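{- Let $\omega,\pi:[0,a]\to[0,b]$ be continuous non-increasing functions with $\pi(x)\le\omega(x)$ for all $x\in[0,a]$, and suppose that $\operatorname{area}(\omega/\pi)=1$. Let $\{\upsilon_n=\lambda^{(n)}/\mu^{(n)}\}$ be a sequence of connected skew shapes with stable shape $\omega/\pi$, i.e. $\lambda^{(n)}\to\omega$ and $\mu^{(n)}\to\pi$. Then $$\log e(\upsilon_n)\ \sim\ \frac12\,n\log n\qquad\text{as } n\to\infty.$$
   Context: $e(\lambda/\mu)$ is the number of standard Young tableaux of skew shape $\lambda/\mu$; $\log$ is the natural logarithm; $\sim$ means that the ratio tends to $1$. $\operatorname{area}(\omega/\pi)$ is the area of the region $\mathcal{C}=\{(x,y):0\le x\le a,\ \pi(x)\le y\le\omega(x)\}$. Stable shape: for a partition $\lambda$, let $[\lambda]$ denote the boundary curve of its Young diagram, viewed as the function $[\lambda](x)=\lambda_{\lceil x\rceil}$ for $x>0$ and $[\lambda](0)=\lambda_1$ (with $\lambda_i=0$ for $i$ greater than the number of parts $\ell(\lambda)$). The rescaled diagram $\frac{1}{\sqrt n}[\lambda]$ is obtained by contracting by a factor $1/\sqrt n$ in both directions, i.e. it is the function $x\mapsto\frac{1}{\sqrt n}[\lambda](x\sqrt n)$. A sequence of partitions $\{\lambda^{(n)}\}$ has stable shape $\omega$, written $\lambda^{(n)}\to\omega$, if the rescaled diagrams $\frac{1}{\sqrt n}[\lambda^{(n)}]$ converge uniformly to $\omega$ on $[0,a]$ as $n\to\infty$, and the rescaled diagrams do not asymptotically extend beyond $x=a$,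 i.e. $\ell(\lambda^{(n)})\le(a+o(1))\sqrt n$. -}

module Defs where

import Data.Nat as ℕ
import Data.Nat.Properties as ℕₚ
open import Data.Nat using (ℕ; zero; suc)
import Data.Integer as ℤ
import Data.Integer.Properties as ℤₚ
open import Data.Integer using (ℤ; +_)
import Data.Rational.Unnormalised as ℚᵘ
import Data.Rational.Unnormalised.Properties as ℚᵘₚ
import Data.Rational as ℚ
import Data.Rational.Properties as ℚₚ
open import Data.Rational using (ℚ; 0ℚ; 1ℚ)
open import Data.Rational.Solver using (module +-*-Solver)
import Data.Nat.Solver as ℕSolver
open import Data.Fin using (Fin; finToFun)
import Data.Fin as Fin
import Data.Fin.Properties as Finₚ
open import Data.List using (List; []; _∷_; length; filter; lookup; cartesianProduct; upTo; allFin)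
open import Data.List.Membership.Propositional using (_∈_)
open import Data.List.Relation.Unary.All using (All)
open import Data.List.Relation.Unary.Linked using (Linked)
open import Data.List.Relation.Unary.Unique.Propositional using (Unique)
open import Data.Product using (Σ; Σ-syntax; ∃; ∃-syntax; _×_; _,_; proj₁; proj₂)
open import Data.Sum using (_⊎_; inj₁; inj₂)
open import Function using (_∘_)
open import Relation.Binary.Construct.Closure.ReflexiveTransitive using (Star)
open import Relation.Nullary using (Dec; yes; no; contradiction)
open import Relation.Nullary.Decidable using (_×-dec_; _→-dec_)
open import Relation.Binary.PropositionalEquality

Eventually : (ℕ → Set) → Set
Eventually P = ∃[ N ] ∀ n → N ℕ.≤ n → P n

frac : ℕ → ℕ → ℚ
frac a d = + a ℚ./ suc d

toℚᵘ-frac : ∀ a d → ℚ.toℚᵘ (frac a d) ℚᵘ.≃ ℚᵘ.mkℚᵘ (+ a) d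
toℚᵘ-frac a d = ℚₚ.toℚᵘ-fromℚᵘ (ℚᵘ.mkℚᵘ (+ a) d)

frac-mono-≤ : ∀ a b c d → a ℕ.* suc d ℕ.≤ c ℕ.* suc b → frac a b ℚ.≤ frac c d
frac-mono-≤ a b c d h = ℚₚ.toℚᵘ-cancel-≤
  (ℚᵘₚ.≤-respˡ-≃ (ℚᵘₚ.≃-sym (toℚᵘ-frac a b))
  (ℚᵘₚ.≤-respʳ-≃ (ℚᵘₚ.≃-sym (toℚᵘ-frac c d))
  (ℚᵘ.*≤* (subst₂ ℤ._≤_ (ℤₚ.pos-* a (suc d)) (ℤₚ.pos-* c (suc b)) (ℤ.+≤+ h)))))

frac-cong : ∀ a b c d → a ℕ.* suc d ≡ c ℕ.* suc b → frac a b ≡ frac c d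
frac-cong a b c d h = ℚₚ.≤-antisym
  (frac-mono-≤ a b c d (ℕₚ.≤-reflexive h)) (frac-mono-≤ c d a b (ℕₚ.≤-reflexive (sym h)))

frac-+ : ∀ a b d → frac a d ℚ.+ frac b d ≡ frac (a ℕ.+ b) d
frac-+ a b d = ℚₚ.toℚᵘ-injective
  (ℚᵘₚ.≃-trans (ℚₚ.toℚᵘ-homo-+ (frac a d) (frac b d))
  (ℚᵘₚ.≃-trans (ℚᵘₚ.+-cong (toℚᵘ-frac a d) (toℚᵘ-frac b d))
  (ℚᵘₚ.≃-trans (ℚᵘ.*≡* same) (ℚᵘₚ.≃-sym (toℚᵘ-frac (a ℕ.+ b) d)))))
  where
  open ℕSolver.+-*-Solver
  same : ((+ a) ℤ.* (+ suc d) ℤ.+ (+ b) ℤ.* (+ suc d)) ℤ.* (+ suc d)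
       ≡ (+ (a ℕ.+ b)) ℤ.* (+ (suc d ℕ.* suc d))
  same rewrite sym (ℤₚ.pos-* a (suc d)) | sym (ℤₚ.pos-* b (suc d))
             | sym (ℤₚ.pos-* (a ℕ.* suc d ℕ.+ b ℕ.* suc d) (suc d))
             | sym (ℤₚ.pos-* (a ℕ.+ b) (suc d ℕ.* suc d)) =
    cong +_ (solve 3 (λ a b d → (a :* d :+ b :* d) :* d := (a :+ b) :* (d :* d)) refl a b (suc d))

frac-nonNeg : ∀ a d → 0ℚ ℚ.≤ frac a d
frac-nonNeg a d = frac-mono-≤ 0 0 a d ℕ.z≤n

0<1ℚ : 0ℚ ℚ.< 1ℚ
0<1ℚ = ℚₚ.positive⁻¹ 1ℚ

archimedean : ∀ ε → 0ℚ ℚ.< ε → ∃[ N ] frac 1 N ℚ.≤ ε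
archimedean ε@(ℚ.mkℚ (+ suc p) d _) _ = d ,
  subst (frac 1 d ℚ.≤_) (ℚₚ.↥p/↧p≡p ε) (frac-mono-≤ 1 d (suc p) d (ℕₚ.*-monoˡ-≤ (suc d) {1} {suc p} (ℕ.s≤s ℕ.z≤n)))
archimedean (ℚ.mkℚ (+ 0) d _) (ℚ.*<* h) = contradiction (subst₂ ℤ._<_ refl (ℤₚ.*-zeroˡ (+ 1)) h) (ℤₚ.<-irrefl refl)
archimedean (ℚ.mkℚ (ℤ.-[1+ p ]) d _) (ℚ.*<* ())

*-pos : ∀ {p q} → 0ℚ ℚ.< p → 0ℚ ℚ.< q → 0ℚ ℚ.< p ℚ.* q
*-pos {p} {q} 0<p 0<q =
  subst (ℚ._< p ℚ.* q) (ℚₚ.*-zeroʳ p) (ℚₚ.*-monoʳ-<-pos p {{ℚ.positive 0<p}} 0<q)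

positive-inverse : ∀ p → 0ℚ ℚ.< p → ∃[ q ] 0ℚ ℚ.< q × p ℚ.* q ≡ 1ℚ
positive-inverse p@record{} 0<p =
  let instance p⁺ = ℚ.positive 0<p
      q = ℚ.1/_ p {{ℚₚ.pos⇒nonZero p}}
  in q , ℚₚ.positive⁻¹ q {{ℚₚ.1/pos⇒pos p}} , ℚₚ.*-inverseʳ p {{ℚₚ.pos⇒nonZero p}}

*-mono-≤-nonNeg : ∀ {p q r s} → 0ℚ ℚ.≤ r → 0ℚ ℚ.≤ q → p ℚ.≤ q → r ℚ.≤ s → p ℚ.* r ℚ.≤ q ℚ.* s
*-mono-≤-nonNeg {p} {q} {r} {s} 0≤r 0≤q p≤q r≤s = ℚₚ.≤-trans
  (ℚₚ.*-monoʳ-≤-nonNeg r {{ℚ.nonNegative 0≤r}} p≤q)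
  (ℚₚ.*-monoˡ-≤-nonNeg q {{ℚ.nonNegative 0≤q}} r≤s)

∣-∣≤ : ∀ {p q c} → p ℚ.≤ q ℚ.+ c → q ℚ.≤ p ℚ.+ c → ℚ.∣ p ℚ.- q ∣ ℚ.≤ c
∣-∣≤ {p} {q} {c} h₁ h₂ with ℚₚ.∣p∣≡p∨∣p∣≡-p (p ℚ.- q)
... | inj₁ eq = subst₂ ℚ._≤_ (sym eq)
        (solve 2 (λ q c → (q :+ c) :+ (:- q) := c) refl q c) (ℚₚ.+-monoˡ-≤ (ℚ.- q) h₁)
  where open +-*-Solver
... | inj₂ eq = subst₂ ℚ._≤_
        (trans (solve 2 (λ p q → q :+ (:- p) := :- (p :+ (:- q))) refl p q) (sym eq))
        (solve 2 (λ p c → (p :+ c) :+ (:- p) := c) refl p c) (ℚₚ.+-monoˡ-≤ (ℚ.- p) h₂)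
  where open +-*-Solver

∣p∣≤∣p-q∣+∣q∣ : ∀ p q → ℚ.∣ p ∣ ℚ.≤ ℚ.∣ p ℚ.- q ∣ ℚ.+ ℚ.∣ q ∣
∣p∣≤∣p-q∣+∣q∣ p q = subst (λ t → ℚ.∣ t ∣ ℚ.≤ ℚ.∣ p ℚ.- q ∣ ℚ.+ ℚ.∣ q ∣)
  (solve 2 (λ p q → (p :+ (:- q)) :+ q := p) refl p q) (ℚₚ.∣p+q∣≤∣p∣+∣q∣ (p ℚ.- q) q)
  where open +-*-Solver

∣-∣-comm : ∀ p q → ℚ.∣ p ℚ.- q ∣ ≡ ℚ.∣ q ℚ.- p ∣
∣-∣-comm p q = trans (sym (ℚₚ.∣-p∣≡∣p∣ (p ℚ.- q)))
  (cong ℚ.∣_∣ (solve 2 (λ p q → :- (p :+ (:- q)) := q :+ (:- p)) refl p q))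
  where open +-*-Solver

-- Real numbers are Cauchy sequences of rationals; equality is the setoid
-- relation _≈_.

IsCauchy : (ℕ → ℚ) → Set
IsCauchy s = ∀ ε → 0ℚ ℚ.< ε → ∃[ N ] ∀ m n → N ℕ.≤ m → N ℕ.≤ n → ℚ.∣ s m ℚ.- s n ∣ ℚ.≤ ε

record ℝ : Set where
  constructor mkℝ
  field
    seq    : ℕ → ℚ
    cauchy : IsCauchy seq
open ℝ public

infix 4 _≤_ _<_ _≈_

_≤_ : ℝ → ℝ → Set
x ≤ y = ∀ ε → 0ℚ ℚ.< ε → Eventually λ k → seq x k ℚ.≤ seq y k ℚ.+ ε

_<_ : ℝ → ℝ → Set
x < y = ∃[ ε ] 0ℚ ℚ.< ε × Eventually λ k → seq x k ℚ.+ ε ℚ.≤ seq y k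

_≈_ : ℝ → ℝ → Set
x ≈ y = x ≤ y × y ≤ x

fromℚ : ℚ → ℝ
fromℚ q = mkℝ (λ _ → q) λ ε 0<ε → 0 , λ _ _ _ _ →
  subst (λ t → ℚ.∣ t ∣ ℚ.≤ ε) (sym (ℚₚ.+-inverseʳ q)) (ℚₚ.<⇒≤ 0<ε)

fromℤ : ℤ → ℝ
fromℤ i = fromℚ (i ℚ./ 1)

fromℕ : ℕ → ℝ
fromℕ n = fromℤ (+ n)

0ℝ 1ℝ : ℝ
0ℝ = fromℕ 0
1ℝ = fromℕ 1

halve : ∀ {ε} → 0ℚ ℚ.< ε → 0ℚ ℚ.< ℚ.½ ℚ.* ε
halve = *-pos (ℚₚ.positive⁻¹ ℚ.½)

½+½ : ∀ ε → ℚ.½ ℚ.* ε ℚ.+ ℚ.½ ℚ.* ε ≡ ε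
½+½ ε = trans (sym (ℚₚ.*-distribʳ-+ ε ℚ.½ ℚ.½)) (ℚₚ.*-identityˡ ε)

infixl 6 _+_ _-_
infixl 7 _*_
infix  8 -_

_+_ : ℝ → ℝ → ℝ
x + y = mkℝ (λ k → seq x k ℚ.+ seq y k) λ ε 0<ε →
  let (M , p) = cauchy x (ℚ.½ ℚ.* ε) (halve 0<ε)
      (N , q) = cauchy y (ℚ.½ ℚ.* ε) (halve 0<ε)
  in M ℕ.⊔ N , λ m n hm hn →
    subst₂ ℚ._≤_
      (cong ℚ.∣_∣ (solve 4 (λ a b c d → (a :+ (:- b)) :+ (c :+ (:- d)) := (a :+ c) :+ (:- (b :+ d))) refl
        (seq x m) (seq x n) (seq y m) (seq y n)))
      (½+½ ε)
      (ℚₚ.≤-trans (ℚₚ.∣p+q∣≤∣p∣+∣q∣ (seq x m ℚ.- seq x n) (seq y m ℚ.- seq y n))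
        (ℚₚ.+-mono-≤
          (p m n (ℕₚ.≤-trans (ℕₚ.m≤m⊔n M N) hm) (ℕₚ.≤-trans (ℕₚ.m≤m⊔n M N) hn))
          (q m n (ℕₚ.≤-trans (ℕₚ.m≤n⊔m M N) hm) (ℕₚ.≤-trans (ℕₚ.m≤n⊔m M N) hn))))
  where open +-*-Solver

-_ : ℝ → ℝ
- x = mkℝ (λ k → ℚ.- seq x k) λ ε 0<ε →
  let (N , p) = cauchy x ε 0<ε
  in N , λ m n hm hn → subst (ℚ._≤ ε)
    (trans (sym (ℚₚ.∣-p∣≡∣p∣ (seq x m ℚ.- seq x n)))
      (cong ℚ.∣_∣ (solve 2 (λ a b → :- (a :+ (:- b)) := (:- a) :+ (:- (:- b))) refl (seq x m) (seq x n))))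
    (p m n hm hn)
  where open +-*-Solver

_-_ : ℝ → ℝ → ℝ
x - y = x + (- y)

∣_∣ : ℝ → ℝ
∣ x ∣ = mkℝ (λ k → ℚ.∣ seq x k ∣) λ ε 0<ε →
  let (N , p) = cauchy x ε 0<ε
      half : ∀ m n → N ℕ.≤ m → N ℕ.≤ n → ℚ.∣ seq x m ∣ ℚ.≤ ℚ.∣ seq x n ∣ ℚ.+ ε
      half m n hm hn = ℚₚ.≤-trans (∣p∣≤∣p-q∣+∣q∣ (seq x m) (seq x n))
        (subst (ℚ._≤ ℚ.∣ seq x n ∣ ℚ.+ ε) (ℚₚ.+-comm ℚ.∣ seq x n ∣ _)
          (ℚₚ.+-monoʳ-≤ ℚ.∣ seq x n ∣ (p m n hm hn)))
  in N , λ m n hm hn → ∣-∣≤ (half m n hm hn) (half n m hn hm)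

eventually-bounded : (x : ℝ) → ∃[ B ] 0ℚ ℚ.≤ B × Eventually λ k → ℚ.∣ seq x k ∣ ℚ.≤ B
eventually-bounded x =
  let (N , p) = cauchy x 1ℚ 0<1ℚ
  in 1ℚ ℚ.+ ℚ.∣ seq x N ∣
   , ℚₚ.+-mono-≤ (ℚₚ.<⇒≤ 0<1ℚ) (ℚₚ.0≤∣p∣ (seq x N))
   , N , λ k hk → ℚₚ.≤-trans (∣p∣≤∣p-q∣+∣q∣ (seq x k) (seq x N))
       (ℚₚ.+-monoˡ-≤ ℚ.∣ seq x N ∣ (p k N hk ℕₚ.≤-refl))

_*_ : ℝ → ℝ → ℝ
x * y = mkℝ (λ k → seq x k ℚ.* seq y k) cau
  where
  open +-*-Solver
  cau : IsCauchy (λ k → seq x k ℚ.* seq y k)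
  cau ε 0<ε =
    let (B , 0≤B , Nx , bx) = eventually-bounded x
        (C , 0≤C , Ny , by) = eventually-bounded y
        D = 1ℚ ℚ.+ (B ℚ.+ C)
        0<D = ℚₚ.+-mono-<-≤ 0<1ℚ (ℚₚ.+-mono-≤ 0≤B 0≤C)
        (D⁻¹ , 0<D⁻¹ , D·D⁻¹) = positive-inverse D 0<D
        η = ℚ.½ ℚ.* (ε ℚ.* D⁻¹)
        0<η : 0ℚ ℚ.< η
        0<η = halve (*-pos 0<ε 0<D⁻¹)
        (M , p) = cauchy x η 0<η
        (N , q) = cauchy y η 0<η
        B≤D : B ℚ.≤ D
        B≤D = subst₂ ℚ._≤_ (solve 1 (λ b → (con 0ℚ :+ b) :+ con 0ℚ := b) refl B)
                (solve 2 (λ b c → (con 1ℚ :+ b) :+ c := con 1ℚ :+ (b :+ c)) refl B C)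
                (ℚₚ.+-mono-≤ (ℚₚ.+-monoˡ-≤ B (ℚₚ.<⇒≤ 0<1ℚ)) 0≤C)
        C≤D : C ℚ.≤ D
        C≤D = subst₂ ℚ._≤_ (solve 1 (λ c → (con 0ℚ :+ con 0ℚ) :+ c := c) refl C)
                (solve 2 (λ b c → (con 1ℚ :+ b) :+ c := con 1ℚ :+ (b :+ c)) refl B C)
                (ℚₚ.+-monoˡ-≤ C (ℚₚ.+-mono-≤ (ℚₚ.<⇒≤ 0<1ℚ) 0≤B))
        Dη+Dη : D ℚ.* η ℚ.+ D ℚ.* η ≡ ε
        Dη+Dη = trans
          (solve 4 (λ d h e i → d :* (h :* (e :* i)) :+ d :* (h :* (e :* i)) := (d :* i) :* (h :* e :+ h :* e)) refl D ℚ.½ ε D⁻¹)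
          (trans (cong₂ ℚ._*_ D·D⁻¹ (½+½ ε)) (ℚₚ.*-identityˡ ε))
    in (Nx ℕ.⊔ Ny) ℕ.⊔ (M ℕ.⊔ N) , λ m n hm hn →
      let hNx : ∀ {k} → (Nx ℕ.⊔ Ny) ℕ.⊔ (M ℕ.⊔ N) ℕ.≤ k → Nx ℕ.≤ k
          hNx = ℕₚ.≤-trans (ℕₚ.≤-trans (ℕₚ.m≤m⊔n Nx Ny) (ℕₚ.m≤m⊔n (Nx ℕ.⊔ Ny) (M ℕ.⊔ N)))
          hNy : ∀ {k} → (Nx ℕ.⊔ Ny) ℕ.⊔ (M ℕ.⊔ N) ℕ.≤ k → Ny ℕ.≤ k
          hNy = ℕₚ.≤-trans (ℕₚ.≤-trans (ℕₚ.m≤n⊔m Nx Ny) (ℕₚ.m≤m⊔n (Nx ℕ.⊔ Ny) (M ℕ.⊔ N)))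
          hM : ∀ {k} → (Nx ℕ.⊔ Ny) ℕ.⊔ (M ℕ.⊔ N) ℕ.≤ k → M ℕ.≤ k
          hM = ℕₚ.≤-trans (ℕₚ.≤-trans (ℕₚ.m≤m⊔n M N) (ℕₚ.m≤n⊔m (Nx ℕ.⊔ Ny) (M ℕ.⊔ N)))
          hN : ∀ {k} → (Nx ℕ.⊔ Ny) ℕ.⊔ (M ℕ.⊔ N) ℕ.≤ k → N ℕ.≤ k
          hN = ℕₚ.≤-trans (ℕₚ.≤-trans (ℕₚ.m≤n⊔m M N) (ℕₚ.m≤n⊔m (Nx ℕ.⊔ Ny) (M ℕ.⊔ N)))
          xm = seq x m
          xn = seq x n
          ym = seq y m
          yn = seq y n
          part₁ : ℚ.∣ xm ℚ.* (ym ℚ.- yn) ∣ ℚ.≤ D ℚ.* η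
          part₁ = subst (ℚ._≤ D ℚ.* η) (sym (ℚₚ.∣p*q∣≡∣p∣*∣q∣ xm (ym ℚ.- yn)))
            (*-mono-≤-nonNeg (ℚₚ.0≤∣p∣ (ym ℚ.- yn)) (ℚₚ.<⇒≤ 0<D)
              (ℚₚ.≤-trans (bx m (hNx hm)) B≤D) (q m n (hN hm) (hN hn)))
          part₂ : ℚ.∣ yn ℚ.* (xm ℚ.- xn) ∣ ℚ.≤ D ℚ.* η
          part₂ = subst (ℚ._≤ D ℚ.* η) (sym (ℚₚ.∣p*q∣≡∣p∣*∣q∣ yn (xm ℚ.- xn)))
            (*-mono-≤-nonNeg (ℚₚ.0≤∣p∣ (xm ℚ.- xn)) (ℚₚ.<⇒≤ 0<D)
              (ℚₚ.≤-trans (by n (hNy hn)) C≤D) (p m n (hM hm) (hM hn)))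
      in subst₂ ℚ._≤_
           (cong ℚ.∣_∣ (solve 4 (λ a b c d → a :* (c :+ (:- d)) :+ d :* (a :+ (:- b)) := a :* c :+ (:- (b :* d))) refl xm xn ym yn))
           Dη+Dη
           (ℚₚ.≤-trans (ℚₚ.∣p+q∣≤∣p∣+∣q∣ (xm ℚ.* (ym ℚ.- yn)) (yn ℚ.* (xm ℚ.- xn)))
             (ℚₚ.+-mono-≤ part₁ part₂))

_#0 : ℝ → Set
x #0 = 0ℝ < ∣ x ∣

-- The junk value at 0ℚ affects only finitely many terms of a sequence
-- representing a real number apart from 0.
recipℚ : ℚ → ℚ
recipℚ q with q ℚₚ.≟ 0ℚ
... | yes _   = 0ℚ
... | no  q≢0 = ℚ.1/_ q {{ℚ.≢-nonZero q≢0}}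

recipℚ-inverse : ∀ q → 0ℚ ℚ.< ℚ.∣ q ∣ → q ℚ.* recipℚ q ≡ 1ℚ
recipℚ-inverse q h with q ℚₚ.≟ 0ℚ
... | yes refl = contradiction h (ℚₚ.<-irrefl refl)
... | no  q≢0  = ℚₚ.*-inverseʳ q {{ℚ.≢-nonZero q≢0}}

inv : (x : ℝ) → x #0 → ℝ
inv x (δ , 0<δ , N₀ , away) = mkℝ (λ k → recipℚ (seq x k)) cau
  where
  open +-*-Solver
  away′ : ∀ k → N₀ ℕ.≤ k → δ ℚ.≤ ℚ.∣ seq x k ∣
  away′ k h = subst (ℚ._≤ ℚ.∣ seq x k ∣) (ℚₚ.+-identityˡ δ) (away k h)
  cau : IsCauchy (λ k → recipℚ (seq x k))
  cau ε 0<ε =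
    let (N , p) = cauchy x (ε ℚ.* (δ ℚ.* δ)) (*-pos 0<ε (*-pos 0<δ 0<δ))
    in N₀ ℕ.⊔ N , λ m n hm hn →
      let xm = seq x m
          xn = seq x n
          rm = recipℚ xm
          rn = recipℚ xn
          δ≤xm = away′ m (ℕₚ.≤-trans (ℕₚ.m≤m⊔n N₀ N) hm)
          δ≤xn = away′ n (ℕₚ.≤-trans (ℕₚ.m≤m⊔n N₀ N) hn)
          xm·rm = recipℚ-inverse xm (ℚₚ.<-≤-trans 0<δ δ≤xm)
          xn·rn = recipℚ-inverse xn (ℚₚ.<-≤-trans 0<δ δ≤xn)
          close = p n m (ℕₚ.≤-trans (ℕₚ.m≤n⊔m N₀ N) hn) (ℕₚ.≤-trans (ℕₚ.m≤n⊔m N₀ N) hm)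
          identity : (rm ℚ.- rn) ℚ.* (xm ℚ.* xn) ≡ xn ℚ.- xm
          identity = trans
            (solve 4 (λ rm rn xm xn → (rm :+ (:- rn)) :* (xm :* xn) := (xm :* rm) :* xn :+ (:- ((xn :* rn) :* xm))) refl rm rn xm xn)
            (cong₂ (λ u v → u ℚ.+ (ℚ.- v))
              (trans (cong (ℚ._* xn) xm·rm) (ℚₚ.*-identityˡ xn))
              (trans (cong (ℚ._* xm) xn·rn) (ℚₚ.*-identityˡ xm)))
          scaled : ℚ.∣ rm ℚ.- rn ∣ ℚ.* (δ ℚ.* δ) ℚ.≤ ε ℚ.* (δ ℚ.* δ)
          scaled = ℚₚ.≤-trans
            (*-mono-≤-nonNeg (ℚₚ.<⇒≤ (*-pos 0<δ 0<δ)) (ℚₚ.0≤∣p∣ (rm ℚ.- rn)) ℚₚ.≤-refl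
              (*-mono-≤-nonNeg (ℚₚ.<⇒≤ 0<δ) (ℚₚ.0≤∣p∣ xm) δ≤xm δ≤xn))
            (subst (ℚ._≤ ε ℚ.* (δ ℚ.* δ))
              (trans (cong ℚ.∣_∣ (sym identity))
                (trans (ℚₚ.∣p*q∣≡∣p∣*∣q∣ (rm ℚ.- rn) (xm ℚ.* xn))
                  (cong (ℚ.∣ rm ℚ.- rn ∣ ℚ.*_) (ℚₚ.∣p*q∣≡∣p∣*∣q∣ xm xn))))
              close)
      in ℚₚ.*-cancelʳ-≤-pos (δ ℚ.* δ) {{ℚ.positive (*-pos 0<δ 0<δ)}} scaled

isCauchy-1/ : (s : ℕ → ℚ) →
              (∀ m n → s m ℚ.≤ s n ℚ.+ (frac 1 m ℚ.+ frac 1 n)) → IsCauchy s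
isCauchy-1/ s h ε 0<ε =
  let (N , p) = archimedean (ℚ.½ ℚ.* ε) (halve 0<ε)
      small : ∀ m n → N ℕ.≤ m → N ℕ.≤ n → frac 1 m ℚ.+ frac 1 n ℚ.≤ ε
      small m n hm hn = subst (frac 1 m ℚ.+ frac 1 n ℚ.≤_) (½+½ ε)
        (ℚₚ.+-mono-≤ (ℚₚ.≤-trans (mono hm) p) (ℚₚ.≤-trans (mono hn) p))
      half : ∀ m n → N ℕ.≤ m → N ℕ.≤ n → s m ℚ.≤ s n ℚ.+ ε
      half m n hm hn = ℚₚ.≤-trans (h m n) (ℚₚ.+-monoʳ-≤ (s n) (small m n hm hn))
  in N , λ m n hm hn → ∣-∣≤ (half m n hm hn) (half n m hn hm)
  where
  mono : ∀ {N m} → N ℕ.≤ m → frac 1 m ℚ.≤ frac 1 N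
  mono {N} {m} N≤m = frac-mono-≤ 1 m 1 N (ℕₚ.*-monoʳ-≤ 1 (ℕ.s≤s N≤m))

isqrt : ℕ → ℕ
isqrt zero = zero
isqrt (suc m) with suc (isqrt m) ℕ.* suc (isqrt m) ℕ.≤? suc m
... | yes _ = suc (isqrt m)
... | no  _ = isqrt m

isqrt-lower : ∀ m → isqrt m ℕ.* isqrt m ℕ.≤ m
isqrt-lower zero = ℕ.z≤n
isqrt-lower (suc m) with suc (isqrt m) ℕ.* suc (isqrt m) ℕ.≤? suc m
... | yes h = h
... | no  _ = ℕₚ.m≤n⇒m≤1+n (isqrt-lower m)

isqrt-upper : ∀ m → m ℕ.< suc (isqrt m) ℕ.* suc (isqrt m)
isqrt-upper zero = ℕ.s≤s ℕ.z≤n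
isqrt-upper (suc m) with suc (isqrt m) ℕ.* suc (isqrt m) ℕ.≤? suc m
... | yes _ = ℕₚ.≤-<-trans (isqrt-upper m)
                (ℕₚ.*-mono-< (ℕₚ.n<1+n (suc (isqrt m))) (ℕₚ.n<1+n (suc (isqrt m))))
... | no  h = ℕₚ.≰⇒> h

square-cancel-< : ∀ p q → p ℕ.* p ℕ.< q ℕ.* q → p ℕ.< q
square-cancel-< p q h = ℕₚ.≰⇒> λ q≤p → ℕₚ.<⇒≱ h (ℕₚ.*-mono-≤ q≤p q≤p)

-- ⌊K √n⌋ / K with K = k + 1
√-approx : ℕ → ℕ → ℚ
√-approx n k = frac (isqrt (n ℕ.* (suc k ℕ.* suc k))) k

√_ : ℕ → ℝ
√ n = mkℝ (√-approx n) (isCauchy-1/ (√-approx n) bound)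
  where
  open ℕSolver.+-*-Solver
  r : ℕ → ℕ
  r k = isqrt (n ℕ.* (suc k ℕ.* suc k))
  cross : ∀ k l → r k ℕ.* suc l ℕ.< suc (r l) ℕ.* suc k
  cross k l = square-cancel-< (r k ℕ.* suc l) (suc (r l) ℕ.* suc k) (ℕₚ.≤-<-trans
    (ℕₚ.≤-trans (ℕₚ.≤-reflexive (solve 2 (λ r l → (r :* l) :* (r :* l) := (r :* r) :* (l :* l)) refl (r k) (suc l)))
      (ℕₚ.≤-trans (ℕₚ.*-monoˡ-≤ (suc l ℕ.* suc l) (isqrt-lower (n ℕ.* (suc k ℕ.* suc k))))
        (ℕₚ.≤-reflexive (solve 3 (λ n k l → (n :* (k :* k)) :* (l :* l) := (n :* (l :* l)) :* (k :* k)) refl n (suc k) (suc l)))))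
    (ℕₚ.<-≤-trans (ℕₚ.*-monoˡ-< (suc k ℕ.* suc k) (isqrt-upper (n ℕ.* (suc l ℕ.* suc l))))
      (ℕₚ.≤-reflexive (solve 2 (λ r k → (r :* r) :* (k :* k) := (r :* k) :* (r :* k)) refl (suc (r l)) (suc k)))))
  bound : ∀ k l → √-approx n k ℚ.≤ √-approx n l ℚ.+ (frac 1 k ℚ.+ frac 1 l)
  bound k l = ℚₚ.≤-trans (frac-mono-≤ (r k) k (suc (r l)) l (ℕₚ.<⇒≤ (cross k l)))
    (ℚₚ.≤-trans (ℚₚ.≤-reflexive (trans (cong (λ t → frac t l) (ℕₚ.+-comm 1 (r l))) (sym (frac-+ (r l) 1 l))))
      (ℚₚ.+-monoʳ-≤ (√-approx n l)
        (subst (ℚ._≤ frac 1 k ℚ.+ frac 1 l) (ℚₚ.+-identityˡ (frac 1 l))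
          (ℚₚ.+-monoˡ-≤ (frac 1 l) (frac-nonNeg 1 k)))))

√-#0 : ∀ n .{{_ : ℕ.NonZero n}} → (√ n) #0
√-#0 n = 1ℚ , 0<1ℚ , 0 , λ k _ → ℚₚ.≤-trans
    (frac-mono-≤ 1 0 (r k) k (subst₂ ℕ._≤_ (sym (ℕₚ.*-identityˡ (suc k))) (sym (ℕₚ.*-identityʳ (r k))) (large k)))
    (ℚₚ.≤-reflexive (sym (ℚₚ.0≤p⇒∣p∣≡p (frac-nonNeg (r k) k))))
  where
  r : ℕ → ℕ
  r k = isqrt (n ℕ.* (suc k ℕ.* suc k))
  large : ∀ k → suc k ℕ.≤ r k
  large k = ℕ.s≤s⁻¹ (square-cancel-< (suc k) (suc (r k)) (ℕₚ.≤-<-trans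
    (ℕₚ.m≤n*m (suc k ℕ.* suc k) n) (isqrt-upper (n ℕ.* (suc k ℕ.* suc k)))))

1/√_ : (n : ℕ) .{{_ : ℕ.NonZero n}} → ℝ
1/√ n = inv (√ n) (√-#0 n)

Σ< : ℕ → (ℕ → ℚ) → ℚ
Σ< zero    f = 0ℚ
Σ< (suc m) f = Σ< m f ℚ.+ f m

Σ<-cong : ∀ m {f g : ℕ → ℚ} → (∀ i → f i ≡ g i) → Σ< m f ≡ Σ< m g
Σ<-cong zero    h = refl
Σ<-cong (suc m) h = cong₂ ℚ._+_ (Σ<-cong m h) (h m)

Σ<-mono : ∀ m {f g : ℕ → ℚ} → (∀ i → i ℕ.< m → f i ℚ.≤ g i) → Σ< m f ℚ.≤ Σ< m g
Σ<-mono zero    h = ℚₚ.≤-refl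
Σ<-mono (suc m) h = ℚₚ.+-mono-≤ (Σ<-mono m λ i i<m → h i (ℕₚ.m≤n⇒m≤1+n i<m)) (h m ℕₚ.≤-refl)

Σ<-split : ∀ m l (f : ℕ → ℚ) → Σ< (m ℕ.+ l) f ≡ Σ< m f ℚ.+ Σ< l (λ j → f (m ℕ.+ j))
Σ<-split m zero    f rewrite ℕₚ.+-identityʳ m = sym (ℚₚ.+-identityʳ (Σ< m f))
Σ<-split m (suc l) f rewrite ℕₚ.+-suc m l =
  trans (cong (ℚ._+ f (m ℕ.+ l)) (Σ<-split m l f)) (ℚₚ.+-assoc (Σ< m f) _ _)

Σ<-blocks : ∀ m l (f : ℕ → ℚ) → Σ< (m ℕ.* l) f ≡ Σ< m (λ t → Σ< l (λ j → f (t ℕ.* l ℕ.+ j)))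
Σ<-blocks zero    l f = refl
Σ<-blocks (suc m) l f rewrite ℕₚ.+-comm l (m ℕ.* l) =
  trans (Σ<-split (m ℕ.* l) l f)
    (cong (ℚ._+ Σ< l (λ j → f (m ℕ.* l ℕ.+ j))) (Σ<-blocks m l f))

Σ<-telescope : ∀ m (f : ℕ → ℚ) → Σ< m f ℚ.+ f m ≡ Σ< m (f ∘ suc) ℚ.+ f 0
Σ<-telescope zero    f = refl
Σ<-telescope (suc m) f = trans (cong (ℚ._+ f (suc m)) (Σ<-telescope m f))
  (solve 3 (λ a b c → (a :+ b) :+ c := (a :+ c) :+ b) refl (Σ< m (f ∘ suc)) (f 0) (f (suc m)))
  where open +-*-Solver

Σ<-const : ∀ m d → Σ< m (λ _ → frac 1 d) ≡ frac m d
Σ<-const zero    d = frac-cong 0 0 0 d refl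
Σ<-const (suc m) d = trans (cong (ℚ._+ frac 1 d) (Σ<-const m d))
  (trans (frac-+ m 1 d) (cong (λ t → frac t d) (ℕₚ.+-comm m 1)))

-- The left Riemann sum of ∫₁ⁿ dt/t with mesh 1/K, where K = k + 1:
-- the sum of (1/K) · 1/(1 + t/K) = 1/(K + t) over 0 ≤ t < (n − 1) K.
ln-approx : ℕ → ℕ → ℚ
ln-approx n k = Σ< ((n ℕ.∸ 1) ℕ.* suc k) (λ t → frac 1 (k ℕ.+ t))

-- ln n = ∫₁ⁿ dt/t for n ≥ 1; the value at 0 is 0 by convention.
ln : ℕ → ℝ
ln n = mkℝ (ln-approx n) (isCauchy-1/ (ln-approx n) bound)
  where
  open ℕSolver.+-*-Solver
  M : ℕ → ℕ
  M k = (n ℕ.∸ 1) ℕ.* suc k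
  common : ℕ → ℕ → ℕ
  common k l = l ℕ.+ k ℕ.* suc l
  blocks : ∀ k l → ln-approx n (common k l)
         ≡ Σ< (M k) (λ t → Σ< (suc l) (λ j → frac 1 (common k l ℕ.+ (t ℕ.* suc l ℕ.+ j))))
  blocks k l = trans
    (cong (λ t → Σ< t (λ t → frac 1 (common k l ℕ.+ t))) (sym (ℕₚ.*-assoc (n ℕ.∸ 1) (suc k) (suc l))))
    (Σ<-blocks (M k) (suc l) (λ t → frac 1 (common k l ℕ.+ t)))
  regroup : ∀ k l t j → suc (common k l ℕ.+ (t ℕ.* suc l ℕ.+ j)) ≡ suc (k ℕ.+ t) ℕ.* suc l ℕ.+ j
  regroup = solve 4 (λ k l t j → con 1 :+ ((l :+ k :* (con 1 :+ l)) :+ (t :* (con 1 :+ l) :+ j))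
                               := (con 1 :+ (k :+ t)) :* (con 1 :+ l) :+ j) refl
  refine-≤ : ∀ k l → ln-approx n (common k l) ℚ.≤ ln-approx n k
  refine-≤ k l = subst (ℚ._≤ ln-approx n k) (sym (blocks k l)) (Σ<-mono (M k) λ t _ →
    ℚₚ.≤-trans
      (Σ<-mono (suc l) {g = λ _ → frac 1 (common k l ℕ.+ t ℕ.* suc l)} λ j _ →
        frac-mono-≤ 1 (common k l ℕ.+ (t ℕ.* suc l ℕ.+ j)) 1 (common k l ℕ.+ t ℕ.* suc l) (ℕₚ.*-monoʳ-≤ 1 (ℕ.s≤s
          (ℕₚ.+-monoʳ-≤ (common k l) (ℕₚ.m≤m+n (t ℕ.* suc l) j)))))
      (ℚₚ.≤-reflexive (trans (Σ<-const (suc l) (common k l ℕ.+ t ℕ.* suc l))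
        (frac-cong (suc l) (common k l ℕ.+ t ℕ.* suc l) 1 (k ℕ.+ t)
          (solve 3 (λ k l t → (con 1 :+ l) :* (con 1 :+ (k :+ t))
                           := con 1 :* (con 1 :+ ((l :+ k :* (con 1 :+ l)) :+ t :* (con 1 :+ l)))) refl k l t)))))
  refine-≥ : ∀ k l → ln-approx n k ℚ.≤ ln-approx n (common k l) ℚ.+ frac 1 k
  refine-≥ k l = ℚₚ.≤-trans
    (subst (ℚ._≤ ln-approx n k ℚ.+ frac 1 (k ℕ.+ M k)) (ℚₚ.+-identityʳ (ln-approx n k))
      (ℚₚ.+-monoʳ-≤ (ln-approx n k) (frac-nonNeg 1 (k ℕ.+ M k))))
    (subst₂ ℚ._≤_ (sym (Σ<-telescope (M k) (λ t → frac 1 (k ℕ.+ t))))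
      (cong₂ ℚ._+_ (sym (blocks k l)) (cong (frac 1) (ℕₚ.+-identityʳ k)))
      (ℚₚ.+-monoˡ-≤ (frac 1 (k ℕ.+ 0)) (Σ<-mono (M k) λ t _ → ℚₚ.≤-trans
        (ℚₚ.≤-reflexive (trans
          (frac-cong 1 (k ℕ.+ suc t) (suc l) (l ℕ.+ (k ℕ.+ suc t) ℕ.* suc l)
            (solve 3 (λ k l t → con 1 :* (con 1 :+ (l :+ (k :+ (con 1 :+ t)) :* (con 1 :+ l)))
                             := (con 1 :+ l) :* (con 1 :+ (k :+ (con 1 :+ t)))) refl k l t))
          (sym (Σ<-const (suc l) (l ℕ.+ (k ℕ.+ suc t) ℕ.* suc l)))))
        (Σ<-mono (suc l) λ j j<l → frac-mono-≤ 1 (l ℕ.+ (k ℕ.+ suc t) ℕ.* suc l) 1 (common k l ℕ.+ (t ℕ.* suc l ℕ.+ j))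
          (ℕₚ.*-monoʳ-≤ 1 (subst₂ ℕ._≤_ (sym (regroup k l t j))
            (solve 3 (λ k l t → (con 1 :+ (k :+ t)) :* (con 1 :+ l) :+ (con 1 :+ l)
                             := con 1 :+ (l :+ (k :+ (con 1 :+ t)) :* (con 1 :+ l))) refl k l t)
            (ℕₚ.+-monoʳ-≤ (suc (k ℕ.+ t) ℕ.* suc l) (ℕₚ.<⇒≤ j<l))))))))
  common-comm : ∀ k l → common k l ≡ common l k
  common-comm = solve 2 (λ k l → l :+ k :* (con 1 :+ l) := k :+ l :* (con 1 :+ k)) refl
  bound : ∀ k l → ln-approx n k ℚ.≤ ln-approx n l ℚ.+ (frac 1 k ℚ.+ frac 1 l)
  bound k l = ℚₚ.≤-trans (refine-≥ k l) (ℚₚ.+-mono-≤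
    (subst (λ c → ln-approx n c ℚ.≤ ln-approx n l) (common-comm l k) (refine-≤ l k))
    (subst (ℚ._≤ frac 1 k ℚ.+ frac 1 l) (ℚₚ.+-identityʳ (frac 1 k))
      (ℚₚ.+-monoʳ-≤ (frac 1 k) (frac-nonNeg 1 l))))

Icc : ℝ → ℝ → ℝ → Set
Icc c d x = c ≤ x × x ≤ d

-- A function on [c , d] is given by an operation ℝ → ℝ of which only the
-- values at points of [c , d] are used.  Non-increasing operations respect _≈_.
MapsTo : (ℝ → Set) → (ℝ → Set) → (ℝ → ℝ) → Set
MapsTo I J f = ∀ x → I x → J (f x)

ContinuousOn : (ℝ → Set) → (ℝ → ℝ) → Set
ContinuousOn I f = ∀ x → I x → ∀ ε → 0ℚ ℚ.< ε → ∃[ δ ] 0ℚ ℚ.< δ ×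
  (∀ y → I y → ∣ y - x ∣ ≤ fromℚ δ → ∣ f y - f x ∣ ≤ fromℚ ε)

NonIncreasingOn : (ℝ → Set) → (ℝ → ℝ) → Set
NonIncreasingOn I f = ∀ x y → I x → I y → x ≤ y → f y ≤ f x

-- f n / g n → 1, the ratio being defined for all large n
_∼_ : (ℕ → ℝ) → (ℕ → ℝ) → Set
f ∼ g = ∀ ε → 0ℚ ℚ.< ε → Eventually λ n →
  Σ[ g#0 ∈ (g n) #0 ] ∣ f n * inv (g n) g#0 - 1ℝ ∣ ≤ fromℚ ε

Region : Set₁
Region = ℝ → ℝ → Set

-- The closed square with side 1/(k+1) and lower left corner (i/(k+1) , j/(k+1))
GridSquare : ℕ → ℤ × ℤ → Region
GridSquare k (i , j) x y =
  Icc (fromℚ (i ℚ./ suc k)) (fromℚ ((i ℤ.+ ℤ.1ℤ) ℚ./ suc k)) x ×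
  Icc (fromℚ (j ℚ./ suc k)) (fromℚ ((j ℤ.+ ℤ.1ℤ) ℚ./ suc k)) y

_⊑_ : Region → Region → Set
R ⊑ S = ∀ x y → R x y → S x y

_meets_ : Region → Region → Set
R meets S = ∃[ x ] ∃[ y ] R x y × S x y

gridArea : ℕ → ℕ → ℝ
gridArea k m = fromℚ (+ m ℚ./ (suc k ℕ.* suc k))

-- A is the Jordan content of R: the inner and outer grid approximations of R
-- both have area tending to A as the mesh tends to 0.  I is a subset of the
-- squares inside R and O a superset of those meeting R; since inner area is at
-- most outer area, the two one-sided bounds determine both limits.
HasArea : Region → ℝ → Set
HasArea R A = ∀ ε → 0ℚ ℚ.< ε → Eventually λ k →
  (∃[ I ] Unique I × All (λ s → GridSquare k s ⊑ R) I × A ≤ gridArea k (length I) + fromℚ ε) ×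
  (∃[ O ] (∀ s → GridSquare k s meets R → s ∈ O) × gridArea k (length O) ≤ A + fromℚ ε)

RegionBetween : ℝ → (π ω : ℝ → ℝ) → Region
RegionBetween a π ω x y = Icc 0ℝ a x × Icc (π x) (ω x) y

record Partition : Set where
  field
    parts      : List ℕ
    positive   : All (0 ℕ.<_) parts
    decreasing : Linked ℕ._≥_ parts
open Partition public

ℓ : Partition → ℕ
ℓ λs = length (parts λs)

nth : List ℕ → ℕ → ℕ
nth []       _       = 0
nth (p ∷ ps) zero    = p
nth (p ∷ ps) (suc i) = nth ps i

-- Rows, columns and parts are indexed from 0: row λs i is the part λᵢ₊₁,
-- which is 0 when i ≥ ℓ λs.
row : Partition → ℕ → ℕ
row λs = nth (parts λs)

record SkewShape : Set where
  field
    outer     : Partition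
    inner     : Partition
    contained : ∀ i → row inner i ℕ.≤ row outer i
open SkewShape public

Cell : Set
Cell = ℕ × ℕ

InShape : SkewShape → Cell → Set
InShape υ (i , j) = row (inner υ) i ℕ.≤ j × j ℕ.< row (outer υ) i

inShape? : ∀ υ c → Dec (InShape υ c)
inShape? υ (i , j) = (row (inner υ) i ℕ.≤? j) ×-dec (j ℕ.<? row (outer υ) i)

cells : SkewShape → List Cell
cells υ = filter (inShape? υ) (cartesianProduct (upTo (ℓ (outer υ))) (upTo (row (outer υ) 0)))

size : SkewShape → ℕ
size υ = length (cells υ)

ShareEdge : Cell → Cell → Set
ShareEdge (i , j) (i′ , j′) = ℕ.∣ i - i′ ∣ ℕ.+ ℕ.∣ j - j′ ∣ ≡ 1

Connected : SkewShape → Set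
Connected υ = ∀ c d → InShape υ c → InShape υ d →
  Star (λ c d → InShape υ c × InShape υ d × ShareEdge c d) c d

-- Fillings of the cells, listed in the order of `cells υ`, with entries
-- 0, …, size υ − 1.
Filling : SkewShape → Set
Filling υ = Fin (size υ) → Fin (size υ)

module _ (υ : SkewShape) (T : Filling υ) where

  rowOf colOf : Fin (size υ) → ℕ
  rowOf p = proj₁ (lookup (cells υ) p)
  colOf p = proj₂ (lookup (cells υ) p)

  -- An injective filling uses each entry exactly once.
  IsStandard : Set
  IsStandard =
    (∀ p q → T p ≡ T q → p ≡ q) ×
    (∀ p q → rowOf p ≡ rowOf q → colOf p ℕ.< colOf q → T p Fin.< T q) ×
    (∀ p q → colOf p ≡ colOf q → rowOf p ℕ.< rowOf q → T p Fin.< T q)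

  isStandard? : Dec IsStandard
  isStandard? =
    Finₚ.all? (λ p → Finₚ.all? λ q → (T p Finₚ.≟ T q) →-dec (p Finₚ.≟ q)) ×-dec
    Finₚ.all? (λ p → Finₚ.all? λ q →
      (rowOf p ℕ.≟ rowOf q) →-dec ((colOf p ℕ.<? colOf q) →-dec (T p Finₚ.<? T q))) ×-dec
    Finₚ.all? (λ p → Finₚ.all? λ q →
      (colOf p ℕ.≟ colOf q) →-dec ((rowOf p ℕ.<? rowOf q) →-dec (T p Finₚ.<? T q)))

-- The number of standard Young tableaux; finToFun enumerates all functions
-- Fin N → Fin N by Fin (N ^ N).
e : SkewShape → ℕ
e υ = length (filter (λ k → isStandard? υ (finToFun k)) (allFin (size υ ℕ.^ size υ)))

-- Graph of the boundary curve: [λ](0) = λ₁ and [λ](x) = λ_⌈x⌉ for x > 0, where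
-- ⌈x⌉ = i + 1 means i < x ≤ i + 1.  It is a relation because ⌈_⌉ is not an
-- operation on constructive reals.
Boundary : Partition → ℝ → ℕ → Set
Boundary λs x h =
  (x ≈ 0ℝ × h ≡ row λs 0) ⊎
  (∃[ i ] fromℕ i < x × x ≤ fromℕ (suc i) × h ≡ row λs i)

-- Graph of x ↦ [λ](x √n) / √n
Rescaled : (n : ℕ) .{{_ : ℕ.NonZero n}} → Partition → ℝ → ℝ → Set
Rescaled n λs x y = ∃[ h ] Boundary λs (x * √ n) h × y ≈ 1/√ n * fromℕ h

HasStableShape : (ℕ → Partition) → ℝ → (ℝ → ℝ) → Set
HasStableShape Λ a ω =
  (∀ ε → 0ℚ ℚ.< ε → Eventually λ n → .{{_ : ℕ.NonZero n}} →
    ∀ x y → Icc 0ℝ a x → Rescaled n (Λ n) x y → ∣ y - ω x ∣ ≤ fromℚ ε) ×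
  (∀ ε → 0ℚ ℚ.< ε → Eventually λ n → fromℕ (ℓ (Λ n)) ≤ (a + fromℚ ε) * √ n)

{-# OPTIONS --safe #-}
module Submission where

open import Defs
open import Data.Nat using (ℕ; zero; suc; z≤n; s≤s)
import Data.Nat as ℕ
import Data.Nat.Properties as ℕₚ
open import Data.Nat.DivMod using (m≡m%n+[m/n]*n; m/n*n≤m; m%n<n)
open import Data.Nat.Induction using (<-wellFounded)
import Data.Nat.Solver as ℕSolver
import Data.Integer as ℤ
import Data.Integer.Properties as ℤₚ
open import Data.Integer using (ℤ; +_)
import Data.Rational as ℚ
import Data.Rational.Properties as ℚₚ
open import Data.Rational using (ℚ; 0ℚ; 1ℚ; ½)
open import Data.Rational.Solver using (module +-*-Solver)
import Data.Rational.Unnormalised as ℚᵘ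
import Data.Rational.Unnormalised.Properties as ℚᵘₚ
open import Data.Fin using (Fin; toℕ; fromℕ<; finToFun; funToFin; punchOut; combine; remQuot)
import Data.Fin as Fin
import Data.Fin.Properties as Finₚ
open import Data.List using (List; []; _∷_; _++_; length; map; filter; lookup; cartesianProduct; upTo; allFin)
open import Data.List.Properties using (length-map; length-++; length-upTo; length-tabulate; filter-none; filter-accept; filter-reject)
open import Data.List.Membership.Propositional using (_∈_; _∉_)
open import Data.List.Membership.Propositional.Properties using (∈-lookup; ∈-filter⁺; ∈-filter⁻; ∈-cartesianProduct⁺; ∈-upTo⁺; ∈-allFin; ∈-map⁺; ∈-++⁺ˡ; ∈-++⁺ʳ)
open import Data.List.Membership.Setoid.Properties using (index-injective)
import Data.List.Relation.Unary.Any as Any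
open import Data.List.Relation.Unary.Any using (here; there)
open import Data.List.Relation.Unary.All using (All; []; _∷_)
import Data.List.Relation.Unary.All as All
open import Data.List.Relation.Unary.AllPairs using (AllPairs; []; _∷_)
open import Data.List.Relation.Unary.Linked as Linked using (Linked; [-])
open import Data.List.Relation.Unary.Unique.Propositional using (Unique)
import Data.List.Relation.Unary.Unique.Propositional.Properties as Uniqueₚ
open import Data.List.Relation.Binary.Permutation.Propositional using (_↭_; prep; swap; ↭-refl; ↭-sym; ↭-trans; ↭⇒↭ₛ)
import Data.List.Relation.Binary.Permutation.Setoid.Properties as ↭ₛₚ
import Data.List.Relation.Binary.Permutation.Propositional.Properties as ↭ₚ
open import Data.Product using (∃-syntax; Σ-syntax; _×_; _,_; proj₁; proj₂; uncurry)
open import Data.Product.Properties using (,-injective)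
open import Data.Sum using (_⊎_; inj₁; inj₂; [_,_]′)
open import Data.Sum.Properties using (inj₁-injective; inj₂-injective)
open import Function using (_∘_; id; Injective)
open import Induction.WellFounded using (Acc; acc)
open import Relation.Binary using (tri<; tri≈; tri>)
open import Relation.Binary.PropositionalEquality
open import Relation.Nullary using (Dec; yes; no; contradiction)

-- Both bounds are elementary; write N for the number of cells, s for √n and
-- suppose the diagram has at most C s rows and columns.  A tableau is
-- determined by the word recording the row of each of its entries, so e is at
-- most (C s)^N.  In the other direction, listing the cells by increasing rank
-- i + j, in an arbitrary order within each rank, gives a tableau.  Building
-- such a list by inserting the cells one at a time leaves at least t choices
-- for each cell, except for the first t cells of each rank, whence
-- t^N ≤ e · t^(r t) with r ≤ 2 C s ranks.  Since s is log-comparable to t = s / T,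
-- and r t is a small multiple of n for large T, both bounds are n^(n/2) up to
-- n^(o(n)) as soon as N ∼ n.
--
-- To see N ∼ n, fix a grid of mesh 1/K.  Each grid square inside the region
-- contains (1 − o(1)) n / K² cells of the rescaled skew diagram, because the
-- boundary curves are uniformly close to ω and π.  Conversely every cell lies
-- in a grid square meeting the region unless it is close to an end of its row or
-- its row is close to x = a, and these exceptional cells are few.

-- Bounds on the number of standard tableaux

-- Real numbers here are Cauchy sequences whose order is undecidable, so no argument may split on
-- whether a row lies to the left of x = a or take the ceiling of x √n. Hence the real data are used
-- only at points h/√n and at rational grid points, and every comparison is moved to natural
-- numbers, with s = `isqrt n` or s + 1 in place of √n. Each asymptotic statement becomes a family
-- of inequalities in ℕ indexed by a precision E and valid for all large n: N E and n E differ by at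
-- most n, n^(n E) ≤ e^(2 (E + 3)) and e^(2 E) ≤ n^(n (E + 2)). Logarithms are taken only of the
-- last two. The order of the choices matters: ε fixes E, E fixes a tolerance 1/M, M fixes the mesh
-- 1/K and a finite list of grid squares, and only then is n taken large compared with all of them.
-- This is why uniform closeness of the boundary curves at one fixed tolerance suffices at each
-- stage.

lookup-injective : ∀ {A : Set} {xs : List A} → Unique xs → Injective _≡_ _≡_ (lookup xs)
lookup-injective {xs = _ ∷ _} (_ ∷ u) {Fin.zero} {Fin.zero} _ = refl
lookup-injective {xs = _ ∷ xs} (x∉ ∷ u) {Fin.zero} {Fin.suc j} eq = contradiction eq (All.lookup x∉ (∈-lookup j))
lookup-injective {xs = _ ∷ xs} (x∉ ∷ u) {Fin.suc i} {Fin.zero} eq = contradiction (sym eq) (All.lookup x∉ (∈-lookup i))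
lookup-injective {xs = _ ∷ _} (_ ∷ u) {Fin.suc i} {Fin.suc j} eq = cong Fin.suc (lookup-injective u eq)

injection-into-list : ∀ {A : Set} {m} {ys : List A} (f : Fin m → A) →
  Injective _≡_ _≡_ f → (∀ i → f i ∈ ys) → m ℕ.≤ length ys
injection-into-list f inj mem = Finₚ.injective⇒≤ {f = Any.index ∘ mem}
  λ {i} {j} eq → inj (index-injective (setoid _) (mem i) (mem j) eq)

injective⇒surjective : ∀ {n} (f : Fin n → Fin n) → Injective _≡_ _≡_ f → ∀ y → ∃[ x ] f x ≡ y
injective⇒surjective {suc n} f inj y with Finₚ.any? (λ x → f x Finₚ.≟ y)
... | yes p = p
... | no ∄ = contradiction (Finₚ.injective⇒≤ {f = λ x → punchOut {i = y} {j = f x} (λ eq → ∄ (x , sym eq))}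
                  (λ {i} {j} eq → inj (Finₚ.punchOut-injective (λ e → ∄ (i , sym e)) (λ e → ∄ (j , sym e)) eq)))
               (ℕₚ.<⇒≱ ℕₚ.≤-refl)

inverse : ∀ {n} (f : Fin n → Fin n) → Injective _≡_ _≡_ f →
  ∃[ g ] (∀ y → f (g y) ≡ y) × (∀ x → g (f x) ≡ x)
inverse f inj = (proj₁ ∘ sur) , (proj₂ ∘ sur) , λ x → inj (proj₂ (sur (f x)))
  where sur = injective⇒surjective f inj

funToFin-injective : ∀ {m n} {f g : Fin m → Fin n} → funToFin f ≡ funToFin g → f ≗ g
funToFin-injective {f = f} {g} eq p =
  trans (sym (Finₚ.finToFun-funToFin f p)) (trans (cong (λ k → finToFun k p) eq) (Finₚ.finToFun-funToFin g p))

funToFin-cong : ∀ {m n} {f g : Fin m → Fin n} → f ≗ g → funToFin f ≡ funToFin g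
funToFin-cong {zero} h = refl
funToFin-cong {suc m} h = cong₂ combine (h Fin.zero) (funToFin-cong (h ∘ Fin.suc))

finToFun-injective : ∀ {m n} {j k : Fin (n ℕ.^ m)} → finToFun {n} {m} j ≗ finToFun k → j ≡ k
finToFun-injective {m} {n} {j} {k} h = trans (sym (Finₚ.funToFin-finToFin {m} {n} j))
  (trans (funToFin-cong {m} {n} h) (Finₚ.funToFin-finToFin {m} {n} k))

unique-cells : ∀ υ → Unique (cells υ)
unique-cells υ = Uniqueₚ.filter⁺ (inShape? υ) (Uniqueₚ.cartesianProduct⁺ (Uniqueₚ.upTo⁺ (ℓ (outer υ))) (Uniqueₚ.upTo⁺ (row (outer υ) 0)))

nth-beyond : ∀ ps i → length ps ℕ.≤ i → nth ps i ≡ 0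
nth-beyond []       i       h = refl
nth-beyond (p ∷ ps) (suc i) (s≤s h) = nth-beyond ps i h

row-positive : ∀ (λs : Partition) {i} → 0 ℕ.< row λs i → i ℕ.< ℓ λs
row-positive λs {i} h = ℕₚ.≰⇒> λ ℓ≤i → ℕₚ.<⇒≢ h (sym (nth-beyond (parts λs) i ℓ≤i))

nth-step : ∀ {ps} → Linked ℕ._≥_ ps → ∀ i → nth ps (suc i) ℕ.≤ nth ps i
nth-step Linked.[]   i = z≤n
nth-step [-]  zero    = z≤n
nth-step [-]  (suc i) = z≤n
nth-step (h Linked.∷ _) zero    = h
nth-step (_ Linked.∷ l) (suc i) = nth-step l i

row-antitone : ∀ (λs : Partition) {i j} → i ℕ.≤ j → row λs j ℕ.≤ row λs i
row-antitone λs {i} h with ℕₚ.m≤n⇒∃[o]m+o≡n h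
... | d , refl = go d
  where
  go : ∀ d → row λs (i ℕ.+ d) ℕ.≤ row λs i
  go zero rewrite ℕₚ.+-identityʳ i = ℕₚ.≤-refl
  go (suc d) rewrite ℕₚ.+-suc i d = ℕₚ.≤-trans (nth-step (decreasing λs) (i ℕ.+ d)) (go d)

∈-cells⁺ : ∀ υ {c} → InShape υ c → c ∈ cells υ
∈-cells⁺ υ {i , j} h@(_ , j<) = ∈-filter⁺ (inShape? υ)
  (∈-cartesianProduct⁺ (∈-upTo⁺ (row-positive (outer υ) (ℕₚ.≤-<-trans z≤n j<)))
    (∈-upTo⁺ (ℕₚ.<-≤-trans j< (row-antitone (outer υ) {0} {i} z≤n)))) h

cell-inShape : ∀ υ p → InShape υ (lookup (cells υ) p)
cell-inShape υ p = proj₂ (∈-filter⁻ (inShape? υ) {xs = cartesianProduct (upTo (ℓ (outer υ))) (upTo (row (outer υ) 0))} (∈-lookup p))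

module _ (υ : SkewShape) where

  private
    N = size υ
    L = ℓ (outer υ)
    R = row (outer υ) 0
    cell : Fin N → Cell
    cell = lookup (cells υ)

  row< : ∀ p → proj₁ (cell p) ℕ.< L
  row< p = row-positive (outer υ) (ℕₚ.≤-<-trans z≤n (proj₂ (cell-inShape υ p)))

  col< : ∀ p → proj₂ (cell p) ℕ.< R
  col< p = ℕₚ.<-≤-trans (proj₂ (cell-inShape υ p)) (row-antitone (outer υ) z≤n)

  tableaux : List (Fin (N ℕ.^ N))
  tableaux = filter (λ k → isStandard? υ (finToFun k)) (allFin (N ℕ.^ N))

  -- A tableau is determined by the rows of its entries in increasing order,
  -- because the entries of each row increase from left to right.
  rowWord : (T : Filling υ) → Injective _≡_ _≡_ T → Fin N → Fin L
  rowWord T inj k = fromℕ< (row< (proj₁ (inverse T inj) k))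

  -- Strong induction on the entry k shows that it occupies the same cell in both tableaux. Both
  -- cells lie in the same row; if the cell of k in T were strictly to the left, its entry m in T′
  -- would be less than k, so by induction m would occupy that cell in T as well, where k already
  -- stands. The other case is symmetric.
  rowWord-injective : ∀ T T′ (st : IsStandard υ T) (st′ : IsStandard υ T′) →
    (∀ k → rowWord T (proj₁ st _ _) k ≡ rowWord T′ (proj₁ st′ _ _) k) → T ≗ T′
  rowWord-injective T T′ st st′ same p =
    sym (trans (cong T′ (trans (sym (gT p)) (gg (T p) (<-wellFounded _)))) (T′g′ (T p)))
    where
    g = proj₁ (inverse T (proj₁ st _ _))
    Tg = proj₁ (proj₂ (inverse T (proj₁ st _ _)))
    gT = proj₂ (proj₂ (inverse T (proj₁ st _ _)))
    g′ = proj₁ (inverse T′ (proj₁ st′ _ _))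
    T′g′ = proj₁ (proj₂ (inverse T′ (proj₁ st′ _ _)))
    g′T′ = proj₂ (proj₂ (inverse T′ (proj₁ st′ _ _)))
    rows : ∀ k → proj₁ (cell (g k)) ≡ proj₁ (cell (g′ k))
    rows k = trans (sym (Finₚ.toℕ-fromℕ< _)) (trans (cong toℕ (same k)) (Finₚ.toℕ-fromℕ< _))
    gg : ∀ k → Acc ℕ._<_ (toℕ k) → g k ≡ g′ k
    gg k (acc rec) with ℕₚ.<-cmp (proj₂ (cell (g k))) (proj₂ (cell (g′ k)))
    ... | tri≈ _ eq _ = lookup-injective (unique-cells υ) (cong₂ _,_ (rows k) eq)
    ... | tri< lt _ _ = contradiction (trans (cong T (trans (sym (g′T′ (g k))) (sym ih))) (Tg m))
                          (λ eq → ℕₚ.<⇒≢ m<k (cong toℕ (trans (sym eq) (Tg k))))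
      where
      m = T′ (g k)
      m<k : m Fin.< k
      m<k = subst (m Fin.<_) (T′g′ k) (proj₁ (proj₂ st′) (g k) (g′ k) (rows k) lt)
      ih = gg m (rec m<k)
    ... | tri> _ _ lt = contradiction (trans (cong T′ (trans (sym (gT (g′ k))) ih)) (T′g′ m))
                          (λ eq → ℕₚ.<⇒≢ m<k (cong toℕ (trans (sym eq) (T′g′ k))))
      where
      m = T (g′ k)
      m<k : m Fin.< k
      m<k = subst (m Fin.<_) (Tg k) (proj₁ (proj₂ st) (g′ k) (g k) (sym (rows k)) lt)
      ih = gg m (rec m<k)

  standard : ∀ i → IsStandard υ (finToFun (lookup tableaux i))
  standard i = proj₂ (∈-filter⁻ (λ k → isStandard? υ (finToFun k)) {xs = allFin (N ℕ.^ N)} (∈-lookup i))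

  e-upper : e υ ℕ.≤ L ℕ.^ N
  e-upper = Finₚ.injective⇒≤ {f = λ i → funToFin (rowWord (finToFun (lookup tableaux i)) (proj₁ (standard i) _ _))}
    λ {i} {j} eq → lookup-injective (Uniqueₚ.filter⁺ _ (Uniqueₚ.allFin⁺ _))
      (finToFun-injective {N} {N} (rowWord-injective _ _ (standard i) (standard j) (funToFin-injective eq)))

-- Counting the listings of the cells by increasing rank

sumℕ : ℕ → (ℕ → ℕ) → ℕ
sumℕ zero    f = 0
sumℕ (suc r) f = sumℕ r f ℕ.+ f r

sumℕ-mono : ∀ r {f g} → (∀ s → f s ℕ.≤ g s) → sumℕ r f ℕ.≤ sumℕ r g
sumℕ-mono zero    h = z≤n
sumℕ-mono (suc r) h = ℕₚ.+-mono-≤ (sumℕ-mono r h) (h r)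

sumℕ-mono-< : ∀ r {f g} → (∀ s → f s ℕ.≤ g s) → ∀ {s} → s ℕ.< r → f s ℕ.< g s → sumℕ r f ℕ.< sumℕ r g
sumℕ-mono-< (suc r) {f} {g} h {s} s<r lt with s ℕ.≟ r
... | yes refl = subst (ℕ._≤ sumℕ r g ℕ.+ g r) (ℕₚ.+-suc (sumℕ r f) (f r)) (ℕₚ.+-mono-≤ (sumℕ-mono r h) lt)
... | no s≢r   = ℕₚ.+-mono-≤ (sumℕ-mono-< r h (ℕₚ.≤∧≢⇒< (ℕ.s≤s⁻¹ s<r) s≢r) lt) (h r)

sumℕ-bound : ∀ r {f c} → (∀ s → f s ℕ.≤ c) → sumℕ r f ℕ.≤ r ℕ.* c
sumℕ-bound zero    h = z≤n
sumℕ-bound (suc r) {f} {c} h = subst (sumℕ r f ℕ.+ f r ℕ.≤_) (ℕₚ.+-comm (r ℕ.* c) c) (ℕₚ.+-mono-≤ (sumℕ-bound r h) (h r))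

AllPairs-lookup : ∀ {A : Set} {R : A → A → Set} {xs} → AllPairs R xs →
  ∀ {i j : Fin (length xs)} → i Fin.< j → R (lookup xs i) (lookup xs j)
AllPairs-lookup (p ∷ _)  {Fin.zero}  {Fin.suc j} _ = All.lookup p (∈-lookup j)
AllPairs-lookup (_ ∷ ps) {Fin.suc i} {Fin.suc j} (s≤s h) = AllPairs-lookup ps h

lookup-ext : ∀ {A : Set} {n} (v w : List A) (p : n ≡ length v) (q : n ≡ length w) →
  (∀ i → lookup v (Fin.cast p i) ≡ lookup w (Fin.cast q i)) → v ≡ w
lookup-ext []       []       p q h = refl
lookup-ext []       (y ∷ w)  p q h = contradiction (trans (sym p) q) λ ()
lookup-ext (x ∷ v)  []       p q h = contradiction (trans (sym p) q) λ ()
lookup-ext {n = suc n} (x ∷ v) (y ∷ w) p q h =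
  cong₂ _∷_ (h Fin.zero) (lookup-ext v w (ℕₚ.suc-injective p) (ℕₚ.suc-injective q) (h ∘ Fin.suc))

-- The elements are inserted one by one into a list sorted by rank; an element
-- may be placed after any number of the earlier elements of its own rank.
module RankSorted {A : Set} (_≟_ : (x y : A) → Dec (x ≡ y)) (rank : A → ℕ) (t : ℕ) where

  count : ℕ → List A → ℕ
  count s ps = length (filter (λ q → rank q ℕ.≟ s) ps)

  Sorted : List A → Set
  Sorted = AllPairs (λ p q → rank p ℕ.≤ rank q)

  -- There are `suc (count (rank p) ps)` places for p among the elements of its rank, but only t of
  -- them are used, and only one if there are fewer than t. Every factor of `total` is then t or 1,
  -- and the factor 1 occurs for fewer than t elements of each rank when t > 1, and contributes no
  -- loss when t = 1.
  choices : A → List A → ℕ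
  choices p ps with t ℕ.≤? suc (count (rank p) ps)
  ... | yes _ = t
  ... | no  _ = 1

  total : List A → ℕ
  total []       = 1
  total (p ∷ ps) = total ps ℕ.* choices p ps

  insert : A → ℕ → List A → List A
  insert p i [] = p ∷ []
  insert p i (y ∷ w) with ℕₚ.<-cmp (rank y) (rank p)
  insert p i       (y ∷ w) | tri< _ _ _ = y ∷ insert p i w
  insert p zero    (y ∷ w) | tri≈ _ _ _ = p ∷ y ∷ w
  insert p (suc i) (y ∷ w) | tri≈ _ _ _ = y ∷ insert p i w
  insert p i       (y ∷ w) | tri> _ _ _ = p ∷ y ∷ w

  insert-↭ : ∀ p i w → insert p i w ↭ p ∷ w
  insert-↭ p i [] = ↭-refl
  insert-↭ p i (y ∷ w) with ℕₚ.<-cmp (rank y) (rank p)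
  insert-↭ p i       (y ∷ w) | tri< _ _ _ = ↭-trans (prep y (insert-↭ p i w)) (swap y p ↭-refl)
  insert-↭ p zero    (y ∷ w) | tri≈ _ _ _ = ↭-refl
  insert-↭ p (suc i) (y ∷ w) | tri≈ _ _ _ = ↭-trans (prep y (insert-↭ p i w)) (swap y p ↭-refl)
  insert-↭ p i       (y ∷ w) | tri> _ _ _ = ↭-refl

  insert-sorted : ∀ p i w → Sorted w → Sorted (insert p i w)
  insert-sorted p i [] s = [] ∷ []
  insert-sorted p i (y ∷ w) (y≤ ∷ s) with ℕₚ.<-cmp (rank y) (rank p)
  insert-sorted p i       (y ∷ w) (y≤ ∷ s) | tri< y<p _ _ =
    ↭ₚ.All-resp-↭ (↭-sym (insert-↭ p i w)) (ℕₚ.<⇒≤ y<p ∷ y≤) ∷ insert-sorted p i w s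
  insert-sorted p zero    (y ∷ w) (y≤ ∷ s) | tri≈ _ y≡p _ =
    (ℕₚ.≤-reflexive (sym y≡p) ∷ All.map (ℕₚ.≤-trans (ℕₚ.≤-reflexive (sym y≡p))) y≤) ∷ y≤ ∷ s
  insert-sorted p (suc i) (y ∷ w) (y≤ ∷ s) | tri≈ _ y≡p _ =
    ↭ₚ.All-resp-↭ (↭-sym (insert-↭ p i w)) (ℕₚ.≤-reflexive y≡p ∷ y≤) ∷ insert-sorted p i w s
  insert-sorted p i       (y ∷ w) (y≤ ∷ s) | tri> _ _ p<y =
    (ℕₚ.<⇒≤ p<y ∷ All.map (ℕₚ.≤-trans (ℕₚ.<⇒≤ p<y)) y≤) ∷ y≤ ∷ s

  bump : A → A → ℕ → ℕ
  bump y p i with rank y ℕ.≟ rank p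
  ... | yes _ = suc i
  ... | no  _ = i

  -- A left inverse of `insert`: since p occurs only once, its position and the number of elements
  -- of its rank before it can be read off the list. This is what makes different choices give
  -- different lists.
  extract : A → List A → ℕ × List A
  extract p [] = 0 , []
  extract p (y ∷ w) with y ≟ p
  ... | yes _ = 0 , w
  ... | no  _ = bump y p (proj₁ (extract p w)) , y ∷ proj₂ (extract p w)

  extract-here : ∀ p w → extract p (p ∷ w) ≡ (0 , w)
  extract-here p w with p ≟ p
  ... | yes _ = refl
  ... | no ¬p = contradiction refl ¬p

  extract-there : ∀ p y w {i v} → y ≢ p → extract p w ≡ (i , v) → extract p (y ∷ w) ≡ (bump y p i , y ∷ v)
  extract-there p y w y≢p eq with y ≟ p
  ... | yes y≡p = contradiction y≡p y≢p
  ... | no  _   rewrite eq = refl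

  -- The bound on i is essential: a larger i would put p at the end of the block of its rank,
  -- exactly where i = `count (rank p) w` puts it.
  extract-insert : ∀ p i w → p ∉ w → Sorted w → i ℕ.≤ count (rank p) w → extract p (insert p i w) ≡ (i , w)
  extract-insert p zero [] p∉ s z≤n = extract-here p []
  extract-insert p i (y ∷ w) p∉ (y≤ ∷ s) i≤ with ℕₚ.<-cmp (rank y) (rank p)
  extract-insert p i (y ∷ w) p∉ (y≤ ∷ s) i≤ | tri< _ y≢ _ =
    trans (extract-there p y _ (λ eq → p∉ (here (sym eq)))
            (extract-insert p i w (p∉ ∘ there) s
              (subst (λ v → i ℕ.≤ length v) (filter-reject (λ q → rank q ℕ.≟ rank p) y≢) i≤)))
      (cong (_, y ∷ w) (unbump y≢))
    where
    unbump : rank y ≢ rank p → bump y p i ≡ i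
    unbump ne with rank y ℕ.≟ rank p
    ... | yes eq = contradiction eq ne
    ... | no  _  = refl
  extract-insert p zero    (y ∷ w) p∉ (y≤ ∷ s) i≤ | tri≈ _ y≡ _ = extract-here p (y ∷ w)
  extract-insert p (suc i) (y ∷ w) p∉ (y≤ ∷ s) i≤ | tri≈ _ y≡ _ =
    trans (extract-there p y _ (λ eq → p∉ (here (sym eq)))
            (extract-insert p i w (p∉ ∘ there) s
              (ℕ.s≤s⁻¹ (subst (λ v → suc i ℕ.≤ length v) (filter-accept (λ q → rank q ℕ.≟ rank p) y≡) i≤))))
      (cong (_, y ∷ w) bumped)
    where
    bumped : bump y p i ≡ suc i
    bumped with rank y ℕ.≟ rank p
    ... | yes _ = refl
    ... | no ne = contradiction y≡ ne
  -- By sortedness no later element has the rank of p, so the bound on i leaves only i = 0.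
  extract-insert p i (y ∷ w) p∉ (y≤ ∷ s) i≤ | tri> _ _ p<y =
    trans (extract-here p (y ∷ w)) (cong (_, y ∷ w) (sym (ℕₚ.n≤0⇒n≡0
      (subst (λ v → i ℕ.≤ length v) (filter-none (λ q → rank q ℕ.≟ rank p)
        ((λ eq → ℕₚ.<⇒≢ p<y (sym eq)) ∷ All.map (λ y≤q eq → ℕₚ.<⇒≱ p<y (ℕₚ.≤-trans y≤q (ℕₚ.≤-reflexive eq))) y≤)) i≤))))

  -- The index is read in mixed radix, with one digit below `choices p ps` for each element.
  word : ∀ ps → Fin (total ps) → List A
  word []       _ = []
  word (p ∷ ps) k = insert p (toℕ (proj₂ (remQuot {total ps} (choices p ps) k)))
                      (word ps (proj₁ (remQuot {total ps} (choices p ps) k)))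

  word-↭ : ∀ ps k → word ps k ↭ ps
  word-↭ []       k = ↭-refl
  word-↭ (p ∷ ps) k = ↭-trans (insert-↭ p _ _) (prep p (word-↭ ps _))

  word-sorted : ∀ ps k → Sorted (word ps k)
  word-sorted []       k = []
  word-sorted (p ∷ ps) k = insert-sorted p _ _ (word-sorted ps _)

  count-↭ : ∀ s {v w} → v ↭ w → count s v ≡ count s w
  count-↭ s v↭w = ↭ₚ.↭-length (↭ₚ.filter-↭ (λ q → rank q ℕ.≟ s) v↭w)

  choices-≤ : ∀ p ps → choices p ps ℕ.≤ suc (count (rank p) ps)
  choices-≤ p ps with t ℕ.≤? suc (count (rank p) ps)
  ... | yes h = h
  ... | no  _ = s≤s z≤n

  word-injective : ∀ ps → Unique ps → Injective _≡_ _≡_ (word ps)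
  word-injective []       u {Fin.zero} {Fin.zero} _ = refl
  word-injective (p ∷ ps) (p∉ ∷ u) {j} {k} eq = trans (sym (Finₚ.combine-remQuot {total ps} c j))
    (trans (cong₂ combine (word-injective ps u (proj₂ both)) (Finₚ.toℕ-injective (proj₁ both)))
      (Finₚ.combine-remQuot {total ps} c k))
    where
    c = choices p ps
    undo : ∀ i → extract p (word (p ∷ ps) i) ≡ (toℕ (proj₂ (remQuot {total ps} c i)) , word ps (proj₁ (remQuot {total ps} c i)))
    undo i = let (a , b) = remQuot {total ps} c i in extract-insert p (toℕ b) (word ps a)
      (λ p∈ → All.lookup p∉ (↭ₚ.∈-resp-↭ (word-↭ ps a) p∈) refl)
      (word-sorted ps a)
      (subst (toℕ b ℕ.≤_) (sym (count-↭ (rank p) (word-↭ ps a))) (ℕ.s≤s⁻¹ (ℕₚ.<-≤-trans (Finₚ.toℕ<n b) (choices-≤ p ps))))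
    both = ,-injective (trans (sym (undo j)) (trans (cong (extract p) eq) (undo k)))

  module _ (r : ℕ) (rank< : ∀ p → rank p ℕ.< r) (1≤t : 1 ℕ.≤ t) where

    crowding : List A → ℕ
    crowding ps = sumℕ r (λ s → t ℕ.⊓ count s ps)

    count-∷ : ∀ p ps s → count s ps ℕ.≤ count s (p ∷ ps)
    count-∷ p ps s with rank p ℕ.≟ s
    ... | yes eq = subst (λ v → count s ps ℕ.≤ length v) (sym (filter-accept (λ q → rank q ℕ.≟ s) eq)) (ℕₚ.n≤1+n _)
    ... | no ne  = subst (λ v → count s ps ℕ.≤ length v) (sym (filter-reject (λ q → rank q ℕ.≟ s) ne)) ℕₚ.≤-refl

    private instance
      t≢0 : ℕ.NonZero t
      t≢0 = ℕ.>-nonZero 1≤t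

    -- A new element multiplies the left side by t. Either `choices` supplies this factor, or the
    -- rank of the element still holds fewer than t elements after the insertion, so that its term
    -- in `crowding` grows by 1 and the missing factor comes from the power of t.
    total-lower′ : ∀ ps → t ℕ.^ length ps ℕ.≤ total ps ℕ.* t ℕ.^ crowding ps
    total-lower′ [] = subst (1 ℕ.≤_) (sym (ℕₚ.*-identityˡ _)) (ℕₚ.m^n>0 t (crowding []))
    total-lower′ (p ∷ ps) with t ℕ.≤? suc (count (rank p) ps)
    ... | yes _ = begin
        t ℕ.* t ℕ.^ length ps                          ≤⟨ ℕₚ.*-monoʳ-≤ t (total-lower′ ps) ⟩
        t ℕ.* (total ps ℕ.* t ℕ.^ crowding ps)         ≡⟨ solve 3 (λ t a b → t :* (a :* b) := (a :* t) :* b) refl t (total ps) (t ℕ.^ crowding ps) ⟩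
        total ps ℕ.* t ℕ.* t ℕ.^ crowding ps           ≤⟨ ℕₚ.*-monoʳ-≤ (total ps ℕ.* t) (ℕₚ.^-monoʳ-≤ t (sumℕ-mono r λ s → ℕₚ.⊓-monoʳ-≤ t (count-∷ p ps s))) ⟩
        total ps ℕ.* t ℕ.* t ℕ.^ crowding (p ∷ ps)     ∎
      where open ℕₚ.≤-Reasoning
            open ℕSolver.+-*-Solver
    ... | no t≰ = begin
        t ℕ.* t ℕ.^ length ps                          ≤⟨ ℕₚ.*-monoʳ-≤ t (total-lower′ ps) ⟩
        t ℕ.* (total ps ℕ.* t ℕ.^ crowding ps)         ≡⟨ solve 3 (λ t a b → t :* (a :* b) := (a :* con 1) :* (t :* b)) refl t (total ps) (t ℕ.^ crowding ps) ⟩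
        total ps ℕ.* 1 ℕ.* t ℕ.^ suc (crowding ps)     ≤⟨ ℕₚ.*-monoʳ-≤ (total ps ℕ.* 1) (ℕₚ.^-monoʳ-≤ t more) ⟩
        total ps ℕ.* 1 ℕ.* t ℕ.^ crowding (p ∷ ps)     ∎
      where
      open ℕₚ.≤-Reasoning
      open ℕSolver.+-*-Solver
      t> = ℕₚ.≰⇒> t≰
      more : suc (crowding ps) ℕ.≤ crowding (p ∷ ps)
      more = sumℕ-mono-< r (λ s → ℕₚ.⊓-monoʳ-≤ t (count-∷ p ps s)) (rank< p)
        (subst₂ ℕ._≤_
          (cong suc (sym (ℕₚ.m≥n⇒m⊓n≡n (ℕₚ.≤-trans (ℕₚ.n≤1+n _) (ℕₚ.<⇒≤ t>)))))
          (trans (sym (ℕₚ.m≥n⇒m⊓n≡n (ℕₚ.<⇒≤ t>)))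
            (cong (λ v → t ℕ.⊓ length v) (sym (filter-accept (λ q → rank q ℕ.≟ rank p) refl))))
          ℕₚ.≤-refl)

    total-lower : ∀ ps → t ℕ.^ length ps ℕ.≤ total ps ℕ.* t ℕ.^ (r ℕ.* t)
    total-lower ps = ℕₚ.≤-trans (total-lower′ ps)
      (ℕₚ.*-monoʳ-≤ (total ps) (ℕₚ.^-monoʳ-≤ t (sumℕ-bound r λ s → ℕₚ.m⊓n≤m t _)))

module _ (υ : SkewShape) (t : ℕ) (1≤t : 1 ℕ.≤ t) where

  private
    N = size υ
    L = ℓ (outer υ)
    R = row (outer υ) 0
    rank : Fin N → ℕ
    rank p = rowOf υ id p ℕ.+ colOf υ id p
    module S = RankSorted Finₚ._≟_ rank t
    K = S.total (allFin N)
    len : ∀ k → N ≡ length (S.word (allFin N) k)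
    len k = sym (trans (↭ₚ.↭-length (S.word-↭ (allFin N) k)) (length-tabulate id))
    order : Fin K → Fin N → Fin N
    order k i = lookup (S.word (allFin N) k) (Fin.cast (len k) i)
    word-unique : ∀ k → Unique (S.word (allFin N) k)
    word-unique k = ↭ₛₚ.Unique-resp-↭ (setoid (Fin N)) (↭⇒↭ₛ (↭-sym (S.word-↭ (allFin N) k))) (Uniqueₚ.allFin⁺ N)
    cast-injective : ∀ {m n} (eq : m ≡ n) {i j} → Fin.cast eq i ≡ Fin.cast eq j → i ≡ j
    cast-injective eq {i} {j} h = Finₚ.toℕ-injective
      (trans (sym (Finₚ.toℕ-cast eq i)) (trans (cong toℕ h) (Finₚ.toℕ-cast eq j)))
    order-injective : ∀ k → Injective _≡_ _≡_ (order k)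
    order-injective k h = cast-injective (len k) (lookup-injective (word-unique k) h)
    -- A listing sends entries to cells, a filling cells to entries, hence the inverse. Rank
    -- strictly increases along rows and down columns, so any listing by increasing rank yields a
    -- standard filling.
    T : Fin K → Filling υ
    T k = proj₁ (inverse (order k) (order-injective k))
    order∘T : ∀ k p → order k (T k p) ≡ p
    order∘T k = proj₁ (proj₂ (inverse (order k) (order-injective k)))
    T∘order : ∀ k i → T k (order k i) ≡ i
    T∘order k = proj₂ (proj₂ (inverse (order k) (order-injective k)))
    T-mono : ∀ k p q → rank p ℕ.< rank q → T k p Fin.< T k q
    T-mono k p q p<q = ℕₚ.≰⇒> λ Tq≤Tp → ℕₚ.<⇒≱ p<q (subst₂ (λ a b → rank a ℕ.≤ rank b) (order∘T k q) (order∘T k p)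
      ([ (λ lt → AllPairs-lookup (S.word-sorted (allFin N) k)
           (subst₂ ℕ._<_ (sym (Finₚ.toℕ-cast (len k) (T k q))) (sym (Finₚ.toℕ-cast (len k) (T k p))) lt))
       , (λ eq → ℕₚ.≤-reflexive (cong (rank ∘ order k) (Finₚ.toℕ-injective eq))) ]′
       (ℕₚ.m≤n⇒m<n∨m≡n Tq≤Tp)))
    T-standard : ∀ k → IsStandard υ (T k)
    T-standard k =
      (λ p q eq → trans (sym (order∘T k p)) (trans (cong (order k) eq) (order∘T k q))) ,
      (λ p q rows cols → T-mono k p q (ℕₚ.+-mono-≤-< (ℕₚ.≤-reflexive rows) cols)) ,
      (λ p q cols rows → T-mono k p q (ℕₚ.+-mono-<-≤ rows (ℕₚ.≤-reflexive cols)))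
    standard-resp : ∀ {F G : Filling υ} → F ≗ G → IsStandard υ F → IsStandard υ G
    standard-resp h (inj , rows , cols) =
      (λ p q eq → inj p q (trans (h p) (trans eq (sym (h q))))) ,
      (λ p q a b → subst₂ Fin._<_ (h p) (h q) (rows p q a b)) ,
      (λ p q a b → subst₂ Fin._<_ (h p) (h q) (cols p q a b))
    T-injective : ∀ {j k} → T j ≗ T k → j ≡ k
    T-injective {j} {k} h = S.word-injective (allFin N) (Uniqueₚ.allFin⁺ N)
      (lookup-ext _ _ (len j) (len k) λ i → trans (sym (order∘T k (order j i)))
        (cong (order k) (trans (sym (h (order j i))) (T∘order j i))))

  e-lower : t ℕ.^ N ℕ.≤ e υ ℕ.* t ℕ.^ ((L ℕ.+ R) ℕ.* t)
  e-lower = ℕₚ.≤-trans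
    (subst (λ n → t ℕ.^ n ℕ.≤ K ℕ.* t ℕ.^ ((L ℕ.+ R) ℕ.* t)) (length-tabulate {n = N} id)
      -- The rank is the row index plus the column index, which are below L and R, so L + R bounds
      -- the number of ranks.
      (S.total-lower (L ℕ.+ R) (λ p → ℕₚ.+-mono-< (row< υ p) (col< υ p)) 1≤t (allFin N)))
    (ℕₚ.*-monoˡ-≤ (t ℕ.^ ((L ℕ.+ R) ℕ.* t))
      (injection-into-list (λ k → funToFin (T k)) (λ eq → T-injective (funToFin-injective eq))
        λ k → ∈-filter⁺ (λ c → isStandard? υ (finToFun c)) (∈-allFin (funToFin (T k)))
          (standard-resp (λ p → sym (Finₚ.finToFun-funToFin (T k) p)) (T-standard k))))

-- Logarithms

Eventually-map : ∀ {P Q : ℕ → Set} → (∀ n → P n → Q n) → Eventually P → Eventually Q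
Eventually-map f (N , p) = N , λ n h → f n (p n h)

Eventually-× : ∀ {P Q : ℕ → Set} → Eventually P → Eventually Q → Eventually (λ n → P n × Q n)
Eventually-× (M , p) (N , q) = M ℕ.⊔ N , λ n h →
  p n (ℕₚ.≤-trans (ℕₚ.m≤m⊔n M N) h) , q n (ℕₚ.≤-trans (ℕₚ.m≤n⊔m M N) h)

Eventually-≥ : ∀ N → Eventually (N ℕ.≤_)
Eventually-≥ N = N , λ _ h → h

-- Linear arithmetic by certificates: the hypothesis eq is closed by the ring solver.
lin : ∀ {L R a b} → L ℚ.≤ R → b ≡ a ℚ.+ (R ℚ.- L) → a ℚ.≤ b
lin {L} {R} {a} L≤R eq = subst₂ ℚ._≤_ (ℚₚ.+-identityʳ a) (sym eq)
  (ℚₚ.+-monoʳ-≤ a (subst (ℚ._≤ R ℚ.- L) (ℚₚ.+-inverseʳ L) (ℚₚ.+-monoˡ-≤ (ℚ.- L) L≤R)))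

*-nonNeg : ∀ {p q} → 0ℚ ℚ.≤ p → 0ℚ ℚ.≤ q → 0ℚ ℚ.≤ p ℚ.* q
*-nonNeg {p} {q} 0≤p 0≤q = subst (ℚ._≤ p ℚ.* q) (ℚₚ.*-zeroʳ p) (ℚₚ.*-monoˡ-≤-nonNeg p {{ℚ.nonNegative 0≤p}} 0≤q)

frac-* : ∀ a b c d → frac a b ℚ.* frac c d ≡ frac (a ℕ.* c) (d ℕ.+ b ℕ.* suc d)
frac-* a b c d = ℚₚ.toℚᵘ-injective
  (ℚᵘₚ.≃-trans (ℚₚ.toℚᵘ-homo-* (frac a b) (frac c d))
  (ℚᵘₚ.≃-trans (ℚᵘₚ.*-cong (toℚᵘ-frac a b) (toℚᵘ-frac c d))
  (ℚᵘₚ.≃-trans (ℚᵘ.*≡* (cong₂ ℤ._*_ (sym (ℤₚ.pos-* a c)) refl))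
    (ℚᵘₚ.≃-sym (toℚᵘ-frac (a ℕ.* c) (d ℕ.+ b ℕ.* suc d))))))

frac-suc : ∀ p → frac (suc p) 0 ≡ 1ℚ ℚ.+ frac p 0
frac-suc p = sym (frac-+ 1 p 0)

Σ<-monoˡ : ∀ {l m} (f : ℕ → ℚ) → (∀ i → 0ℚ ℚ.≤ f i) → l ℕ.≤ m → Σ< l f ℚ.≤ Σ< m f
Σ<-monoˡ {l} f f≥0 l≤m with ℕₚ.m≤n⇒∃[o]m+o≡n l≤m
... | d , refl = subst₂ ℚ._≤_ (ℚₚ.+-identityʳ (Σ< l f)) (sym (Σ<-split l d f))
                   (ℚₚ.+-monoʳ-≤ (Σ< l f) (nonNeg d (f≥0 ∘ (l ℕ.+_))))
  where
  nonNeg : ∀ d {g} → (∀ i → 0ℚ ℚ.≤ g i) → 0ℚ ℚ.≤ Σ< d g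
  nonNeg zero    h = ℚₚ.≤-refl
  nonNeg (suc d) h = ℚₚ.+-mono-≤ (nonNeg d h) (h d)

ln-approx-mono : ∀ {m n} k → m ℕ.≤ n → ln-approx m k ℚ.≤ ln-approx n k
ln-approx-mono k m≤n = Σ<-monoˡ _ (λ t → frac-nonNeg 1 (k ℕ.+ t)) (ℕₚ.*-monoˡ-≤ (suc k) (ℕₚ.∸-monoˡ-≤ 1 m≤n))

-- The first k + 1 terms, those of the integral over [1, 2], are each at least 1/(2 k + 1), and (k +
-- 1)/(2 k + 1) ≥ 1/2. The bound is uniform in k, which keeps ½ n ln n apart from 0.
½≤ln-approx : ∀ {n} k → 2 ℕ.≤ n → ½ ℚ.≤ ln-approx n k
½≤ln-approx k 2≤n = ℚₚ.≤-trans
  (ℚₚ.≤-trans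
    (frac-mono-≤ 1 1 (1 ℕ.* suc k) (k ℕ.+ k) (ℕₚ.≤-trans (ℕₚ.n≤1+n _)
      (ℕₚ.≤-reflexive (solve 1 (λ k → con 1 :+ (con 1 :* (con 1 :+ (k :+ k))) := (con 1 :* (con 1 :+ k)) :* con 2) refl k))))
    (ℚₚ.≤-trans (ℚₚ.≤-reflexive (sym (Σ<-const (1 ℕ.* suc k) (k ℕ.+ k))))
      (Σ<-mono (1 ℕ.* suc k) λ t t<K → frac-mono-≤ 1 (k ℕ.+ k) 1 (k ℕ.+ t)
        (ℕₚ.*-monoʳ-≤ 1 (s≤s (ℕₚ.+-monoʳ-≤ k (ℕ.s≤s⁻¹ (subst (suc t ℕ.≤_) (ℕₚ.*-identityˡ (suc k)) t<K))))))))
  (ln-approx-mono k 2≤n)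
  where open ℕSolver.+-*-Solver

-- ∫₁^mn dt/t = ∫₁^m dt/t + ∫₁^n dt/t by the substitution t ↦ mt, under which
-- mesh 1/K corresponds to mesh 1/mK.
ln-approx-* : ∀ m n k → ln-approx (suc m ℕ.* suc n) k ≡ ln-approx (suc m) k ℚ.+ ln-approx (suc n) (k ℕ.+ m ℕ.* suc k)
ln-approx-* m n k = trans
  (cong (λ l → Σ< l (λ t → frac 1 (k ℕ.+ t)))
    (solve 3 (λ m n k → (n :+ m :* (con 1 :+ n)) :* (con 1 :+ k) := m :* (con 1 :+ k) :+ n :* (con 1 :+ (k :+ m :* (con 1 :+ k)))) refl m n k))
  (trans (Σ<-split (m ℕ.* suc k) (n ℕ.* suc (k ℕ.+ m ℕ.* suc k)) _)
    (cong (ln-approx (suc m) k ℚ.+_) (Σ<-cong (n ℕ.* suc (k ℕ.+ m ℕ.* suc k)) λ t →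
      cong (frac 1) (sym (ℕₚ.+-assoc k (m ℕ.* suc k) t)))))
  where open ℕSolver.+-*-Solver

p≤∣p∣ : ∀ p → p ℚ.≤ ℚ.∣ p ∣
p≤∣p∣ p with ℚₚ.∣p∣≡p∨∣p∣≡-p p
... | inj₁ eq = ℚₚ.≤-reflexive (sym eq)
... | inj₂ eq = lin (ℚₚ.+-mono-≤ (ℚₚ.0≤∣p∣ p) (ℚₚ.0≤∣p∣ p)) (trans eq (trans
    (solve 1 (λ p → :- p := p :+ (((:- p) :+ (:- p)) :+ (:- (con 0ℚ :+ con 0ℚ)))) refl p)
    (cong (λ a → p ℚ.+ ((a ℚ.+ a) ℚ.- 0ℚ)) (sym eq))))
  where open +-*-Solver

∣-∣≤⁻ : ∀ {p q c} → ℚ.∣ p ℚ.- q ∣ ℚ.≤ c → p ℚ.≤ q ℚ.+ c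
∣-∣≤⁻ {p} {q} {c} h = lin (ℚₚ.≤-trans (p≤∣p∣ (p ℚ.- q)) h)
  (solve 3 (λ p q c → q :+ c := p :+ (c :+ (:- (p :+ (:- q))))) refl p q c)
  where open +-*-Solver

∣-∣≤⁻′ : ∀ {p q c} → ℚ.∣ p ℚ.- q ∣ ℚ.≤ c → q ℚ.≤ p ℚ.+ c
∣-∣≤⁻′ {p} {q} h = ∣-∣≤⁻ {q} {p} (subst (ℚ._≤ _) (∣-∣-comm p q) h)

-- Splitting off one factor by `ln-approx-*` refines the mesh in the other summand, so the law for
-- powers holds for the Riemann sums only up to an error. Half of δ goes to the induction hypothesis
-- and half to the change of mesh, which the Cauchy property makes small.
ln-approx-^ : ∀ m p δ → 0ℚ ℚ.< δ → Eventually λ k →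
  ln-approx (suc m ℕ.^ p) k ℚ.≤ frac p 0 ℚ.* ln-approx (suc m) k ℚ.+ δ ×
  frac p 0 ℚ.* ln-approx (suc m) k ℚ.≤ ln-approx (suc m ℕ.^ p) k ℚ.+ δ
ln-approx-^ m zero δ 0<δ = 0 , λ k _ →
  subst (λ z → 0ℚ ℚ.≤ z ℚ.+ δ × z ℚ.≤ 0ℚ ℚ.+ δ) (sym (ℚₚ.*-zeroˡ (ln-approx (suc m) k)))
    (0≤0+δ , 0≤0+δ)
  where
  0≤0+δ : 0ℚ ℚ.≤ 0ℚ ℚ.+ δ
  0≤0+δ = subst (0ℚ ℚ.≤_) (sym (ℚₚ.+-identityˡ δ)) (ℚₚ.<⇒≤ 0<δ)
ln-approx-^ m (suc p) δ 0<δ =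
  let h = ½ ℚ.* δ
      (M , ih) = ln-approx-^ m p h (halve 0<δ)
      (N , c) = cauchy (ln (suc m ℕ.^ p)) h (halve 0<δ)
  in M ℕ.⊔ N , λ k hk →
    let k′ = k ℕ.+ m ℕ.* suc k
        x = ln-approx (suc m) k
        y = ln-approx (suc m ℕ.^ p) k
        y′ = ln-approx (suc m ℕ.^ p) k′
        k≥N = ℕₚ.≤-trans (ℕₚ.m≤n⊔m M N) hk
        near = c k′ k (ℕₚ.≤-trans k≥N (ℕₚ.m≤m+n k (m ℕ.* suc k))) k≥N
        (i₁ , i₂) = ih k (ℕₚ.≤-trans (ℕₚ.m≤m⊔n M N) hk)
    in subst₂ (λ u v → u ℚ.≤ v ℚ.* x ℚ.+ δ × v ℚ.* x ℚ.≤ u ℚ.+ δ) (sym (split k)) (sym (frac-suc p))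
         ( lin (ℚₚ.+-mono-≤ i₁ (∣-∣≤⁻ {y′} {y} near))
             (trans (cong ((1ℚ ℚ.+ frac p 0) ℚ.* x ℚ.+_) (sym (½+½ δ)))
              (solve 5 (λ f x y y′ h → (con 1ℚ :+ f) :* x :+ (h :+ h)
                := (x :+ y′) :+ (((f :* x :+ h) :+ (y :+ h)) :+ (:- (y :+ y′)))) refl (frac p 0) x y y′ h))
         , lin (ℚₚ.+-mono-≤ i₂ (∣-∣≤⁻′ {y′} {y} near))
             (trans (cong ((x ℚ.+ y′) ℚ.+_) (sym (½+½ δ)))
              (solve 5 (λ f x y y′ h → (x :+ y′) :+ (h :+ h)
                := (con 1ℚ :+ f) :* x :+ (((y :+ h) :+ (y′ :+ h)) :+ (:- (f :* x :+ y)))) refl (frac p 0) x y y′ h)))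
  where
  open +-*-Solver
  split : ∀ k → ln-approx (suc m ℕ.^ suc p) k ≡ ln-approx (suc m) k ℚ.+ ln-approx (suc m ℕ.^ p) (k ℕ.+ m ℕ.* suc k)
  split k with suc m ℕ.^ p | ℕₚ.m^n>0 (suc m) p
  ... | suc n | _ = ln-approx-* m n k

ln-approx-^-mono : ∀ {a b p q} → 1 ℕ.≤ a → 1 ℕ.≤ b → a ℕ.^ p ℕ.≤ b ℕ.^ q → ∀ δ → 0ℚ ℚ.< δ → Eventually λ k →
  frac p 0 ℚ.* ln-approx a k ℚ.≤ frac q 0 ℚ.* ln-approx b k ℚ.+ δ
ln-approx-^-mono {suc a} {suc b} {p} {q} _ _ h δ 0<δ =
  Eventually-map (λ k (x , y) → subst (frac p 0 ℚ.* ln-approx (suc a) k ℚ.≤_)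
      (trans (ℚₚ.+-assoc (frac q 0 ℚ.* ln-approx (suc b) k) (½ ℚ.* δ) (½ ℚ.* δ)) (cong (frac q 0 ℚ.* ln-approx (suc b) k ℚ.+_) (½+½ δ)))
      (ℚₚ.≤-trans (proj₂ x) (ℚₚ.+-monoˡ-≤ (½ ℚ.* δ) (ℚₚ.≤-trans (ln-approx-mono k h) (proj₁ y)))))
    (Eventually-× (ln-approx-^ a p (½ ℚ.* δ) (halve 0<δ)) (ln-approx-^ b q (½ ℚ.* δ) (halve 0<δ)))

frac-*-hom : ∀ a b → frac (a ℕ.* b) 0 ≡ frac a 0 ℚ.* frac b 0
frac-*-hom a b = sym (frac-* a 0 b 0)

frac-+-hom : ∀ a b → frac (a ℕ.+ b) 0 ≡ frac a 0 ℚ.+ frac b 0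
frac-+-hom a b = sym (frac-+ a b 0)

-- Write X = ln (f n) and G = ½ n ln n. Taking logarithms of the hypotheses, and absorbing the
-- additive error 1 of the approximations into 2 G, gives E X ≤ (E + 3) G and (E - 1) G ≤ (E + 3) X.
-- Both relative errors are then at most 6/E.
log-asymptotics : (f : ℕ → ℕ) →
  (∀ E → Eventually λ n → 1 ℕ.≤ f n ×
     n ℕ.^ (n ℕ.* E) ℕ.≤ f n ℕ.^ (2 ℕ.* (E ℕ.+ 3)) × f n ℕ.^ (2 ℕ.* E) ℕ.≤ n ℕ.^ (n ℕ.* (E ℕ.+ 2))) →
  (λ n → ln (f n)) ∼ (λ n → fromℚ ½ * fromℕ n * ln n)
log-asymptotics f h ε 0<ε =
  let (D , 1/D≤ε) = archimedean ε 0<ε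
      -- This makes 6/E ≤ ε.
      E = 6 ℕ.* suc D
  in Eventually-map (main D 1/D≤ε E refl) (Eventually-× (Eventually-≥ 2) (h E))
  where
  main : ∀ D → frac 1 D ℚ.≤ ε → ∀ E → E ≡ 6 ℕ.* suc D → ∀ n → 2 ℕ.≤ n × 1 ℕ.≤ f n ×
     n ℕ.^ (n ℕ.* E) ℕ.≤ f n ℕ.^ (2 ℕ.* (E ℕ.+ 3)) × f n ℕ.^ (2 ℕ.* E) ℕ.≤ n ℕ.^ (n ℕ.* (E ℕ.+ 2)) →
     Σ[ g#0 ∈ (fromℚ ½ * fromℕ n * ln n) #0 ] ∣ ln (f n) * inv (fromℚ ½ * fromℕ n * ln n) g#0 - 1ℝ ∣ ≤ fromℚ ε
  main D 1/D≤ε E refl n (2≤n , 1≤f , lo , hi) = (½ , ℚₚ.positive⁻¹ ½ , 0 , λ k _ → away k) , λ δ 0<δ →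
    -- The logarithmic inequalities may carry an error as large as 1, because n ≥ 2 gives `1≤2g`.
    Eventually-map (close δ 0<δ) (Eventually-× (ln-approx-^-mono {n} {f n} {n ℕ.* E} {2 ℕ.* (E ℕ.+ 3)} (ℕₚ.≤-trans (s≤s z≤n) 2≤n) 1≤f lo 1ℚ 0<1ℚ)
                       (ln-approx-^-mono {f n} {n} {2 ℕ.* E} {n ℕ.* (E ℕ.+ 2)} 1≤f (ℕₚ.≤-trans (s≤s z≤n) 2≤n) hi 1ℚ 0<1ℚ))
    where
    open +-*-Solver
    F = frac n 0
    I = frac E 0
    g x l : ℕ → ℚ
    l k = ln-approx n k
    x k = ln-approx (f n) k
    g k = ½ ℚ.* F ℚ.* l k
    ½≤g : ∀ k → ½ ℚ.≤ g k
    ½≤g k = *-mono-≤-nonNeg {1ℚ} {½ ℚ.* F} {½} {l k} (ℚₚ.<⇒≤ (ℚₚ.positive⁻¹ ½)) (*-nonNeg (ℚₚ.<⇒≤ (ℚₚ.positive⁻¹ ½)) (frac-nonNeg n 0))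
      (ℚₚ.*-monoˡ-≤-nonNeg ½ (frac-mono-≤ 2 0 n 0 (ℕₚ.*-monoˡ-≤ 1 2≤n)))
      (½≤ln-approx k 2≤n)
    0≤g : ∀ k → 0ℚ ℚ.≤ g k
    0≤g k = ℚₚ.≤-trans (ℚₚ.<⇒≤ (ℚₚ.positive⁻¹ ½)) (½≤g k)
    1≤2g : ∀ k → 1ℚ ℚ.≤ g k ℚ.+ g k
    1≤2g k = ℚₚ.+-mono-≤ (½≤g k) (½≤g k)
    ∣g∣ : ∀ k → ℚ.∣ g k ∣ ≡ g k
    ∣g∣ k = ℚₚ.0≤p⇒∣p∣≡p (0≤g k)
    0<g : ∀ k → 0ℚ ℚ.< g k
    0<g k = ℚₚ.<-≤-trans (ℚₚ.positive⁻¹ ½) (½≤g k)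
    away : ∀ k → 0ℚ ℚ.+ ½ ℚ.≤ ℚ.∣ g k ∣
    away k = subst (½ ℚ.≤_) (sym (∣g∣ k)) (½≤g k)
    two-g : ∀ k → F ℚ.* l k ≡ g k ℚ.+ g k
    two-g k = solve 2 (λ F l → F :* l := con ½ :* F :* l :+ con ½ :* F :* l) refl F (l k)
    6≤εI : frac 6 0 ℚ.≤ ε ℚ.* I
    6≤εI = ℚₚ.≤-trans (ℚₚ.≤-reflexive (trans (frac-cong 6 0 (1 ℕ.* E) (0 ℕ.+ D ℕ.* 1)
               (NS.solve 1 (λ d → NS.con 6 NS.:* (NS.con 1 NS.:+ (NS.con 0 NS.:+ d NS.:* NS.con 1)) NS.:= (NS.con 1 NS.:* (NS.con 6 NS.:* (NS.con 1 NS.:+ d))) NS.:* NS.con 1) refl D)) (sym (frac-* 1 D E 0))))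
             (ℚₚ.*-monoʳ-≤-nonNeg I {{ℚ.nonNegative (frac-nonNeg E 0)}} 1/D≤ε)
      where module NS = ℕSolver.+-*-Solver
    6≤I : frac 6 0 ℚ.≤ I
    6≤I = frac-mono-≤ 6 0 E 0 (ℕₚ.*-monoˡ-≤ 1 (ℕₚ.*-monoʳ-≤ 6 {1} {suc D} (s≤s z≤n)))
    0<I : 0ℚ ℚ.< I
    0<I = ℚₚ.<-≤-trans (ℚₚ.positive⁻¹ (frac 6 0)) 6≤I
    close : ∀ δ → 0ℚ ℚ.< δ → ∀ k →
      frac (n ℕ.* E) 0 ℚ.* l k ℚ.≤ frac (2 ℕ.* (E ℕ.+ 3)) 0 ℚ.* x k ℚ.+ 1ℚ ×
      frac (2 ℕ.* E) 0 ℚ.* x k ℚ.≤ frac (n ℕ.* (E ℕ.+ 2)) 0 ℚ.* l k ℚ.+ 1ℚ →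
      ℚ.∣ x k ℚ.* recipℚ (g k) ℚ.- 1ℚ ∣ ℚ.≤ ε ℚ.+ δ
    close δ 0<δ k (lo′ , hi′) = ℚₚ.≤-trans (∣-∣≤ (scale upper) (scale′ lower))
      (subst (ℚ._≤ ε ℚ.+ δ) (ℚₚ.+-identityʳ ε) (ℚₚ.+-monoʳ-≤ ε (ℚₚ.<⇒≤ 0<δ)))
      where
      G = g k
      X = x k
      r = recipℚ G
      G*r : G ℚ.* r ≡ 1ℚ
      G*r = recipℚ-inverse G (subst (0ℚ ℚ.<_) (sym (∣g∣ k)) (0<g k))
      0≤r : 0ℚ ℚ.≤ r
      0≤r = ℚₚ.*-cancelˡ-≤-pos G {{ℚ.positive (0<g k)}}
        (subst₂ ℚ._≤_ (sym (ℚₚ.*-zeroʳ G)) (sym G*r) (ℚₚ.<⇒≤ 0<1ℚ))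
      scale : X ℚ.≤ G ℚ.+ ε ℚ.* G → X ℚ.* r ℚ.≤ 1ℚ ℚ.+ ε
      scale h = subst (X ℚ.* r ℚ.≤_) (trans (solve 3 (λ G e r → (G :+ e :* G) :* r := (G :* r) :+ e :* (G :* r)) refl G ε r)
          (cong₂ ℚ._+_ G*r (trans (cong (ε ℚ.*_) G*r) (ℚₚ.*-identityʳ ε))))
        (ℚₚ.*-monoʳ-≤-nonNeg r {{ℚ.nonNegative 0≤r}} h)
      scale′ : G ℚ.≤ X ℚ.+ ε ℚ.* G → 1ℚ ℚ.≤ X ℚ.* r ℚ.+ ε
      scale′ h = subst₂ ℚ._≤_ G*r (trans (solve 4 (λ X G e r → (X :+ e :* G) :* r := (X :* r) :+ e :* (G :* r)) refl X G ε r)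
          (cong (X ℚ.* r ℚ.+_) (trans (cong (ε ℚ.*_) G*r) (ℚₚ.*-identityʳ ε))))
        (ℚₚ.*-monoʳ-≤-nonNeg r {{ℚ.nonNegative 0≤r}} h)
      two three : ℚ
      two = frac 2 0
      three = frac 3 0
      hi″ : two ℚ.* I ℚ.* X ℚ.≤ (I ℚ.+ two) ℚ.* (G ℚ.+ G) ℚ.+ (G ℚ.+ G)
      hi″ = ℚₚ.≤-trans (subst₂ ℚ._≤_ (cong (ℚ._* X) (frac-*-hom 2 E))
          (cong (ℚ._+ 1ℚ) (trans (cong (ℚ._* l k) (trans (frac-*-hom n (E ℕ.+ 2)) (cong (F ℚ.*_) (frac-+-hom E 2))))
            (trans (solve 3 (λ F J l → F :* J :* l := J :* (F :* l)) refl F (I ℚ.+ two) (l k)) (cong ((I ℚ.+ two) ℚ.*_) (two-g k)))))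
          hi′)
        (ℚₚ.+-monoʳ-≤ ((I ℚ.+ two) ℚ.* (G ℚ.+ G)) (1≤2g k))
      lo″ : I ℚ.* (G ℚ.+ G) ℚ.≤ two ℚ.* (I ℚ.+ three) ℚ.* X ℚ.+ (G ℚ.+ G)
      lo″ = ℚₚ.≤-trans (subst₂ ℚ._≤_
          (trans (cong (ℚ._* l k) (frac-*-hom n E)) (trans (solve 3 (λ F J l → F :* J :* l := J :* (F :* l)) refl F I (l k)) (cong (I ℚ.*_) (two-g k))))
          (cong (λ u → u ℚ.* X ℚ.+ 1ℚ) (trans (frac-*-hom 2 (E ℕ.+ 3)) (cong (two ℚ.*_) (frac-+-hom E 3))))
          lo′)
        (ℚₚ.+-monoʳ-≤ (two ℚ.* (I ℚ.+ three) ℚ.* X) (1≤2g k))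
      6G≤ : frac 6 0 ℚ.* G ℚ.≤ ε ℚ.* I ℚ.* G
      6G≤ = ℚₚ.*-monoʳ-≤-nonNeg G {{ℚ.nonNegative (0≤g k)}} 6≤εI
      0≤εG : 0ℚ ℚ.≤ ε ℚ.* G
      0≤εG = *-nonNeg (ℚₚ.<⇒≤ 0<ε) (0≤g k)
      upper : X ℚ.≤ G ℚ.+ ε ℚ.* G
      upper = ℚₚ.*-cancelˡ-≤-pos (two ℚ.* I) {{ℚ.positive (*-pos (ℚₚ.positive⁻¹ two) 0<I)}}
        (lin (ℚₚ.+-mono-≤ hi″ (ℚₚ.+-mono-≤ 6G≤ (ℚₚ.+-mono-≤ 6G≤ (*-nonNeg (frac-nonNeg 6 0) (0≤g k)))))
          (solve 4 (λ I X G e → (con two :* I) :* (G :+ e :* G) :=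
            (con two :* I) :* X :+ ((((I :+ con two) :* (G :+ G) :+ (G :+ G)) :+ (e :* I :* G :+ (e :* I :* G :+ con (frac 6 0) :* G)))
              :+ (:- ((con two :* I :* X) :+ (con (frac 6 0) :* G :+ (con (frac 6 0) :* G :+ con 0ℚ)))))) refl I X G ε))
      lower : G ℚ.≤ X ℚ.+ ε ℚ.* G
      lower = ℚₚ.*-cancelˡ-≤-pos (two ℚ.* (I ℚ.+ three)) {{ℚ.positive (*-pos (ℚₚ.positive⁻¹ two) (ℚₚ.+-mono-< 0<I (ℚₚ.positive⁻¹ three)))}}
        (lin (ℚₚ.+-mono-≤ lo″ (ℚₚ.+-mono-≤ 6G≤ (ℚₚ.+-mono-≤ 6G≤ (ℚₚ.+-mono-≤ (*-nonNeg (frac-nonNeg 6 0) 0≤εG) (*-nonNeg (frac-nonNeg 4 0) (0≤g k))))))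
          (solve 4 (λ I X G e → (con two :* (I :+ con three)) :* (X :+ e :* G) :=
            (con two :* (I :+ con three)) :* G :+ (((con two :* (I :+ con three) :* X :+ (G :+ G)) :+ (e :* I :* G :+ (e :* I :* G :+ (con (frac 6 0) :* (e :* G) :+ con (frac 4 0) :* G))))
              :+ (:- ((I :* (G :+ G)) :+ (con (frac 6 0) :* G :+ (con (frac 6 0) :* G :+ (con 0ℚ :+ con 0ℚ))))))) refl I X G ε))

-- Comparison of h/√n with rational numbers

frac-cancel-≤ : ∀ a b c d → frac a b ℚ.≤ frac c d → a ℕ.* suc d ℕ.≤ c ℕ.* suc b
frac-cancel-≤ a b c d h
  with ℚᵘₚ.≤-respˡ-≃ (toℚᵘ-frac a b) (ℚᵘₚ.≤-respʳ-≃ (toℚᵘ-frac c d) (ℚₚ.toℚᵘ-mono-≤ h))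
... | ℚᵘ.*≤* z = ℤₚ.drop‿+≤+ (subst₂ ℤ._≤_ (sym (ℤₚ.pos-* a (suc d))) (sym (ℤₚ.pos-* c (suc b))) z)

frac-pos : ∀ d → 0ℚ ℚ.< frac 1 d
frac-pos d = ℚₚ.positive⁻¹ (frac 1 d) {{ℚₚ.normalize-pos 1 (suc d)}}

≤-by-ε : ∀ {p q} → (∀ ε → 0ℚ ℚ.< ε → p ℚ.≤ q ℚ.+ ε) → p ℚ.≤ q
≤-by-ε {p} {q} h = ℚₚ.≮⇒≥ λ q<p →
  let d = p ℚ.- q
      0<d : 0ℚ ℚ.< d
      0<d = subst (ℚ._< d) (ℚₚ.+-inverseʳ q) (ℚₚ.+-monoˡ-< (ℚ.- q) q<p)
      r = ½ ℚ.* d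
      p≤ = h r (halve 0<d)
  in ℚₚ.<-irrefl refl (ℚₚ.<-≤-trans (halve 0<d) (lin p≤ (solve 2 (λ p q → con 0ℚ := con ½ :* (p :+ (:- q)) :+ ((q :+ con ½ :* (p :+ (:- q))) :+ (:- p))) refl p q)))
  where open +-*-Solver

≤-reflℝ : ∀ {x} → x ≤ x
≤-reflℝ {x} ε 0<ε = 0 , λ k _ → subst (ℚ._≤ seq x k ℚ.+ ε) (ℚₚ.+-identityʳ (seq x k)) (ℚₚ.+-monoʳ-≤ (seq x k) (ℚₚ.<⇒≤ 0<ε))

≤-pointwise : ∀ {x y} → Eventually (λ k → seq x k ℚ.≤ seq y k) → x ≤ y
≤-pointwise {x} {y} h ε 0<ε = Eventually-map (λ k le → ℚₚ.≤-trans le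
  (subst (ℚ._≤ seq y k ℚ.+ ε) (ℚₚ.+-identityʳ (seq y k)) (ℚₚ.+-monoʳ-≤ (seq y k) (ℚₚ.<⇒≤ 0<ε)))) h

≤-transℝ : ∀ {x y z} → x ≤ y → y ≤ z → x ≤ z
≤-transℝ {x} {y} {z} p q ε 0<ε = Eventually-map
  (λ k (a , b) → subst (seq x k ℚ.≤_) (trans (ℚₚ.+-assoc (seq z k) (½ ℚ.* ε) (½ ℚ.* ε)) (cong (seq z k ℚ.+_) (½+½ ε)))
    (ℚₚ.≤-trans a (ℚₚ.+-monoˡ-≤ (½ ℚ.* ε) b)))
  (Eventually-× (p (½ ℚ.* ε) (halve 0<ε)) (q (½ ℚ.* ε) (halve 0<ε)))

fromℚ-mono : ∀ {p q} → p ℚ.≤ q → fromℚ p ≤ fromℚ q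
fromℚ-mono {p} {q} h = ≤-pointwise {fromℚ p} {fromℚ q} (0 , λ _ _ → h)

fromℚ-cancel : ∀ {p q} → fromℚ p ≤ fromℚ q → p ℚ.≤ q
fromℚ-cancel h = ≤-by-ε λ ε 0<ε → let (N , le) = h ε 0<ε in le N ℕₚ.≤-refl

+-monoˡℝ : ∀ {x y} z → x ≤ y → x + z ≤ y + z
+-monoˡℝ {x} {y} z h ε 0<ε = Eventually-map
  (λ k le → lin le (solve 4 (λ x y z e → (y :+ z) :+ e := (x :+ z) :+ ((y :+ e) :+ (:- x))) refl (seq x k) (seq y k) (seq z k) ε)) (h ε 0<ε)
  where open +-*-Solver

+-cancelʳℝ : ∀ {x y} z → x + z ≤ y + z → x ≤ y
+-cancelʳℝ {x} {y} z h ε 0<ε = Eventually-map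
  (λ k le → lin le (solve 4 (λ x y z e → y :+ e := x :+ (((y :+ z) :+ e) :+ (:- (x :+ z)))) refl (seq x k) (seq y k) (seq z k) ε)) (h ε 0<ε)
  where open +-*-Solver

+-moveʳℝ : ∀ {x y z} → x ≤ y + z → x - z ≤ y
+-moveʳℝ {x} {y} {z} h ε 0<ε = Eventually-map
  (λ k le → lin le (solve 4 (λ x y z e → y :+ e := (x :+ (:- z)) :+ (((y :+ z) :+ e) :+ (:- x))) refl (seq x k) (seq y k) (seq z k) ε)) (h ε 0<ε)
  where open +-*-Solver

abs-≤ : ∀ {x y q} → ∣ x - y ∣ ≤ fromℚ q → x ≤ y + fromℚ q × y ≤ x + fromℚ q
abs-≤ {x} {y} {q} h =
  (λ ε 0<ε → Eventually-map (λ k le → subst (seq x k ℚ.≤_) (sym (ℚₚ.+-assoc (seq y k) q ε)) (∣-∣≤⁻ {seq x k} {seq y k} le)) (h ε 0<ε)) ,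
  (λ ε 0<ε → Eventually-map (λ k le → subst (seq y k ℚ.≤_) (sym (ℚₚ.+-assoc (seq x k) q ε)) (∣-∣≤⁻′ {seq x k} {seq y k} le)) (h ε 0<ε))

square-cancel-≤ : ∀ p q → p ℕ.* p ℕ.≤ q ℕ.* q → p ℕ.≤ q
square-cancel-≤ p q h = ℕₚ.≮⇒≥ λ q<p → ℕₚ.<⇒≱ (ℕₚ.*-mono-< q<p q<p) h

module Scaling (n : ℕ) .{{_ : ℕ.NonZero n}} where

  s : ℕ
  s = isqrt n

  abstract
    scaled : ℕ → ℝ
    scaled h = 1/√ n * fromℕ h

    private
      r : ℕ → ℕ
      r k = isqrt (n ℕ.* (suc k ℕ.* suc k))

      r-lower : ∀ k → s ℕ.* suc k ℕ.≤ r k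
      r-lower k = ℕ.s≤s⁻¹ (square-cancel-< (s ℕ.* suc k) (suc (r k)) (ℕₚ.≤-<-trans
        (ℕₚ.≤-trans (ℕₚ.≤-reflexive (solve 2 (λ s k → (s :* k) :* (s :* k) := (s :* s) :* (k :* k)) refl s (suc k)))
          (ℕₚ.*-monoˡ-≤ (suc k ℕ.* suc k) (isqrt-lower n)))
        (isqrt-upper (n ℕ.* (suc k ℕ.* suc k)))))
        where open ℕSolver.+-*-Solver

      r-upper : ∀ k → r k ℕ.≤ suc s ℕ.* suc k
      r-upper k = square-cancel-≤ (r k) (suc s ℕ.* suc k) (ℕₚ.≤-trans (isqrt-lower (n ℕ.* (suc k ℕ.* suc k)))
        (ℕₚ.≤-trans (ℕₚ.*-monoˡ-≤ (suc k ℕ.* suc k) (ℕₚ.<⇒≤ (isqrt-upper n)))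
          (ℕₚ.≤-reflexive (solve 2 (λ s k → (s :* s) :* (k :* k) := (s :* k) :* (s :* k)) refl (suc s) (suc k)))))
        where open ℕSolver.+-*-Solver

      1≤√ : ∀ k → 1ℚ ℚ.≤ √-approx n k
      1≤√ k = frac-mono-≤ 1 0 (r k) k (subst₂ ℕ._≤_ (sym (ℕₚ.*-identityˡ (suc k))) (sym (ℕₚ.*-identityʳ (r k)))
        (ℕ.s≤s⁻¹ (square-cancel-< (suc k) (suc (r k)) (ℕₚ.≤-<-trans
          (ℕₚ.m≤n*m (suc k ℕ.* suc k) n) (isqrt-upper (n ℕ.* (suc k ℕ.* suc k)))))))

      0<√ : ∀ k → 0ℚ ℚ.< √-approx n k
      0<√ k = ℚₚ.<-≤-trans 0<1ℚ (1≤√ k)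

      √-upper : ∀ k → √-approx n k ℚ.≤ frac (suc s) 0
      √-upper k = frac-mono-≤ (r k) k (suc s) 0 (subst (ℕ._≤ suc s ℕ.* suc k) (sym (ℕₚ.*-identityʳ (r k))) (r-upper k))

      √-lower : ∀ k → frac s 0 ℚ.≤ √-approx n k
      √-lower k = frac-mono-≤ s 0 (r k) k (subst (s ℕ.* suc k ℕ.≤_) (sym (ℕₚ.*-identityʳ (r k))) (r-lower k))

      unscale : ∀ h k → seq (scaled h) k ℚ.* √-approx n k ≡ frac h 0
      unscale h k = trans (solve 3 (λ i h x → (i :* h) :* x := (x :* i) :* h) refl (recipℚ (√-approx n k)) (frac h 0) (√-approx n k))
        (trans (cong (ℚ._* frac h 0) (recipℚ-inverse (√-approx n k)
            (subst (0ℚ ℚ.<_) (sym (ℚₚ.0≤p⇒∣p∣≡p (ℚₚ.<⇒≤ (0<√ k)))) (0<√ k))))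
          (ℚₚ.*-identityˡ (frac h 0)))
        where open +-*-Solver

      cancel-√ : ∀ k {p q} → p ℚ.* √-approx n k ℚ.≤ q ℚ.* √-approx n k → p ℚ.≤ q
      cancel-√ k = ℚₚ.*-cancelʳ-≤-pos (√-approx n k) {{ℚ.positive (0<√ k)}}

    scaled-nonNeg : ∀ h → 0ℝ ≤ scaled h
    scaled-nonNeg h = ≤-pointwise {0ℝ} {scaled h} (0 , λ k _ → cancel-√ k
      (subst₂ ℚ._≤_ (sym (ℚₚ.*-zeroˡ (√-approx n k))) (sym (unscale h k)) (frac-nonNeg h 0)))

    -- Squaring removes the root from p/(d + 1) ≤ h/√n. The approximations of √n are rounded down,
    -- which is harmless in this direction, so the inequality holds at every index of the sequences.
    scaled-≥ : ∀ {p d h} → p ℕ.* p ℕ.* n ℕ.≤ (h ℕ.* suc d) ℕ.* (h ℕ.* suc d) → fromℚ (frac p d) ≤ scaled h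
    scaled-≥ {p} {d} {h} le = ≤-pointwise {fromℚ (frac p d)} {scaled h} (0 , λ k _ → cancel-√ k
      (subst₂ ℚ._≤_ (sym (frac-* p d (r k) k)) (sym (unscale h k))
        (frac-mono-≤ (p ℕ.* r k) (k ℕ.+ d ℕ.* suc k) h 0 (subst (ℕ._≤ h ℕ.* (suc d ℕ.* suc k)) (sym (ℕₚ.*-identityʳ (p ℕ.* r k)))
          (square-cancel-≤ (p ℕ.* r k) (h ℕ.* (suc d ℕ.* suc k)) (begin
            p ℕ.* r k ℕ.* (p ℕ.* r k)           ≡⟨ solve 2 (λ p r → p :* r :* (p :* r) := p :* p :* (r :* r)) refl p (r k) ⟩
            p ℕ.* p ℕ.* (r k ℕ.* r k)           ≤⟨ ℕₚ.*-monoʳ-≤ (p ℕ.* p) (isqrt-lower (n ℕ.* (suc k ℕ.* suc k))) ⟩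
            p ℕ.* p ℕ.* (n ℕ.* (suc k ℕ.* suc k)) ≡⟨ ℕₚ.*-assoc (p ℕ.* p) n (suc k ℕ.* suc k) ⟨
            p ℕ.* p ℕ.* n ℕ.* (suc k ℕ.* suc k) ≤⟨ ℕₚ.*-monoˡ-≤ (suc k ℕ.* suc k) le ⟩
            h ℕ.* suc d ℕ.* (h ℕ.* suc d) ℕ.* (suc k ℕ.* suc k) ≡⟨ solve 3 (λ h d k → h :* d :* (h :* d) :* (k :* k) := h :* (d :* k) :* (h :* (d :* k))) refl h (suc d) (suc k) ⟩
            h ℕ.* (suc d ℕ.* suc k) ℕ.* (h ℕ.* (suc d ℕ.* suc k)) ∎))))))
      where
      open ℕₚ.≤-Reasoning
      open ℕSolver.+-*-Solver

    -- Here rounding √n down goes the wrong way, so `suc (r k)` must replace `r k`. The extra p/(d +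
    -- 1) · 1/(k + 1) is at most ε √n for large k, because √n ≥ 1.
    scaled-≤ : ∀ {p d h} → (h ℕ.* suc d) ℕ.* (h ℕ.* suc d) ℕ.≤ p ℕ.* p ℕ.* n → scaled h ≤ fromℚ (frac p d)
    scaled-≤ {p} {d} {h} le ε 0<ε =
      let (N , 1/N≤) = archimedean (ε ℚ.* frac 1 p) (*-pos 0<ε (frac-pos p))
      in N , λ k hk → cancel-√ k (begin
          seq (scaled h) k ℚ.* √-approx n k            ≡⟨ unscale h k ⟩
          frac h 0                                     ≤⟨ frac-mono-≤ h 0 (p ℕ.* suc (r k)) (k ℕ.+ d ℕ.* suc k)
                                                            (subst (h ℕ.* (suc d ℕ.* suc k) ℕ.≤_) (sym (ℕₚ.*-identityʳ (p ℕ.* suc (r k)))) (key k)) ⟩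
          frac (p ℕ.* suc (r k)) (k ℕ.+ d ℕ.* suc k)   ≡⟨ trans (cong (λ t → frac (p ℕ.* t) (k ℕ.+ d ℕ.* suc k)) (ℕₚ.+-comm 1 (r k))) (sym (frac-* p d (r k ℕ.+ 1) k)) ⟩
          frac p d ℚ.* frac (r k ℕ.+ 1) k              ≡⟨ cong (frac p d ℚ.*_) (sym (frac-+ (r k) 1 k)) ⟩
          frac p d ℚ.* (√-approx n k ℚ.+ frac 1 k)     ≡⟨ ℚₚ.*-distribˡ-+ (frac p d) (√-approx n k) (frac 1 k) ⟩
          frac p d ℚ.* √-approx n k ℚ.+ frac p d ℚ.* frac 1 k ≤⟨ ℚₚ.+-monoʳ-≤ (frac p d ℚ.* √-approx n k) (small N 1/N≤ k hk) ⟩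
          frac p d ℚ.* √-approx n k ℚ.+ ε ℚ.* √-approx n k ≡⟨ ℚₚ.*-distribʳ-+ (√-approx n k) (frac p d) ε ⟨
          (frac p d ℚ.+ ε) ℚ.* √-approx n k            ∎)
      where
      open ℚₚ.≤-Reasoning
      key : ∀ k → h ℕ.* (suc d ℕ.* suc k) ℕ.≤ p ℕ.* suc (r k)
      key k = square-cancel-≤ _ _ (ℕₚ.≤-trans (ℕₚ.≤-reflexive (solve 3 (λ h d k → h :* (d :* k) :* (h :* (d :* k)) := h :* d :* (h :* d) :* (k :* k)) refl h (suc d) (suc k)))
        (ℕₚ.≤-trans (ℕₚ.*-monoˡ-≤ (suc k ℕ.* suc k) le)
        (ℕₚ.≤-trans (ℕₚ.≤-reflexive (ℕₚ.*-assoc (p ℕ.* p) n (suc k ℕ.* suc k)))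
        (ℕₚ.≤-trans (ℕₚ.*-monoʳ-≤ (p ℕ.* p) (ℕₚ.<⇒≤ (isqrt-upper (n ℕ.* (suc k ℕ.* suc k)))))
          (ℕₚ.≤-reflexive (solve 2 (λ p r → p :* p :* (r :* r) := p :* r :* (p :* r)) refl p (suc (r k))))))))
        where open ℕSolver.+-*-Solver
      small : ∀ N → frac 1 N ℚ.≤ ε ℚ.* frac 1 p → ∀ k → N ℕ.≤ k → frac p d ℚ.* frac 1 k ℚ.≤ ε ℚ.* √-approx n k
      small N 1/N≤ k N≤k = begin
        frac p d ℚ.* frac 1 k  ≤⟨ *-mono-≤-nonNeg (frac-nonNeg 1 k) (frac-nonNeg p 0)
            (frac-mono-≤ p d p 0 (ℕₚ.*-monoʳ-≤ p (s≤s z≤n)))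
            (ℚₚ.≤-trans (frac-mono-≤ 1 k 1 N (ℕₚ.*-monoʳ-≤ 1 (s≤s N≤k))) 1/N≤) ⟩
        frac p 0 ℚ.* (ε ℚ.* frac 1 p) ≡⟨ solve 3 (λ a e b → a :* (e :* b) := e :* (a :* b)) refl (frac p 0) ε (frac 1 p) ⟩
        ε ℚ.* (frac p 0 ℚ.* frac 1 p) ≡⟨ cong (ε ℚ.*_) (frac-* p 0 1 p) ⟩
        ε ℚ.* frac (p ℕ.* 1) (p ℕ.+ 0 ℕ.* suc p) ≤⟨ ℚₚ.*-monoˡ-≤-nonNeg ε {{ℚ.nonNegative (ℚₚ.<⇒≤ 0<ε)}}
            (ℚₚ.≤-trans (frac-mono-≤ (p ℕ.* 1) (p ℕ.+ 0 ℕ.* suc p) 1 0 le′) (1≤√ k)) ⟩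
        ε ℚ.* √-approx n k ∎
        where
        open +-*-Solver
        le′ : p ℕ.* 1 ℕ.* 1 ℕ.≤ 1 ℕ.* suc (p ℕ.+ 0)
        le′ rewrite ℕₚ.*-identityʳ (p ℕ.* 1) | ℕₚ.*-identityʳ p | ℕₚ.*-identityˡ (suc (p ℕ.+ 0)) | ℕₚ.+-identityʳ p = ℕₚ.n≤1+n p

    -- Replacing √n by its lower bound s weakens the conclusion but makes it linear in natural
    -- numbers. Its counterpart `scaled-≤⁻` uses s + 1 for the same reason; the difference between
    -- the two is negligible once s is large.
    scaled-≥⁻ : ∀ {p d h} → fromℚ (frac p d) ≤ scaled h → p ℕ.* s ℕ.≤ h ℕ.* suc d
    scaled-≥⁻ {p} {d} {h} le = subst₂ ℕ._≤_ (ℕₚ.*-identityʳ (p ℕ.* s)) (cong (λ t → h ℕ.* suc t) (ℕₚ.*-identityʳ d))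
      (frac-cancel-≤ (p ℕ.* s) (d ℕ.* 1) h 0 (subst (ℚ._≤ frac h 0) (frac-* p d s 0) (≤-by-ε λ ε 0<ε →
        let η = ε ℚ.* frac 1 s
            (N , x) = le η (*-pos 0<ε (frac-pos s))
        in begin
          frac p d ℚ.* frac s 0                        ≤⟨ ℚₚ.*-monoˡ-≤-nonNeg (frac p d) {{ℚ.nonNegative (frac-nonNeg p d)}} (√-lower N) ⟩
          frac p d ℚ.* √-approx n N                    ≤⟨ ℚₚ.*-monoʳ-≤-nonNeg (√-approx n N) {{ℚ.nonNegative (ℚₚ.<⇒≤ (0<√ N))}} (x N ℕₚ.≤-refl) ⟩
          (seq (scaled h) N ℚ.+ η) ℚ.* √-approx n N    ≡⟨ ℚₚ.*-distribʳ-+ (√-approx n N) (seq (scaled h) N) η ⟩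
          seq (scaled h) N ℚ.* √-approx n N ℚ.+ η ℚ.* √-approx n N ≡⟨ cong (ℚ._+ η ℚ.* √-approx n N) (unscale h N) ⟩
          frac h 0 ℚ.+ η ℚ.* √-approx n N              ≤⟨ ℚₚ.+-monoʳ-≤ (frac h 0) (η√≤ε 0<ε N) ⟩
          frac h 0 ℚ.+ ε                               ∎)))
      where
      open ℚₚ.≤-Reasoning
      η√≤ε : ∀ {ε} → 0ℚ ℚ.< ε → ∀ N → ε ℚ.* frac 1 s ℚ.* √-approx n N ℚ.≤ ε
      η√≤ε {ε} 0<ε N = begin
        ε ℚ.* frac 1 s ℚ.* √-approx n N ≤⟨ ℚₚ.*-monoˡ-≤-nonNeg (ε ℚ.* frac 1 s) {{ℚ.nonNegative (*-nonNeg (ℚₚ.<⇒≤ 0<ε) (frac-nonNeg 1 s))}} (√-upper N) ⟩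
        ε ℚ.* frac 1 s ℚ.* frac (suc s) 0 ≡⟨ ℚₚ.*-assoc ε (frac 1 s) (frac (suc s) 0) ⟩
        ε ℚ.* (frac 1 s ℚ.* frac (suc s) 0) ≡⟨ cong (ε ℚ.*_) (trans (frac-* 1 s (suc s) 0) (frac-cong (1 ℕ.* suc s) (0 ℕ.+ s ℕ.* 1) 1 0
            (ℕSolver.+-*-Solver.solve 1 (λ s → NS.con 1 NS.:* (NS.con 1 NS.:+ s) NS.:* NS.con 1 NS.:= NS.con 1 NS.:* (NS.con 1 NS.:+ (NS.con 0 NS.:+ s NS.:* NS.con 1))) refl s))) ⟩
        ε ℚ.* 1ℚ ≡⟨ ℚₚ.*-identityʳ ε ⟩
        ε ∎
        where module NS = ℕSolver.+-*-Solver

    -- The common core of the two upper estimates that follow: h ≤ (p/(d + 1) + ε) √n + ε need be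
    -- known only at one index of the sequences for each ε, as √n ≤ s + 1 holds at every index.
    √-≥⁻ : ∀ {p d h} → (∀ ε → 0ℚ ℚ.< ε → ∃[ k ] frac h 0 ℚ.≤ (frac p d ℚ.+ ε) ℚ.* √-approx n k ℚ.+ ε) → h ℕ.* suc d ℕ.≤ p ℕ.* suc s
    √-≥⁻ {p} {d} {h} le = subst₂ ℕ._≤_ (cong (λ t → h ℕ.* suc t) (ℕₚ.*-identityʳ d)) (ℕₚ.*-identityʳ (p ℕ.* suc s))
      (frac-cancel-≤ h 0 (p ℕ.* suc s) (d ℕ.* 1) (subst (frac h 0 ℚ.≤_) (frac-* p d (suc s) 0) (≤-by-ε λ ε 0<ε →
        -- The error is η √n + η, which is at most η (s + 2) = ε.
        let η = ε ℚ.* frac 1 (suc s)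
            0<η = *-pos 0<ε (frac-pos (suc s))
            (N , x) = le η 0<η
        in begin
          frac h 0                                     ≤⟨ x ⟩
          (frac p d ℚ.+ η) ℚ.* √-approx n N ℚ.+ η      ≤⟨ ℚₚ.+-monoˡ-≤ η (ℚₚ.*-monoˡ-≤-nonNeg (frac p d ℚ.+ η)
                                                            {{ℚ.nonNegative (ℚₚ.+-mono-≤ (frac-nonNeg p d) (ℚₚ.<⇒≤ 0<η))}} (√-upper N)) ⟩
          (frac p d ℚ.+ η) ℚ.* frac (suc s) 0 ℚ.+ η    ≡⟨ solve 4 (λ p e i s → (p :+ e :* i) :* s :+ e :* i := p :* s :+ e :* (i :* (con 1ℚ :+ s))) refl (frac p d) ε (frac 1 (suc s)) (frac (suc s) 0) ⟩
          frac p d ℚ.* frac (suc s) 0 ℚ.+ ε ℚ.* (frac 1 (suc s) ℚ.* (1ℚ ℚ.+ frac (suc s) 0)) ≡⟨ cong (λ t → frac p d ℚ.* frac (suc s) 0 ℚ.+ ε ℚ.* t) unit ⟩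
          frac p d ℚ.* frac (suc s) 0 ℚ.+ ε ℚ.* 1ℚ     ≡⟨ cong (frac p d ℚ.* frac (suc s) 0 ℚ.+_) (ℚₚ.*-identityʳ ε) ⟩
          frac p d ℚ.* frac (suc s) 0 ℚ.+ ε            ∎)))
      where
      open ℚₚ.≤-Reasoning
      open +-*-Solver
      module NS = ℕSolver.+-*-Solver
      unit : frac 1 (suc s) ℚ.* (1ℚ ℚ.+ frac (suc s) 0) ≡ 1ℚ
      unit = trans (cong (frac 1 (suc s) ℚ.*_) (sym (frac-suc (suc s))))
        (trans (frac-* 1 (suc s) (suc (suc s)) 0) (frac-cong (1 ℕ.* suc (suc s)) (0 ℕ.+ suc s ℕ.* 1) 1 0
            (NS.solve 1 (λ s → NS.con 1 NS.:* (NS.con 1 NS.:+ s) NS.:* NS.con 1 NS.:= NS.con 1 NS.:* (NS.con 1 NS.:+ (NS.con 0 NS.:+ s NS.:* NS.con 1))) refl (suc s))))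

    scaled-≤⁻ : ∀ {p d h} → scaled h ≤ fromℚ (frac p d) → h ℕ.* suc d ℕ.≤ p ℕ.* suc s
    scaled-≤⁻ {p} {d} {h} le = √-≥⁻ {p} {d} {h} λ ε 0<ε →
      let (N , x) = le ε 0<ε
      in N , subst₂ ℚ._≤_ (unscale h N) refl (ℚₚ.≤-trans
           (ℚₚ.*-monoʳ-≤-nonNeg (√-approx n N) {{ℚ.nonNegative (ℚₚ.<⇒≤ (0<√ N))}} (x N ℕₚ.≤-refl))
           (subst (ℚ._≤ (frac p d ℚ.+ ε) ℚ.* √-approx n N ℚ.+ ε) (ℚₚ.+-identityʳ _)
             (ℚₚ.+-monoʳ-≤ ((frac p d ℚ.+ ε) ℚ.* √-approx n N) (ℚₚ.<⇒≤ 0<ε))))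

    multiple-of-√-≥⁻ : ∀ {x p d h} → x ≤ fromℚ (frac p d) → fromℕ h ≤ x * √ n → h ℕ.* suc d ℕ.≤ p ℕ.* suc s
    multiple-of-√-≥⁻ {x} {p} {d} {h} x≤ le = √-≥⁻ {p} {d} {h} λ ε 0<ε →
      let (N , y) = Eventually-× (x≤ ε 0<ε) (le ε 0<ε)
          (a , b) = y N ℕₚ.≤-refl
      in N , ℚₚ.≤-trans b (ℚₚ.+-monoˡ-≤ ε (ℚₚ.*-monoʳ-≤-nonNeg (√-approx n N) {{ℚ.nonNegative (ℚₚ.<⇒≤ (0<√ N))}} a))

    scaled-mono : ∀ {g h} → g ℕ.≤ h → scaled g ≤ scaled h
    scaled-mono {g} {h} g≤h = ≤-pointwise {scaled g} {scaled h} (0 , λ k _ → cancel-√ k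
      (subst₂ ℚ._≤_ (sym (unscale g k)) (sym (unscale h k)) (frac-mono-≤ g 0 h 0 (ℕₚ.*-monoˡ-≤ 1 g≤h))))

    scaled-+ : ∀ {x g h} → x ≤ scaled h → scaled g + x ≤ scaled (g ℕ.+ h)
    scaled-+ {x} {g} {h} x≤ ε 0<ε = Eventually-map (λ k le → subst (seq (scaled g) k ℚ.+ seq x k ℚ.≤_)
        (trans (sym (ℚₚ.+-assoc (seq (scaled g) k) (seq (scaled h) k) ε))
          (cong (ℚ._+ ε) (trans (sym (ℚₚ.*-distribˡ-+ (recipℚ (√-approx n k)) (frac g 0) (frac h 0)))
            (cong (recipℚ (√-approx n k) ℚ.*_) (frac-+ g h 0)))))
        (ℚₚ.+-monoʳ-≤ (seq (scaled g) k) le)) (x≤ ε 0<ε)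

    -- At x = (m + 1)/√n the product x √n is the integer m + 1, so the ceiling is known and the
    -- boundary curve has the value `row Λ m`.
    boundary : ∀ (Λ : Partition) m → Rescaled n Λ (scaled (suc m)) (scaled (row Λ m))
    boundary Λ m = row Λ m , inj₂ (m ,
        (1ℚ , 0<1ℚ , 0 , λ k _ → ℚₚ.≤-reflexive (trans (frac-+ m 1 0) (trans (cong (λ t → frac t 0) (ℕₚ.+-comm m 1)) (sym (unscale (suc m) k))))) ,
        ≤-pointwise {scaled (suc m) * √ n} {fromℕ (suc m)} (0 , λ k _ → ℚₚ.≤-reflexive (unscale (suc m) k)) , refl) ,
      (≤-reflℝ {scaled (row Λ m)} , ≤-reflℝ {scaled (row Λ m)})

    -- The abscissa 0 lies in [0, a] as soon as a ≥ 0, so the longest row can be bounded without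
    -- comparing 1/√n with a.
    boundary₀ : ∀ (Λ : Partition) → Rescaled n Λ 0ℝ (scaled (row Λ 0))
    boundary₀ Λ = row Λ 0 , inj₁ ((≤-pointwise {0ℝ * √ n} {0ℝ} (0 , λ k _ → ℚₚ.≤-reflexive (ℚₚ.*-zeroˡ (√-approx n k))) ,
        ≤-pointwise {0ℝ} {0ℝ * √ n} (0 , λ k _ → ℚₚ.≤-reflexive (sym (ℚₚ.*-zeroˡ (√-approx n k))))) , refl) ,
      (≤-reflℝ {scaled (row Λ 0)} , ≤-reflℝ {scaled (row Λ 0)})

-- Counting cells by grid squares

remQuot-injective : ∀ {m} n {i j : Fin (m ℕ.* n)} → remQuot {m} n i ≡ remQuot n j → i ≡ j
remQuot-injective {m} n {i} {j} eq = trans (sym (Finₚ.combine-remQuot {m} n i))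
  (trans (cong (uncurry combine) eq) (Finₚ.combine-remQuot {m} n j))

m<[1+m/n]*n : ∀ m n .{{_ : ℕ.NonZero n}} → m ℕ.< suc (m ℕ./ n) ℕ.* n
m<[1+m/n]*n m n = subst (ℕ._< suc (m ℕ./ n) ℕ.* n) (sym (m≡m%n+[m/n]*n m n)) (ℕₚ.+-monoˡ-< ((m ℕ./ n) ℕ.* n) (m%n<n m n))

Separated : (lo hi : ℕ → ℕ) → Set
Separated lo hi = ∀ {i j} → i ℕ.< j → hi i ℕ.≤ lo j

separated-unique : ∀ {lo hi} → Separated lo hi → ∀ {i j} w →
  lo i ℕ.< w → w ℕ.≤ hi i → lo j ℕ.< w → w ℕ.≤ hi j → i ≡ j
separated-unique sep {i} {j} w a b c d with ℕₚ.<-cmp i j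
... | tri< i<j _ _ = contradiction (ℕₚ.≤-trans b (sep i<j)) (ℕₚ.<⇒≱ c)
... | tri≈ _ eq _  = eq
... | tri> _ _ j<i = contradiction (ℕₚ.≤-trans d (sep j<i)) (ℕₚ.<⇒≱ a)

-- Row u runs through the grid square (i , j) when lo₁ i < (u + 1) K ≤ hi₁ i, and
-- column v does when lo₂ j < v D and (v + 1) D ≤ hi₂ j.
module _ (υ : SkewShape) (I : List (ℕ × ℕ)) (I-unique : Unique I)
  (K D P Q : ℕ) .{{_ : ℕ.NonZero K}} .{{_ : ℕ.NonZero D}}
  (lo₁ hi₁ lo₂ hi₂ : ℕ → ℕ) (sep₁ : Separated lo₁ hi₁) (sep₂ : Separated lo₂ hi₂)
  (room₁ : ∀ {i j} → (i , j) ∈ I → lo₁ i ℕ.+ P ℕ.* K ℕ.≤ hi₁ i)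
  (room₂ : ∀ {i j} → (i , j) ∈ I → lo₂ j ℕ.+ suc Q ℕ.* D ℕ.≤ hi₂ j)
  (inside : ∀ {i j} → (i , j) ∈ I → ∀ u → lo₁ i ℕ.≤ suc u ℕ.* K → suc u ℕ.* K ℕ.≤ hi₁ i →
    row (inner υ) u ℕ.* D ℕ.≤ lo₂ j × hi₂ j ℕ.≤ row (outer υ) u ℕ.* D) where

  private
    module _ (lo w : ℕ) .{{_ : ℕ.NonZero w}} where
      slot-lower : ∀ x → lo ℕ.< suc (lo ℕ./ w ℕ.+ x) ℕ.* w
      slot-lower x = ℕₚ.<-≤-trans (m<[1+m/n]*n lo w) (ℕₚ.*-monoˡ-≤ w (s≤s (ℕₚ.m≤m+n (lo ℕ./ w) x)))
      slot-upper : ∀ {x X} → x ℕ.< X → suc (lo ℕ./ w ℕ.+ x) ℕ.* w ℕ.≤ lo ℕ.+ X ℕ.* w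
      slot-upper {x} {X} x<X = subst (ℕ._≤ lo ℕ.+ X ℕ.* w)
        (solve 3 (λ q x w → q :* w :+ (con 1 :+ x) :* w := (con 1 :+ (q :+ x)) :* w) refl (lo ℕ./ w) x w)
        (ℕₚ.+-mono-≤ (m/n*n≤m lo w) (ℕₚ.*-monoˡ-≤ w x<X))
        where open ℕSolver.+-*-Solver

    Index = Fin (length I ℕ.* (P ℕ.* Q))
    cellAt : Fin (length I) × Fin (P ℕ.* Q) → Cell
    cellAt (a , b) = let (x , y) = remQuot {P} Q b
                         (i , j) = lookup I a
                     -- A row is tested only at its far edge u + 1, whereas a column must have both
                     -- edges v and v + 1 inside the square. Hence the additional `suc` for v, and
                     -- room for `suc Q` instead of Q slots in `room₂`.
                     in lo₁ i ℕ./ K ℕ.+ toℕ x , suc (lo₂ j ℕ./ D ℕ.+ toℕ y)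

    module _ (a : Fin (length I)) (x : Fin P) (y : Fin Q) where
      i = proj₁ (lookup I a)
      j = proj₂ (lookup I a)
      u = lo₁ i ℕ./ K ℕ.+ toℕ x
      v = suc (lo₂ j ℕ./ D ℕ.+ toℕ y)
      u-lower : lo₁ i ℕ.< suc u ℕ.* K
      u-lower = slot-lower (lo₁ i) K (toℕ x)
      u-upper : suc u ℕ.* K ℕ.≤ hi₁ i
      u-upper = ℕₚ.≤-trans (slot-upper (lo₁ i) K (Finₚ.toℕ<n x)) (room₁ (∈-lookup a))
      v-lower : lo₂ j ℕ.< v ℕ.* D
      v-lower = slot-lower (lo₂ j) D (toℕ y)
      v-upper : suc v ℕ.* D ℕ.≤ hi₂ j
      v-upper = ℕₚ.≤-trans (subst (ℕ._≤ lo₂ j ℕ.+ suc Q ℕ.* D)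
        (cong (λ t → suc t ℕ.* D) (ℕₚ.+-suc (lo₂ j ℕ./ D) (toℕ y)))
        (slot-upper (lo₂ j) D (s≤s (Finₚ.toℕ<n y)))) (room₂ (∈-lookup a))
      inShape : InShape υ (u , v)
      inShape = let (p , q) = inside (∈-lookup a) u (ℕₚ.<⇒≤ u-lower) u-upper in
        ℕₚ.*-cancelʳ-≤ _ _ D (ℕₚ.≤-trans p (ℕₚ.<⇒≤ v-lower)) ,
        ℕₚ.*-cancelʳ-≤ _ _ D (ℕₚ.≤-trans v-upper q)

    cellAt-injective : Injective _≡_ _≡_ cellAt
    cellAt-injective {a , b} {a′ , b′} eq = cong₂ _,_ a≡a′ (remQuot-injective {P} Q (cong₂ _,_ x≡x′ y≡y′))
      where
      x = proj₁ (remQuot {P} Q b)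
      y = proj₂ (remQuot {P} Q b)
      x′ = proj₁ (remQuot {P} Q b′)
      y′ = proj₂ (remQuot {P} Q b′)
      u≡ = proj₁ (,-injective eq)
      v≡ = proj₂ (,-injective eq)
      i≡ : i a x y ≡ i a′ x′ y′
      i≡ = separated-unique {lo₁} {hi₁} sep₁ (suc (u a x y) ℕ.* K) (u-lower a x y) (u-upper a x y)
        (subst (λ t → lo₁ (i a′ x′ y′) ℕ.< suc t ℕ.* K) (sym u≡) (u-lower a′ x′ y′))
        (subst (λ t → suc t ℕ.* K ℕ.≤ hi₁ (i a′ x′ y′)) (sym u≡) (u-upper a′ x′ y′))
      weaken : ∀ {w h} → suc w ℕ.* D ℕ.≤ h → w ℕ.* D ℕ.≤ h
      weaken {w} = ℕₚ.≤-trans (ℕₚ.m≤n+m (w ℕ.* D) D)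
      j≡ : j a x y ≡ j a′ x′ y′
      j≡ = separated-unique {lo₂} {hi₂} sep₂ (v a x y ℕ.* D) (v-lower a x y) (weaken {v a x y} (v-upper a x y))
        (subst (λ t → lo₂ (j a′ x′ y′) ℕ.< t ℕ.* D) (sym v≡) (v-lower a′ x′ y′))
        (subst (λ t → t ℕ.* D ℕ.≤ hi₂ (j a′ x′ y′)) (sym v≡) (weaken {v a′ x′ y′} (v-upper a′ x′ y′)))
      a≡a′ : a ≡ a′
      a≡a′ = lookup-injective I-unique (cong₂ _,_ i≡ j≡)
      x≡x′ : x ≡ x′
      x≡x′ = Finₚ.toℕ-injective (ℕₚ.+-cancelˡ-≡ (lo₁ (i a x y) ℕ./ K) _ _
        (trans u≡ (cong (λ t → lo₁ t ℕ./ K ℕ.+ toℕ x′) (sym i≡))))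
      y≡y′ : y ≡ y′
      y≡y′ = Finₚ.toℕ-injective (ℕₚ.+-cancelˡ-≡ (lo₂ (j a x y) ℕ./ D) _ _
        (ℕₚ.suc-injective (trans v≡ (cong (λ t → suc (lo₂ t ℕ./ D ℕ.+ toℕ y′)) (sym j≡)))))

  size-lower : length I ℕ.* (P ℕ.* Q) ℕ.≤ size υ
  size-lower = injection-into-list {m = length I ℕ.* (P ℕ.* Q)} (cellAt ∘ remQuot {length I} (P ℕ.* Q))
    (λ eq → remQuot-injective {length I} (P ℕ.* Q) (cellAt-injective eq))
    λ c → let (a , b) = remQuot {length I} (P ℕ.* Q) c
              (x , y) = remQuot {P} Q b
          in ∈-cells⁺ υ (inShape a x y)

length-cartesianProduct : ∀ {A B : Set} (xs : List A) (ys : List B) →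
  length (cartesianProduct xs ys) ≡ length xs ℕ.* length ys
length-cartesianProduct []       ys = refl
length-cartesianProduct (x ∷ xs) ys = trans (length-++ (map (x ,_) ys))
  (cong₂ ℕ._+_ (length-map (x ,_) ys) (length-cartesianProduct xs ys))

-- A grid interval contains only numbers that differ by less than P, so a residue modulo P
-- identifies a number within it.
%-separates : ∀ {P} .{{_ : ℕ.NonZero P}} {m n} → m ℕ.≤ n → n ℕ.< m ℕ.+ P → m ℕ.% P ≡ n ℕ.% P → m ≡ n
%-separates {P} {m} {n} m≤n n<m+P eq with ℕₚ.<-cmp (m ℕ./ P) (n ℕ./ P)
... | tri≈ _ q _ = trans (m≡m%n+[m/n]*n m P) (trans (cong₂ (λ r q → r ℕ.+ q ℕ.* P) eq q) (sym (m≡m%n+[m/n]*n n P)))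
... | tri< lt _ _ = contradiction n<m+P (ℕₚ.≤⇒≯ (subst₂ ℕ._≤_
        (trans (solve 3 (λ r q p → r :+ (con 1 :+ q) :* p := (r :+ q :* p) :+ p) refl (m ℕ.% P) (m ℕ./ P) P)
          (cong (ℕ._+ P) (sym (m≡m%n+[m/n]*n m P))))
        (trans (cong (ℕ._+ (n ℕ./ P) ℕ.* P) eq) (sym (m≡m%n+[m/n]*n n P)))
        (ℕₚ.+-monoʳ-≤ (m ℕ.% P) (ℕₚ.*-monoˡ-≤ P lt))))
  where open ℕSolver.+-*-Solver
... | tri> _ _ gt = contradiction m≤n (ℕₚ.<⇒≱ (subst₂ ℕ._<_
        (trans (cong (ℕ._+ (n ℕ./ P) ℕ.* P) eq) (sym (m≡m%n+[m/n]*n n P))) (sym (m≡m%n+[m/n]*n m P))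
        (ℕₚ.+-monoʳ-< (m ℕ.% P) (ℕₚ.*-monoˡ-< P gt))))

module _ (υ : SkewShape) (O : List (ℤ × ℤ)) (floor : ℕ → ℕ) (P c U : ℕ) .{{_ : ℕ.NonZero P}}
  (floor-fibre : ∀ {m n} → floor m ≡ floor n → m ℕ.≤ n → n ℕ.< m ℕ.+ P)
  (covered : ∀ u v → u ℕ.< U → row (inner υ) u ℕ.+ c ℕ.≤ v → v ℕ.+ c ℕ.≤ row (outer υ) u →
    (+ floor (suc u) , + floor v) ∈ O) where

  private
    L = ℓ (outer υ)
    R = row (outer υ) 0

    fibre-injective : ∀ {m n} → floor m ≡ floor n → m ℕ.% P ≡ n ℕ.% P → m ≡ n
    fibre-injective {m} {n} fl mod with ℕₚ.≤-total m n
    ... | inj₁ m≤n = %-separates m≤n (floor-fibre fl m≤n) mod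
    ... | inj₂ n≤m = sym (%-separates n≤m (floor-fibre (sym fl) n≤m) (sym mod))

    -- The four summands record why a cell is counted: its grid square belongs to O, and residues
    -- modulo P locate it there; it is within c of the left end of its row; it is within c of the
    -- right end; or its row has index at least U. They account for the four terms of `size-upper`.
    Code : Set
    Code = ((ℤ × ℤ) × ℕ × ℕ) ⊎ ((ℕ × ℕ) ⊎ ((ℕ × ℕ) ⊎ (ℕ × ℕ)))

    data Coded (u v : ℕ) : Code → Set where
      inner-cell : (+ floor (suc u) , + floor v) ∈ O →
        Coded u v (inj₁ ((+ floor (suc u) , + floor v) , (suc u ℕ.% P , v ℕ.% P)))
      left-cell  : row (inner υ) u ℕ.≤ v → v ℕ.< row (inner υ) u ℕ.+ c → Coded u v (inj₂ (inj₁ (u , v ℕ.∸ row (inner υ) u)))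
      right-cell : v ℕ.< row (outer υ) u → row (outer υ) u ℕ.< v ℕ.+ c → Coded u v (inj₂ (inj₂ (inj₁ (u , row (outer υ) u ℕ.∸ suc v))))
      low-cell   : U ℕ.≤ u → Coded u v (inj₂ (inj₂ (inj₂ (u ℕ.∸ U , v))))

    encode : ∀ u v → InShape υ (u , v) → ∃[ x ] Coded u v x
    encode u v (μ≤v , v<λ) with u ℕ.<? U | row (inner υ) u ℕ.+ c ℕ.≤? v | v ℕ.+ c ℕ.≤? row (outer υ) u
    ... | no u≮U  | _     | _     = _ , low-cell (ℕₚ.≮⇒≥ u≮U)
    ... | yes _   | no h  | _     = _ , left-cell μ≤v (ℕₚ.≰⇒> h)
    ... | yes _   | yes _ | no h  = _ , right-cell v<λ (ℕₚ.≰⇒> h)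
    ... | yes u<U | yes h | yes k = _ , inner-cell (covered u v u<U h k)

    decode : ∀ {u v u′ v′ x} → Coded u v x → Coded u′ v′ x → (u , v) ≡ (u′ , v′)
    decode {u} {v} {u′} {v′} x y = go x y refl
      where
      go : ∀ {a b} → Coded u v a → Coded u′ v′ b → a ≡ b → (u , v) ≡ (u′ , v′)
      go (inner-cell _) (inner-cell _) eq =
        let (fl , md) = ,-injective (inj₁-injective eq)
            (f₁ , f₂) = ,-injective fl
            (m₁ , m₂) = ,-injective md
        in cong₂ _,_ (ℕₚ.suc-injective (fibre-injective (ℤₚ.+-injective f₁) m₁)) (fibre-injective (ℤₚ.+-injective f₂) m₂)
      go (left-cell p _) (left-cell q _) eq with ,-injective (inj₁-injective (inj₂-injective eq))
      ... | refl , h = cong (u ,_) (ℕₚ.∸-cancelʳ-≡ p q h)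
      go (right-cell p _) (right-cell q _) eq with ,-injective (inj₁-injective (inj₂-injective (inj₂-injective eq)))
      ... | refl , h = cong (u ,_) (ℕₚ.suc-injective (ℕₚ.∸-cancelˡ-≡ p q h))
      go (low-cell p) (low-cell q) eq with ,-injective (inj₂-injective (inj₂-injective (inj₂-injective eq)))
      ... | h , refl = cong (_, v) (ℕₚ.∸-cancelʳ-≡ p q h)

    codes₁ codes₂ codes₃ codes₄ codes : List Code
    codes₁ = map inj₁ (cartesianProduct O (cartesianProduct (upTo P) (upTo P)))
    codes₂ = map (inj₂ ∘ inj₁) (cartesianProduct (upTo L) (upTo c))
    codes₃ = map (inj₂ ∘ inj₂ ∘ inj₁) (cartesianProduct (upTo L) (upTo c))
    codes₄ = map (inj₂ ∘ inj₂ ∘ inj₂) (cartesianProduct (upTo (L ℕ.∸ U)) (upTo R))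
    codes = codes₁ ++ (codes₂ ++ (codes₃ ++ codes₄))

    rect : ∀ {A : Set} (f : ℕ × ℕ → A) p q → length (map f (cartesianProduct (upTo p) (upTo q))) ≡ p ℕ.* q
    rect f p q = trans (length-map f (cartesianProduct (upTo p) (upTo q))) (trans (length-cartesianProduct (upTo p) (upTo q)) (cong₂ ℕ._*_ (length-upTo p) (length-upTo q)))

    length-codes : length codes ≡ length O ℕ.* (P ℕ.* P) ℕ.+ (L ℕ.* c ℕ.+ (L ℕ.* c ℕ.+ (L ℕ.∸ U) ℕ.* R))
    length-codes =
      trans (length-++ codes₁) (cong₂ ℕ._+_
        (trans (length-map inj₁ (cartesianProduct O (cartesianProduct (upTo P) (upTo P)))) (trans (length-cartesianProduct O (cartesianProduct (upTo P) (upTo P))) (cong (length O ℕ.*_)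
          (trans (length-cartesianProduct (upTo P) (upTo P)) (cong₂ ℕ._*_ (length-upTo P) (length-upTo P))))))
      (trans (length-++ codes₂) (cong₂ ℕ._+_ (rect _ L c)
      (trans (length-++ codes₃) (cong₂ ℕ._+_ (rect _ L c) (rect _ (L ℕ.∸ U) R))))))

    coded-∈ : ∀ {u v x} → u ℕ.< L → v ℕ.< R → Coded u v x → x ∈ codes
    coded-∈ {u} {v} u<L v<R (inner-cell m) = ∈-++⁺ˡ (∈-map⁺ inj₁ (∈-cartesianProduct⁺ m
      (∈-cartesianProduct⁺ (∈-upTo⁺ (m%n<n (suc u) P)) (∈-upTo⁺ (m%n<n v P)))))
    coded-∈ {u} {v} u<L v<R (left-cell p q) = ∈-++⁺ʳ codes₁ (∈-++⁺ˡ (∈-map⁺ (inj₂ ∘ inj₁) (∈-cartesianProduct⁺ (∈-upTo⁺ u<L)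
      (∈-upTo⁺ (ℕₚ.m<n+o⇒m∸n<o v (row (inner υ) u) {c} {{positive-c}} q)))))
      where
      positive-c : ℕ.NonZero c
      positive-c = ℕ.>-nonZero (ℕₚ.+-cancelˡ-< (row (inner υ) u) 0 c
        (subst (ℕ._< row (inner υ) u ℕ.+ c) (sym (ℕₚ.+-identityʳ (row (inner υ) u))) (ℕₚ.≤-<-trans p q)))
    coded-∈ {u} {v} u<L v<R (right-cell p q) = ∈-++⁺ʳ codes₁ (∈-++⁺ʳ codes₂ (∈-++⁺ˡ (∈-map⁺ (inj₂ ∘ inj₂ ∘ inj₁) (∈-cartesianProduct⁺ (∈-upTo⁺ u<L)
      (∈-upTo⁺ (ℕₚ.+-cancelʳ-< (suc v) (row (outer υ) u ℕ.∸ suc v) c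
        (subst₂ ℕ._<_ (sym (ℕₚ.m∸n+n≡m p)) (ℕₚ.+-comm (suc v) c) (ℕₚ.<-trans q (ℕₚ.n<1+n (v ℕ.+ c))))))))))
    coded-∈ {u} {v} u<L v<R (low-cell U≤u) = ∈-++⁺ʳ codes₁ (∈-++⁺ʳ codes₂ (∈-++⁺ʳ codes₃ (∈-map⁺ (inj₂ ∘ inj₂ ∘ inj₂) (∈-cartesianProduct⁺
      (∈-upTo⁺ (ℕₚ.∸-monoˡ-< u<L U≤u)) (∈-upTo⁺ v<R)))))

    code : (p : Fin (size υ)) → ∃[ x ] Coded (proj₁ (lookup (cells υ) p)) (proj₂ (lookup (cells υ) p)) x
    code p = encode _ _ (cell-inShape υ p)

  size-upper : size υ ℕ.≤ length O ℕ.* (P ℕ.* P) ℕ.+ (L ℕ.* c ℕ.+ (L ℕ.* c ℕ.+ (L ℕ.∸ U) ℕ.* R))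
  size-upper = subst (size υ ℕ.≤_) length-codes (injection-into-list (proj₁ ∘ code)
    (λ {p} {q} eq → lookup-injective (unique-cells υ)
      (decode (proj₂ (code p)) (subst (Coded _ _) (sym eq) (proj₂ (code q)))))
    λ p → coded-∈ (row< υ p) (col< υ p) (proj₂ (code p)))

-- From areas and stable shapes to the counts in natural numbers

open Scaling using (scaled; scaled-≥; scaled-≤; scaled-≥⁻; scaled-≤⁻; scaled-mono; scaled-+; scaled-nonNeg)

/-mono-≤ : ∀ {i j} d → i ℤ.≤ j → i ℚ./ suc d ℚ.≤ j ℚ./ suc d
/-mono-≤ {i} {j} d i≤j = ℚₚ.toℚᵘ-cancel-≤
  (ℚᵘₚ.≤-respˡ-≃ (ℚᵘₚ.≃-sym (ℚₚ.toℚᵘ-fromℚᵘ (ℚᵘ.mkℚᵘ i d)))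
  (ℚᵘₚ.≤-respʳ-≃ (ℚᵘₚ.≃-sym (ℚₚ.toℚᵘ-fromℚᵘ (ℚᵘ.mkℚᵘ j d)))
  (ℚᵘ.*≤* (ℤₚ.*-monoʳ-≤-nonNeg (+ suc d) i≤j))))

/-nonNeg⁻ : ∀ i d → 0ℚ ℚ.≤ i ℚ./ suc d → ∃[ m ] i ≡ + m
/-nonNeg⁻ (+ m)        d h = m , refl
/-nonNeg⁻ ℤ.-[1+ m ] d h = contradiction
  (frac-cancel-≤ (suc m) d 0 0 (subst (ℚ._≤ 0ℚ) (+-*-Solver.solve 1 (λ x → +-*-Solver.:- (+-*-Solver.:- x) +-*-Solver.:= x) refl (frac (suc m) d)) (ℚₚ.neg-antimono-≤ h))) λ ()

ℚ-bound : ∀ q → ∃[ B ] q ℚ.≤ frac B 0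
ℚ-bound q@(ℚ.mkℚ (+ p) d _) = p , subst (ℚ._≤ frac p 0) (ℚₚ.↥p/↧p≡p q) (frac-mono-≤ p d p 0 (ℕₚ.*-monoʳ-≤ p (s≤s z≤n)))
ℚ-bound q@(ℚ.mkℚ ℤ.-[1+ p ] d _) = 0 , ℚₚ.nonPositive⁻¹ q

ℝ-bound : ∀ x → ∃[ B ] x ≤ fromℚ (frac B 0)
ℝ-bound x = let (q , _ , N , h) = eventually-bounded x
                (B , q≤B) = ℚ-bound q
            in B , ≤-pointwise {x} {fromℚ (frac B 0)}
                 (N , λ k hk → ℚₚ.≤-trans (p≤∣p∣ (seq x k)) (ℚₚ.≤-trans (h k hk) q≤B))

-- The order on ℝ is undecidable, so the search runs over multiples of 1/(m + 1) and compares them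
-- with a rational q that is within 1/(m + 1) of a. It ends with q ≤ (A + 2)/(m + 1), and passing
-- from q back to a costs one more unit, whence the 3. When the search reaches 0, the hypothesis 0 ≤
-- a supplies the lower bound.
nonNeg-approx : ∀ a → 0ℝ ≤ a → ∀ m → ∃[ A ] fromℚ (frac A m) ≤ a × a ≤ fromℚ (frac (A ℕ.+ 3) m)
nonNeg-approx a 0≤a m =
  let (A , A≤a , q≤) = search (B ℕ.* suc m) (ℚₚ.≤-trans q≤B (ℚₚ.≤-reflexive (frac-cong B 0 (B ℕ.* suc m) m (sym (ℕₚ.*-identityʳ _)))))
  in A , A≤a , ≤-pointwise {a} {fromℚ (frac (A ℕ.+ 3) m)} (N , λ i hi → ℚₚ.≤-trans (∣-∣≤⁻ {seq a i} {q} (close i N hi ℕₚ.≤-refl))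
      (ℚₚ.≤-trans (ℚₚ.+-monoˡ-≤ (frac 1 m) q≤) (ℚₚ.≤-reflexive (trans (frac-+ (A ℕ.+ 2) 1 m) (cong (λ t → frac t m) (ℕₚ.+-assoc A 2 1))))))
  where
  N = proj₁ (cauchy a (frac 1 m) (frac-pos m))
  close = proj₂ (cauchy a (frac 1 m) (frac-pos m))
  q = seq a N
  B = proj₁ (ℚ-bound q)
  q≤B = proj₂ (ℚ-bound q)
  up : ∀ x y → x ℕ.≤ y → frac x m ℚ.≤ frac y m
  up x y h = frac-mono-≤ x m y m (ℕₚ.*-monoˡ-≤ (suc m) h)
  zero-below : fromℚ (frac 0 m) ≤ a
  zero-below = ≤-transℝ {fromℚ (frac 0 m)} {0ℝ} {a} (fromℚ-mono (frac-mono-≤ 0 m 0 0 z≤n)) 0≤a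
  search : ∀ X → q ℚ.≤ frac X m → ∃[ A ] fromℚ (frac A m) ≤ a × q ℚ.≤ frac (A ℕ.+ 2) m
  step : ∀ X → q ℚ.≤ frac (suc X) m → Dec (q ℚ.≤ frac X m) → ∃[ A ] fromℚ (frac A m) ≤ a × q ℚ.≤ frac (A ℕ.+ 2) m
  search zero    h = 0 , zero-below , ℚₚ.≤-trans h (up 0 2 z≤n)
  search (suc X) h = step X h (q ℚₚ.≤? frac X m)
  step X       h (yes h′) = search X h′
  step zero    h (no _)   = 0 , zero-below , ℚₚ.≤-trans h (up 1 2 (s≤s z≤n))
  step (suc X) h (no ¬h)  = X , ≤-pointwise {fromℚ (frac X m)} {a} (N , λ i hi →
      lin (ℚₚ.≤-trans (ℚₚ.≤-trans (ℚₚ.≤-reflexive (trans (frac-+ X 1 m) (cong (λ t → frac t m) (ℕₚ.+-comm X 1)))) (ℚₚ.<⇒≤ (ℚₚ.≰⇒> ¬h)))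
             (∣-∣≤⁻ {q} {seq a i} (close N i ℕₚ.≤-refl hi)))
          (solve 3 (λ x a e → a := x :+ ((a :+ e) :+ (:- (x :+ e)))) refl (frac X m) (seq a i) (frac 1 m))) ,
    ℚₚ.≤-trans h (ℚₚ.≤-reflexive (cong (λ t → frac t m) (ℕₚ.+-comm 2 X)))
    where open +-*-Solver

NearAt : Partition → ℝ → (ℝ → ℝ) → ℕ → (n : ℕ) .{{_ : ℕ.NonZero n}} → Set
NearAt Λ a ω M n = ∀ m → scaled n (suc m) ≤ a →
  scaled n (row Λ m) ≤ ω (scaled n (suc m)) + fromℚ (frac 1 M) ×
  ω (scaled n (suc m)) ≤ scaled n (row Λ m) + fromℚ (frac 1 M)

CloseTo : Partition → ℝ → (ℝ → ℝ) → ℚ → (n : ℕ) .{{_ : ℕ.NonZero n}} → Set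
CloseTo Λ a ω ε n = ∀ x y → Icc 0ℝ a x → Rescaled n Λ x y → ∣ y - ω x ∣ ≤ fromℚ ε

close⇒near : ∀ Λ a ω M n .{{_ : ℕ.NonZero n}} → CloseTo Λ a ω (frac 1 M) n → NearAt Λ a ω M n
close⇒near Λ a ω M n h m x≤a = abs-≤ {scaled n (row Λ m)} {ω (scaled n (suc m))} {frac 1 M}
  (h (scaled n (suc m)) (scaled n (row Λ m)) (scaled-nonNeg n (suc m) , x≤a) (Scaling.boundary n Λ m))

stable-near : ∀ {Λ a ω} → HasStableShape Λ a ω → ∀ M → Eventually λ n → .{{_ : ℕ.NonZero n}} → NearAt (Λ n) a ω M n
stable-near {Λ} {a} {ω} (shape , _) M =
  let (N , p) = shape (frac 1 M) (frac-pos M)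
  in N , λ n hn → close⇒near (Λ n) a ω M n (p n hn)

close⇒row₀ : ∀ Λ a ω b B n .{{_ : ℕ.NonZero n}} → 0ℝ ≤ a → ω 0ℝ ≤ b → b ≤ fromℚ (frac B 0) →
  CloseTo Λ a ω 1ℚ n → row Λ 0 ℕ.≤ (B ℕ.+ 1) ℕ.* suc (isqrt n)
close⇒row₀ Λ a ω b B n 0≤a ω0≤b b≤B h =
  subst (ℕ._≤ (B ℕ.+ 1) ℕ.* suc (isqrt n)) (ℕₚ.*-identityʳ (row Λ 0)) (scaled-≤⁻ n {B ℕ.+ 1} {0} {row Λ 0} y≤B+1)
  where
  y = scaled n (row Λ 0)
  y≤ : y ≤ ω 0ℝ + fromℚ 1ℚ
  y≤ = proj₁ (abs-≤ {y} {ω 0ℝ} {1ℚ} (h 0ℝ y (≤-reflℝ {0ℝ} , 0≤a) (Scaling.boundary₀ n Λ)))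
  ω0≤B : ω 0ℝ ≤ fromℚ (frac B 0)
  ω0≤B = ≤-transℝ {ω 0ℝ} {b} {fromℚ (frac B 0)} ω0≤b b≤B
  y≤B+1 : y ≤ fromℚ (frac (B ℕ.+ 1) 0)
  y≤B+1 = ≤-transℝ {y} {ω 0ℝ + fromℚ 1ℚ} {fromℚ (frac (B ℕ.+ 1) 0)} y≤
    (≤-transℝ {ω 0ℝ + fromℚ 1ℚ} {fromℚ (frac B 0) + fromℚ 1ℚ} {fromℚ (frac (B ℕ.+ 1) 0)}
      (+-monoˡℝ {ω 0ℝ} {fromℚ (frac B 0)} (fromℚ 1ℚ) ω0≤B)
      (fromℚ-mono {frac B 0 ℚ.+ 1ℚ} {frac (B ℕ.+ 1) 0} (ℚₚ.≤-reflexive (frac-+ B 1 0))))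

stable-row₀ : ∀ {Λ a ω b B} → 0ℝ ≤ a → MapsTo (Icc 0ℝ a) (Icc 0ℝ b) ω → b ≤ fromℚ (frac B 0) →
  HasStableShape Λ a ω → Eventually λ n → .{{_ : ℕ.NonZero n}} → row (Λ n) 0 ℕ.≤ (B ℕ.+ 1) ℕ.* suc (isqrt n)
stable-row₀ {Λ} {a} {ω} {b} {B} 0≤a maps b≤B (shape , _) =
  let (N , p) = shape 1ℚ 0<1ℚ
  in N , λ n hn → close⇒row₀ (Λ n) a ω b B n 0≤a (proj₂ (maps 0ℝ (≤-reflℝ {0ℝ} , 0≤a))) b≤B (p n hn)

stable-ℓ : ∀ {Λ a ω A m} → a ≤ fromℚ (frac A m) → HasStableShape Λ a ω →
  Eventually λ n → .{{_ : ℕ.NonZero n}} → ℓ (Λ n) ℕ.* suc m ℕ.≤ (A ℕ.+ 1) ℕ.* suc (isqrt n)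
stable-ℓ {Λ} {a} {ω} {A} {m} a≤ (_ , len) =
  let (N , p) = len (frac 1 m) (frac-pos m)
  in N , λ n hn → Scaling.multiple-of-√-≥⁻ n {a + fromℚ (frac 1 m)} {A ℕ.+ 1} {m} {ℓ (Λ n)} a+ε≤ (p n hn)
  where
  a+ε≤ : a + fromℚ (frac 1 m) ≤ fromℚ (frac (A ℕ.+ 1) m)
  a+ε≤ = ≤-transℝ {a + fromℚ (frac 1 m)} {fromℚ (frac A m) + fromℚ (frac 1 m)} {fromℚ (frac (A ℕ.+ 1) m)}
    (+-monoˡℝ {a} {fromℚ (frac A m)} (fromℚ (frac 1 m)) a≤)
    (fromℚ-mono {frac A m ℚ.+ frac 1 m} {frac (A ℕ.+ 1) m} (ℚₚ.≤-reflexive (frac-+ A 1 m)))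

-- ⌊m (k + 1) / √n⌋, the index of the grid interval containing m/√n
floor : (n k : ℕ) .{{_ : ℕ.NonZero n}} → ℕ → ℕ
floor n k m = isqrt ((m ℕ.* suc k) ℕ.* (m ℕ.* suc k) ℕ./ n)

module _ (n k : ℕ) .{{_ : ℕ.NonZero n}} where
  private
    s = isqrt n

  floor-lower : ∀ m → floor n k m ℕ.* floor n k m ℕ.* n ℕ.≤ (m ℕ.* suc k) ℕ.* (m ℕ.* suc k)
  floor-lower m = ℕₚ.≤-trans (ℕₚ.*-monoˡ-≤ n (isqrt-lower ((m ℕ.* suc k) ℕ.* (m ℕ.* suc k) ℕ./ n))) (m/n*n≤m ((m ℕ.* suc k) ℕ.* (m ℕ.* suc k)) n)

  floor-upper : ∀ m → (m ℕ.* suc k) ℕ.* (m ℕ.* suc k) ℕ.< suc (floor n k m) ℕ.* suc (floor n k m) ℕ.* n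
  floor-upper m = ℕₚ.<-≤-trans (m<[1+m/n]*n ((m ℕ.* suc k) ℕ.* (m ℕ.* suc k)) n) (ℕₚ.*-monoˡ-≤ n (isqrt-upper ((m ℕ.* suc k) ℕ.* (m ℕ.* suc k) ℕ./ n)))

  -- If l + P ≤ m then m/√n exceeds l/√n by at least the mesh, since D = P (k + 1) ≥ √n, and the
  -- floor must increase. In squared form the cross term of (A + D)² needs i n ≤ A D, which is the
  -- product of i √n ≤ A and √n ≤ D.
  floor-fibre : ∀ {P} → s ℕ.< P ℕ.* suc k → ∀ {l m} → floor n k l ≡ floor n k m → l ℕ.≤ m → m ℕ.< l ℕ.+ P
  floor-fibre {P} s<PK {l} {m} eq _ = ℕₚ.≰⇒> λ l+P≤m → ℕₚ.<⇒≱ (floor-upper m) (begin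
    suc (floor n k m) ℕ.* suc (floor n k m) ℕ.* n ≡⟨ cong (λ t → suc t ℕ.* suc t ℕ.* n) eq ⟨
    suc i ℕ.* suc i ℕ.* n              ≡⟨ solve 2 (λ i n → (con 1 :+ i) :* (con 1 :+ i) :* n := i :* i :* n :+ (con 2 :* (i :* n) :+ n)) refl i n ⟩
    i ℕ.* i ℕ.* n ℕ.+ (2 ℕ.* (i ℕ.* n) ℕ.+ n) ≤⟨ ℕₚ.+-mono-≤ (floor-lower l) (ℕₚ.+-mono-≤ (ℕₚ.*-monoʳ-≤ 2 in≤AD) n≤D²) ⟩
    A ℕ.* A ℕ.+ (2 ℕ.* (A ℕ.* D) ℕ.+ D ℕ.* D) ≡⟨ solve 2 (λ a d → a :* a :+ (con 2 :* (a :* d) :+ d :* d) := (a :+ d) :* (a :+ d)) refl A D ⟩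
    (A ℕ.+ D) ℕ.* (A ℕ.+ D)            ≤⟨ ℕₚ.*-mono-≤ (A+D≤ l+P≤m) (A+D≤ l+P≤m) ⟩
    m ℕ.* suc k ℕ.* (m ℕ.* suc k)      ∎)
    where
    open ℕₚ.≤-Reasoning
    open ℕSolver.+-*-Solver
    i = floor n k l
    A = l ℕ.* suc k
    D = P ℕ.* suc k
    n≤D² : n ℕ.≤ D ℕ.* D
    n≤D² = ℕₚ.≤-trans (ℕₚ.<⇒≤ (isqrt-upper n)) (ℕₚ.*-mono-≤ s<PK s<PK)
    in≤AD : i ℕ.* n ℕ.≤ A ℕ.* D
    in≤AD = square-cancel-≤ (i ℕ.* n) (A ℕ.* D) (subst₂ ℕ._≤_
      (solve 2 (λ i n → i :* i :* n :* n := i :* n :* (i :* n)) refl i n)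
      (solve 2 (λ a d → a :* a :* (d :* d) := a :* d :* (a :* d)) refl A D)
      (ℕₚ.*-mono-≤ (floor-lower l) n≤D²))
    A+D≤ : l ℕ.+ P ℕ.≤ m → A ℕ.+ D ℕ.≤ m ℕ.* suc k
    A+D≤ h = subst (ℕ._≤ m ℕ.* suc k) (ℕₚ.*-distribʳ-+ (suc k) l P) (ℕₚ.*-monoˡ-≤ (suc k) h)

  floor-Icc : ∀ m → Icc (fromℚ (+ floor n k m ℚ./ suc k)) (fromℚ ((+ floor n k m ℤ.+ ℤ.1ℤ) ℚ./ suc k)) (scaled n m)
  floor-Icc m = scaled-≥ n {floor n k m} {k} {m} (floor-lower m) ,
    scaled-≤ n {floor n k m ℕ.+ 1} {k} {m} (subst (λ t → (m ℕ.* suc k) ℕ.* (m ℕ.* suc k) ℕ.≤ t ℕ.* t ℕ.* n) (ℕₚ.+-comm 1 (floor n k m)) (ℕₚ.<⇒≤ (floor-upper m)))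

refine : ∀ j k m → frac j k ≡ frac (j ℕ.* suc m) (m ℕ.+ k ℕ.* suc m)
refine j k m = frac-cong j k (j ℕ.* suc m) (m ℕ.+ k ℕ.* suc m) (solve 3 (λ j k m → j :* ((con 1 :+ k) :* (con 1 :+ m)) := (j :* (con 1 :+ m)) :* (con 1 :+ k)) refl j k m)
  where open ℕSolver.+-*-Solver

emb : ℕ × ℕ → ℤ × ℤ
emb (i , j) = + i , + j

module _ {a b : ℝ} {ω π : ℝ → ℝ} (maps-π : MapsTo (Icc 0ℝ a) (Icc 0ℝ b) π) where

  -- The lower left corner of the square lies in the region, where x ≥ 0 and y ≥ π x ≥ 0. So the
  -- inner squares can be indexed by natural numbers, as the cells are.
  nonNeg-square : ∀ k {i j} → GridSquare k (i , j) ⊑ RegionBetween a π ω → ∃[ i′ ] ∃[ j′ ] (i ≡ + i′ × j ≡ + j′)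
  nonNeg-square k {i} {j} inside =
    let (0≤x≤a , π≤y , _) = inside (fromℚ (i ℚ./ suc k)) (fromℚ (j ℚ./ suc k)) ((≤-reflℝ {fromℚ (i ℚ./ suc k)} , up i) , (≤-reflℝ {fromℚ (j ℚ./ suc k)} , up j))
        (i′ , i≡) = /-nonNeg⁻ i k (fromℚ-cancel (proj₁ 0≤x≤a))
        (j′ , j≡) = /-nonNeg⁻ j k (fromℚ-cancel (≤-transℝ {0ℝ} {π (fromℚ (i ℚ./ suc k))} {fromℚ (j ℚ./ suc k)} (proj₁ (maps-π _ 0≤x≤a)) π≤y))
    in i′ , j′ , i≡ , j≡
    where
    up : ∀ i → fromℚ (i ℚ./ suc k) ≤ fromℚ ((i ℤ.+ ℤ.1ℤ) ℚ./ suc k)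
    up i = fromℚ-mono (/-mono-≤ k (ℤₚ.i≤i+j i ℤ.1ℤ))

  nonNeg-squares : ∀ k (I : List (ℤ × ℤ)) → All (λ c → GridSquare k c ⊑ RegionBetween a π ω) I → ∃[ J ] I ≡ map emb J
  nonNeg-squares k [] [] = [] , refl
  nonNeg-squares k ((c , d) ∷ I) (h ∷ hs) =
    let (i , j , c≡i , d≡j) = nonNeg-square k {c} {d} h
        (J , I≡J) = nonNeg-squares k I hs
    in (i , j) ∷ J , cong₂ _∷_ (cong₂ _,_ c≡i d≡j) I≡J

module _ {a : ℝ} {ω π : ℝ → ℝ} where

  -- Using s + 1 below and s above places x = (u + 1)/√n in the horizontal side of the square. The
  -- region is then tested at the two ends of the vertical segment of the square over x, which
  -- yields the bounds on π and ω.
  square-cell : ∀ {n} .{{_ : ℕ.NonZero n}} k {i j} → GridSquare k (+ i , + j) ⊑ RegionBetween a π ω → ∀ u →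
    i ℕ.* suc (isqrt n) ℕ.≤ suc u ℕ.* suc k → suc u ℕ.* suc k ℕ.≤ suc i ℕ.* isqrt n →
    scaled n (suc u) ≤ a × π (scaled n (suc u)) ≤ fromℚ (frac j k) × fromℚ (frac (suc j) k) ≤ ω (scaled n (suc u))
  square-cell {n} k {i} {j} inside u lo hi =
    let x = scaled n (suc u)
        s = isqrt n
        x-lo : fromℚ (frac i k) ≤ x
        x-lo = scaled-≥ n {i} {k} {suc u} (ℕₚ.≤-trans (ℕₚ.*-monoʳ-≤ (i ℕ.* i) (ℕₚ.<⇒≤ (isqrt-upper n)))
          (subst (ℕ._≤ suc u ℕ.* suc k ℕ.* (suc u ℕ.* suc k)) (solve 2 (λ i s → i :* s :* (i :* s) := i :* i :* (s :* s)) refl i (suc s)) (ℕₚ.*-mono-≤ lo lo)))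
        x-hi : x ≤ fromℚ (frac (i ℕ.+ 1) k)
        x-hi = scaled-≤ n {i ℕ.+ 1} {k} {suc u} (subst (λ t → suc u ℕ.* suc k ℕ.* (suc u ℕ.* suc k) ℕ.≤ t ℕ.* t ℕ.* n) (ℕₚ.+-comm 1 i)
          (ℕₚ.≤-trans (ℕₚ.*-mono-≤ hi hi) (ℕₚ.≤-trans (ℕₚ.≤-reflexive (solve 2 (λ i s → i :* s :* (i :* s) := i :* i :* (s :* s)) refl (suc i) s))
            (ℕₚ.*-monoʳ-≤ (suc i ℕ.* suc i) (isqrt-lower n)))))
        j≤j+1 : fromℚ (frac j k) ≤ fromℚ (frac (j ℕ.+ 1) k)
        j≤j+1 = fromℚ-mono (frac-mono-≤ j k (j ℕ.+ 1) k (ℕₚ.*-monoˡ-≤ (suc k) (ℕₚ.m≤m+n j 1)))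
        (0≤x≤a , π≤ , _) = inside x (fromℚ (frac j k)) ((x-lo , x-hi) , (≤-reflℝ {fromℚ (frac j k)} , j≤j+1))
        (_ , _ , ≤ω) = inside x (fromℚ (frac (j ℕ.+ 1) k)) ((x-lo , x-hi) , (j≤j+1 , ≤-reflℝ {fromℚ (frac (j ℕ.+ 1) k)}))
    in proj₂ 0≤x≤a , π≤ , subst (λ t → fromℚ (frac t k) ≤ ω x) (ℕₚ.+-comm j 1) ≤ω
    where open ℕSolver.+-*-Solver

module _ {a : ℝ} {ω π : ℝ → ℝ} (υ : ℕ → SkewShape)
         (stable-ω : HasStableShape (outer ∘ υ) a ω) (stable-π : HasStableShape (inner ∘ υ) a π) where

  private
    R : Region
    R = RegionBetween a π ω

  -- With K = k + 1 and M = m + 1, the boundary curves are within 1/(K M) of ω and π, so each square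
  -- is trimmed by that amount at top and bottom. The bound B on the corner indices controls the gap
  -- between multiples of s and of s + 1, so that all squares offer the same room for P rows and Q
  -- columns.
  inner-count : ∀ k m (J : List (ℕ × ℕ)) → Unique J → (∀ {c} → c ∈ J → GridSquare k (emb c) ⊑ R) →
    ∀ B → (∀ {i j} → (i , j) ∈ J → i ℕ.≤ B × j ℕ.≤ B) →
    Eventually λ n → .{{_ : ℕ.NonZero n}} → ∀ P Q →
      B ℕ.+ P ℕ.* suc k ℕ.≤ isqrt n →
      B ℕ.* suc m ℕ.+ suc (isqrt n) ℕ.+ suc Q ℕ.* (suc k ℕ.* suc m) ℕ.≤ m ℕ.* isqrt n →
      length J ℕ.* (P ℕ.* Q) ℕ.≤ size (υ n)
  inner-count k m J J-unique J⊑R B J≤B =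
    let (N , p) = stable-near {outer ∘ υ} {a} {ω} stable-ω D′
        (N′ , p′) = stable-near {inner ∘ υ} {a} {π} stable-π D′
    in N ℕ.⊔ N′ , λ n hn P Q → main n (p n (ℕₚ.≤-trans (ℕₚ.m≤m⊔n N N′) hn)) (p′ n (ℕₚ.≤-trans (ℕₚ.m≤n⊔m N N′) hn)) P Q
    where
    D′ = m ℕ.+ k ℕ.* suc m
    main : ∀ n .{{_ : ℕ.NonZero n}} → NearAt (outer (υ n)) a ω D′ n → NearAt (inner (υ n)) a π D′ n → ∀ P Q →
      B ℕ.+ P ℕ.* suc k ℕ.≤ isqrt n →
      B ℕ.* suc m ℕ.+ suc (isqrt n) ℕ.+ suc Q ℕ.* (suc k ℕ.* suc m) ℕ.≤ m ℕ.* isqrt n →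
      length J ℕ.* (P ℕ.* Q) ℕ.≤ size (υ n)
    main n near-ω near-π P Q room₁ room₂ =
      size-lower (υ n) J J-unique (suc k) (suc k ℕ.* suc m) P Q
        lo₁ hi₁ lo₂ hi₂ (λ {i} {j} → sep₁ {i} {j}) (λ {i} {j} → sep₂ {i} {j}) room₁′ room₂′
        inside
      where
      open ℕSolver.+-*-Solver
      s = isqrt n
      lo₁ hi₁ lo₂ hi₂ : ℕ → ℕ
      lo₁ i = i ℕ.* suc s
      hi₁ i = suc i ℕ.* s
      -- In units of 1/(K M), the trimmed vertical side runs from j M + 1 to (j + 1) M - 1 = m + j
      -- M.
      lo₂ j = suc (j ℕ.* suc m) ℕ.* suc s
      hi₂ j = (m ℕ.+ j ℕ.* suc m) ℕ.* s
      sep₁ : Separated lo₁ hi₁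
      sep₁ {i} {j} i<j = ℕₚ.*-mono-≤ {suc i} {j} {s} {suc s} i<j (ℕₚ.n≤1+n s)
      sep₂ : Separated lo₂ hi₂
      sep₂ {i} {j} i<j = ℕₚ.*-mono-≤ {m ℕ.+ i ℕ.* suc m} {suc (j ℕ.* suc m)} {s} {suc s}
        (ℕₚ.≤-trans (ℕₚ.n≤1+n (m ℕ.+ i ℕ.* suc m)) (ℕₚ.≤-trans (ℕₚ.*-monoˡ-≤ (suc m) i<j) (ℕₚ.n≤1+n (j ℕ.* suc m)))) (ℕₚ.n≤1+n s)
      room₁′ : ∀ {i j} → (i , j) ∈ J → lo₁ i ℕ.+ P ℕ.* suc k ℕ.≤ hi₁ i
      room₁′ {i} {j} c∈ = begin
        i ℕ.* suc s ℕ.+ P ℕ.* suc k      ≡⟨ solve 3 (λ i s pk → i :* (con 1 :+ s) :+ pk := i :* s :+ (i :+ pk)) refl i s (P ℕ.* suc k) ⟩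
        i ℕ.* s ℕ.+ (i ℕ.+ P ℕ.* suc k)  ≤⟨ ℕₚ.+-monoʳ-≤ (i ℕ.* s) (ℕₚ.≤-trans (ℕₚ.+-monoˡ-≤ (P ℕ.* suc k) (proj₁ (J≤B c∈))) room₁) ⟩
        i ℕ.* s ℕ.+ s                    ≡⟨ ℕₚ.+-comm (i ℕ.* s) s ⟩
        suc i ℕ.* s                      ∎
        where open ℕₚ.≤-Reasoning
      room₂′ : ∀ {i j} → (i , j) ∈ J → lo₂ j ℕ.+ suc Q ℕ.* (suc k ℕ.* suc m) ℕ.≤ hi₂ j
      room₂′ {i} {j} c∈ = begin
        suc jM ℕ.* suc s ℕ.+ QD            ≡⟨ solve 3 (λ jm s qd → (con 1 :+ jm) :* (con 1 :+ s) :+ qd := jm :* s :+ (jm :+ (con 1 :+ s) :+ qd)) refl jM s QD ⟩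
        jM ℕ.* s ℕ.+ (jM ℕ.+ suc s ℕ.+ QD) ≤⟨ ℕₚ.+-monoʳ-≤ (jM ℕ.* s) (ℕₚ.≤-trans (ℕₚ.+-monoˡ-≤ QD (ℕₚ.+-monoˡ-≤ (suc s) (ℕₚ.*-monoˡ-≤ (suc m) (proj₂ (J≤B c∈))))) room₂) ⟩
        jM ℕ.* s ℕ.+ m ℕ.* s               ≡⟨ solve 3 (λ jm m s → jm :* s :+ m :* s := (m :+ jm) :* s) refl jM m s ⟩
        (m ℕ.+ jM) ℕ.* s                   ∎
        where
        open ℕₚ.≤-Reasoning
        jM = j ℕ.* suc m
        QD = suc Q ℕ.* (suc k ℕ.* suc m)
      inside : ∀ {i j} → (i , j) ∈ J → ∀ u → i ℕ.* suc s ℕ.≤ suc u ℕ.* suc k → suc u ℕ.* suc k ℕ.≤ suc i ℕ.* s →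
        row (inner (υ n)) u ℕ.* (suc k ℕ.* suc m) ℕ.≤ suc (j ℕ.* suc m) ℕ.* suc s ×
        (m ℕ.+ j ℕ.* suc m) ℕ.* s ℕ.≤ row (outer (υ n)) u ℕ.* (suc k ℕ.* suc m)
      inside {i} {j} c∈ u lo hi =
        let x = scaled n (suc u)
            p = row (inner (υ n)) u
            q = row (outer (υ n)) u
            (x≤a , π≤ , ≤ω) = square-cell {a} {ω} {π} k {i} {j} (J⊑R c∈) u lo hi
        in scaled-≤⁻ n {suc (j ℕ.* suc m)} {D′} {p}
             (≤-transℝ {scaled n p} {π x + fromℚ (frac 1 D′)} {fromℚ (frac (suc (j ℕ.* suc m)) D′)} (proj₁ (near-π u x≤a))
             (≤-transℝ {π x + fromℚ (frac 1 D′)} {fromℚ (frac j k) + fromℚ (frac 1 D′)} {fromℚ (frac (suc (j ℕ.* suc m)) D′)}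
               (+-monoˡℝ {π x} {fromℚ (frac j k)} (fromℚ (frac 1 D′)) π≤)
               (fromℚ-mono (ℚₚ.≤-reflexive (trans (cong (ℚ._+ frac 1 D′) (refine j k m))
                 (trans (frac-+ (j ℕ.* suc m) 1 D′) (cong (λ t → frac t D′) (ℕₚ.+-comm (j ℕ.* suc m) 1)))))))) ,
           scaled-≥⁻ n {m ℕ.+ j ℕ.* suc m} {D′} {q}
             (≤-transℝ {fromℚ (frac (m ℕ.+ j ℕ.* suc m) D′)} {fromℚ (frac (suc j) k) - fromℚ (frac 1 D′)} {scaled n q}
               (fromℚ-mono (ℚₚ.≤-reflexive (lower j)))
               (+-moveʳℝ {fromℚ (frac (suc j) k)} {scaled n q} {fromℚ (frac 1 D′)}
                 (≤-transℝ {fromℚ (frac (suc j) k)} {ω x} {scaled n q + fromℚ (frac 1 D′)} ≤ω (proj₂ (near-ω u x≤a)))))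
        where
        lower : ∀ j → frac (m ℕ.+ j ℕ.* suc m) D′ ≡ frac (suc j) k ℚ.- frac 1 D′
        lower j = trans (QS.solve 2 (λ x e → x QS.:= (e QS.:+ x) QS.:+ (QS.:- e)) refl (frac (m ℕ.+ j ℕ.* suc m) D′) (frac 1 D′))
          (cong (ℚ._- frac 1 D′) (trans (frac-+ 1 (m ℕ.+ j ℕ.* suc m) D′) (sym (refine (suc j) k m))))
          where module QS = +-*-Solver

  -- The margin c/√n exceeds the tolerance 1/(m + 1), so for a cell at distance c from both ends of
  -- its row the point ((u + 1)/√n, v/√n) itself lies in the region, and its grid square meets the
  -- region. The rational A/(m + 1) ≤ a replaces a in the cutoff U, so that x ≤ a can be proved for
  -- the rows above it.
  outer-count : ∀ k m (O : List (ℤ × ℤ)) → (∀ c → GridSquare k c meets R → c ∈ O) →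
    ∀ A → fromℚ (frac A m) ≤ a →
    Eventually λ n → .{{_ : ℕ.NonZero n}} → ∀ P c U .{{_ : ℕ.NonZero P}} →
      isqrt n ℕ.< P ℕ.* suc k → isqrt n ℕ.< c ℕ.* suc m → U ℕ.* suc m ℕ.≤ A ℕ.* isqrt n →
      size (υ n) ℕ.≤ length O ℕ.* (P ℕ.* P) ℕ.+ (ℓ (outer (υ n)) ℕ.* c ℕ.+ (ℓ (outer (υ n)) ℕ.* c ℕ.+ (ℓ (outer (υ n)) ℕ.∸ U) ℕ.* row (outer (υ n)) 0))
  outer-count k m O covers A A≤a =
    let (N , p) = stable-near {outer ∘ υ} {a} {ω} stable-ω m
        (N′ , p′) = stable-near {inner ∘ υ} {a} {π} stable-π m
    in N ℕ.⊔ N′ , λ n hn P c U → main n (p n (ℕₚ.≤-trans (ℕₚ.m≤m⊔n N N′) hn)) (p′ n (ℕₚ.≤-trans (ℕₚ.m≤n⊔m N N′) hn)) P c U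
    where
    main : ∀ n .{{_ : ℕ.NonZero n}} → NearAt (outer (υ n)) a ω m n → NearAt (inner (υ n)) a π m n → ∀ P c U .{{_ : ℕ.NonZero P}} →
      isqrt n ℕ.< P ℕ.* suc k → isqrt n ℕ.< c ℕ.* suc m → U ℕ.* suc m ℕ.≤ A ℕ.* isqrt n →
      size (υ n) ℕ.≤ length O ℕ.* (P ℕ.* P) ℕ.+ (ℓ (outer (υ n)) ℕ.* c ℕ.+ (ℓ (outer (υ n)) ℕ.* c ℕ.+ (ℓ (outer (υ n)) ℕ.∸ U) ℕ.* row (outer (υ n)) 0))
    main n near-ω near-π P c U s<PK s<cM U≤ = size-upper (υ n) O (floor n k) P c U (floor-fibre n k s<PK) covered
      where
      s = isqrt n
      1/m≤c : fromℚ (frac 1 m) ≤ scaled n c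
      1/m≤c = scaled-≥ n {1} {m} {c} (ℕₚ.≤-trans (ℕₚ.≤-reflexive (ℕₚ.*-identityˡ n)) (ℕₚ.≤-trans (ℕₚ.<⇒≤ (isqrt-upper n)) (ℕₚ.*-mono-≤ s<cM s<cM)))
      covered : ∀ u v → u ℕ.< U → row (inner (υ n)) u ℕ.+ c ℕ.≤ v → v ℕ.+ c ℕ.≤ row (outer (υ n)) u →
        (+ floor n k (suc u) , + floor n k v) ∈ O
      covered u v u<U lo hi = covers _ (x , scaled n v , (floor-Icc n k (suc u) , floor-Icc n k v) ,
          (scaled-nonNeg n (suc u) , x≤a) , π≤v , v≤ω)
        where
        open ℕSolver.+-*-Solver
        x = scaled n (suc u)
        p = row (inner (υ n)) u
        q = row (outer (υ n)) u
        h : suc u ℕ.* suc m ℕ.≤ A ℕ.* s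
        h = ℕₚ.≤-trans (ℕₚ.*-monoˡ-≤ (suc m) u<U) U≤
        x≤a : x ≤ a
        x≤a = ≤-transℝ {x} {fromℚ (frac A m)} {a} (scaled-≤ n {A} {m} {suc u} (ℕₚ.≤-trans (ℕₚ.*-mono-≤ h h)
          (ℕₚ.≤-trans (ℕₚ.≤-reflexive (solve 2 (λ i s → i :* s :* (i :* s) := i :* i :* (s :* s)) refl A s))
            (ℕₚ.*-monoʳ-≤ (A ℕ.* A) (isqrt-lower n))))) A≤a
        π≤v : π x ≤ scaled n v
        π≤v = ≤-transℝ {π x} {scaled n p + fromℚ (frac 1 m)} {scaled n v} (proj₂ (near-π u x≤a))
          (≤-transℝ {scaled n p + fromℚ (frac 1 m)} {scaled n (p ℕ.+ c)} {scaled n v}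
            (scaled-+ n {fromℚ (frac 1 m)} {p} {c} 1/m≤c) (scaled-mono n lo))
        v+1/m≤ω+1/m : scaled n v + fromℚ (frac 1 m) ≤ ω x + fromℚ (frac 1 m)
        v+1/m≤ω+1/m = ≤-transℝ {scaled n v + fromℚ (frac 1 m)} {scaled n q} {ω x + fromℚ (frac 1 m)}
          (≤-transℝ {scaled n v + fromℚ (frac 1 m)} {scaled n (v ℕ.+ c)} {scaled n q}
            (scaled-+ n {fromℚ (frac 1 m)} {v} {c} 1/m≤c) (scaled-mono n hi))
          (proj₁ (near-ω u x≤a))
        v≤ω : scaled n v ≤ ω x
        v≤ω = +-cancelʳℝ {scaled n v} {ω x} (fromℚ (frac 1 m)) v+1/m≤ω+1/m

open ℕSolver.+-*-Solver using (solve; _:+_; _:*_; _:=_; con)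

-- Asymptotics

-- The relation (1 − a/M) x ≤ y, cleared of denominators and subtraction
module Approximation (M : ℕ) where

  infix 4 _≲[_]_
  record _≲[_]_ (x a y : ℕ) : Set where
    constructor approx
    field bound : M ℕ.* x ℕ.≤ M ℕ.* y ℕ.+ a ℕ.* x
  open _≲[_]_ public

  -- The two errors are relative to different quantities. If y ≤ x, then b y is at most b x. If x ≤
  -- y, then (M - b) x ≤ (M - b) y ≤ M z, where b ≤ M is what permits multiplying by M - b.
  ≲-trans : ∀ {x a y b z} → b ℕ.≤ M → x ≲[ a ] y → y ≲[ b ] z → x ≲[ a ℕ.+ b ] z
  ≲-trans {x} {a} {y} {b} {z} b≤M (approx x≲y) (approx y≲z) with ℕₚ.≤-total y x
  ... | inj₁ y≤x = approx (begin
    M ℕ.* x                              ≤⟨ x≲y ⟩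
    M ℕ.* y ℕ.+ a ℕ.* x                  ≤⟨ ℕₚ.+-monoˡ-≤ (a ℕ.* x) (ℕₚ.≤-trans y≲z (ℕₚ.+-monoʳ-≤ (M ℕ.* z) (ℕₚ.*-monoʳ-≤ b y≤x))) ⟩
    M ℕ.* z ℕ.+ b ℕ.* x ℕ.+ a ℕ.* x      ≡⟨ solve 4 (λ m a b x → m :+ b :* x :+ a :* x := m :+ (a :+ b) :* x) refl (M ℕ.* z) a b x ⟩
    M ℕ.* z ℕ.+ (a ℕ.+ b) ℕ.* x          ∎)
    where open ℕₚ.≤-Reasoning
  ... | inj₂ x≤y with ℕₚ.m≤n⇒∃[o]m+o≡n b≤M
  ... | c , refl = approx (begin
    (b ℕ.+ c) ℕ.* x                      ≡⟨ solve 3 (λ b c x → (b :+ c) :* x := c :* x :+ b :* x) refl b c x ⟩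
    c ℕ.* x ℕ.+ b ℕ.* x                  ≤⟨ ℕₚ.+-monoˡ-≤ (b ℕ.* x) (ℕₚ.≤-trans (ℕₚ.*-monoʳ-≤ c x≤y) cy≤) ⟩
    M ℕ.* z ℕ.+ b ℕ.* x                  ≤⟨ ℕₚ.+-monoʳ-≤ (M ℕ.* z) (ℕₚ.*-monoˡ-≤ x (ℕₚ.m≤n+m b a)) ⟩
    M ℕ.* z ℕ.+ (a ℕ.+ b) ℕ.* x          ∎)
    where
    open ℕₚ.≤-Reasoning
    cy≤ : c ℕ.* y ℕ.≤ M ℕ.* z
    cy≤ = ℕₚ.+-cancelʳ-≤ (b ℕ.* y) (c ℕ.* y) (M ℕ.* z)
      (ℕₚ.≤-trans (ℕₚ.≤-reflexive (solve 3 (λ b c y → c :* y :+ b :* y := (b :+ c) :* y) refl b c y)) y≲z)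

  ≲-*ʳ : ∀ {x a y} z → x ≲[ a ] y → x ℕ.* z ≲[ a ] y ℕ.* z
  ≲-*ʳ {x} {a} {y} z (approx h) = approx (subst₂ ℕ._≤_ (ℕₚ.*-assoc M x z)
    (solve 5 (λ M x y a z → (M :* y :+ a :* x) :* z := M :* (y :* z) :+ a :* (x :* z)) refl M x y a z)
    (ℕₚ.*-monoˡ-≤ z h))

  ≲-*ˡ : ∀ {x a y} z → x ≲[ a ] y → z ℕ.* x ≲[ a ] z ℕ.* y
  ≲-*ˡ {x} {a} {y} z h = subst₂ _≲[ a ]_ (ℕₚ.*-comm x z) (ℕₚ.*-comm y z) (≲-*ʳ z h)

  -- From y ≤ (1 + a/M) x to (1 - a/M) y ≤ x: when x ≤ y the error a x is at most a y, and otherwise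
  -- y ≤ x is already stronger.
  ≲-from-excess : ∀ {x a y} → M ℕ.* y ℕ.≤ M ℕ.* x ℕ.+ a ℕ.* x → y ≲[ a ] x
  ≲-from-excess {x} {a} {y} h with ℕₚ.≤-total x y
  ... | inj₁ x≤y = approx (ℕₚ.≤-trans h (ℕₚ.+-monoʳ-≤ (M ℕ.* x) (ℕₚ.*-monoʳ-≤ a x≤y)))
  ... | inj₂ y≤x = approx (ℕₚ.≤-trans (ℕₚ.*-monoʳ-≤ M y≤x) (ℕₚ.m≤m+n (M ℕ.* x) (a ℕ.* y)))

isqrt-large : ∀ S → Eventually λ n → S ℕ.≤ isqrt n
isqrt-large S = S ℕ.* S , λ n h → ℕ.s≤s⁻¹ (square-cancel-< S (suc (isqrt n)) (ℕₚ.≤-<-trans h (isqrt-upper n)))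

module _ (k m I B : ℕ) where
  private
    K = suc k
    M = suc m
    D = K ℕ.* M
    c₂ = 2 ℕ.* D ℕ.+ (B ℕ.* M ℕ.+ 1)
    open Approximation M

  inner-threshold : ℕ
  inner-threshold = suc (c₂ ℕ.+ M ℕ.* (B ℕ.+ K) ℕ.+ 3 ℕ.* M)

  -- The relative loss 6/M is 1/M for replacing n by s², 1/M for the rows P K, 3/M for the columns Q
  -- K and 1/M for the area of the squares. In the columns, two units come from the trimmed ends and
  -- one from the bounded terms, which the threshold keeps below s.
  size-asymptotically-≥ : 6 ℕ.≤ M → K ℕ.* K ℕ.* M ℕ.≤ I ℕ.* M ℕ.+ K ℕ.* K →
    ∀ n N → inner-threshold ℕ.≤ isqrt n →
    (∀ P Q → B ℕ.+ P ℕ.* K ℕ.≤ isqrt n → B ℕ.* M ℕ.+ suc (isqrt n) ℕ.+ suc Q ℕ.* D ℕ.≤ m ℕ.* isqrt n → I ℕ.* (P ℕ.* Q) ℕ.≤ N) →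
    M ℕ.* n ℕ.≤ M ℕ.* N ℕ.+ 6 ℕ.* n
  size-asymptotically-≥ 6≤M area n N large count = conclude
    where
    open ℕₚ.≤-Reasoning
    s = isqrt n
    c₂≤s : c₂ ℕ.≤ s
    c₂≤s = ℕₚ.≤-trans (ℕₚ.≤-trans (ℕₚ.m≤m+n c₂ (M ℕ.* (B ℕ.+ K))) (ℕₚ.m≤m+n _ (3 ℕ.* M))) (ℕₚ.<⇒≤ large)
    MBK≤s : M ℕ.* (B ℕ.+ K) ℕ.≤ s
    MBK≤s = ℕₚ.≤-trans (ℕₚ.≤-trans (ℕₚ.m≤n+m (M ℕ.* (B ℕ.+ K)) c₂) (ℕₚ.m≤m+n _ (3 ℕ.* M))) (ℕₚ.<⇒≤ large)
    3M≤s : 3 ℕ.* M ℕ.≤ s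
    3M≤s = ℕₚ.≤-trans (ℕₚ.m≤n+m (3 ℕ.* M) (c₂ ℕ.+ M ℕ.* (B ℕ.+ K))) (ℕₚ.<⇒≤ large)
    1≤s : 1 ℕ.≤ s
    1≤s = ℕₚ.≤-trans (s≤s z≤n) large
    B≤s : B ℕ.≤ s
    B≤s = ℕₚ.≤-trans (ℕₚ.≤-trans (ℕₚ.m≤m+n B K) (ℕₚ.m≤n*m (B ℕ.+ K) M)) MBK≤s
    P Q rest : ℕ
    P = (s ℕ.∸ B) ℕ./ K
    rest = m ℕ.* s ℕ.∸ (B ℕ.* M ℕ.+ suc s)
    -- `count` asks for room for Q + 1 slots of width D, and `D≤rest` makes this truncated
    -- subtraction exact.
    Q = rest ℕ./ D ℕ.∸ 1
    rest≥ : m ℕ.* s ℕ.≤ rest ℕ.+ (B ℕ.* M ℕ.+ suc s)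
    rest≥ = ℕₚ.≤-trans (ℕₚ.m≤n+m∸n (m ℕ.* s) (B ℕ.* M ℕ.+ suc s)) (ℕₚ.≤-reflexive (ℕₚ.+-comm (B ℕ.* M ℕ.+ suc s) rest))
    5s≤ms : 5 ℕ.* s ℕ.≤ m ℕ.* s
    5s≤ms = ℕₚ.*-monoˡ-≤ s (ℕ.s≤s⁻¹ 6≤M)
    fits : B ℕ.* M ℕ.+ suc s ℕ.+ D ℕ.≤ m ℕ.* s
    fits = begin
      B ℕ.* M ℕ.+ suc s ℕ.+ D     ≡⟨ solve 3 (λ x s d → x :+ (con 1 :+ s) :+ d := (x :+ con 1) :+ d :+ s) refl (B ℕ.* M) s D ⟩
      B ℕ.* M ℕ.+ 1 ℕ.+ D ℕ.+ s   ≤⟨ ℕₚ.+-monoˡ-≤ s (ℕₚ.≤-trans (ℕₚ.≤-trans (ℕₚ.m≤m+n _ D)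
                                      (ℕₚ.≤-reflexive (solve 2 (λ x d → x :+ d :+ d := con 2 :* d :+ x) refl (B ℕ.* M ℕ.+ 1) D))) c₂≤s) ⟩
      s ℕ.+ s                     ≡⟨ solve 1 (λ s → s :+ s := con 2 :* s) refl s ⟩
      2 ℕ.* s                     ≤⟨ ℕₚ.*-monoˡ-≤ s {2} {5} (s≤s (s≤s z≤n)) ⟩
      5 ℕ.* s                     ≤⟨ 5s≤ms ⟩
      m ℕ.* s                     ∎
    D≤rest : D ℕ.≤ rest
    D≤rest = ℕₚ.m+n≤o⇒m≤o∸n D (ℕₚ.≤-trans (ℕₚ.≤-reflexive (ℕₚ.+-comm D (B ℕ.* M ℕ.+ suc s))) fits)
    sucQ : suc Q ≡ rest ℕ./ D
    sucQ = ℕₚ.m+[n∸m]≡n (ℕₚ.*-cancelʳ-< D 0 (rest ℕ./ D) (ℕₚ.+-cancelˡ-< D 0 ((rest ℕ./ D) ℕ.* D)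
      (subst (ℕ._< D ℕ.+ (rest ℕ./ D) ℕ.* D) (sym (ℕₚ.+-identityʳ D)) (ℕₚ.≤-<-trans D≤rest (m<[1+m/n]*n rest D)))))
    count′ : I ℕ.* (P ℕ.* Q) ℕ.≤ N
    count′ = count P Q
      (ℕₚ.≤-trans (ℕₚ.+-monoʳ-≤ B (m/n*n≤m (s ℕ.∸ B) K)) (ℕₚ.≤-reflexive (ℕₚ.m+[n∸m]≡n B≤s)))
      (subst (λ q → B ℕ.* M ℕ.+ suc s ℕ.+ q ℕ.* D ℕ.≤ m ℕ.* s) (sym sucQ)
        (ℕₚ.≤-trans (ℕₚ.+-monoʳ-≤ (B ℕ.* M ℕ.+ suc s) (m/n*n≤m rest D))
          (ℕₚ.≤-reflexive (ℕₚ.m+[n∸m]≡n (ℕₚ.≤-trans (ℕₚ.m≤m+n _ D) fits)))))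
    s≲PK : s ≲[ 1 ] P ℕ.* K
    s≲PK = approx (begin
      M ℕ.* s                              ≤⟨ ℕₚ.*-monoʳ-≤ M (begin
        s                                    ≡⟨ ℕₚ.m+[n∸m]≡n B≤s ⟨
        B ℕ.+ (s ℕ.∸ B)                      ≤⟨ ℕₚ.+-monoʳ-≤ B (ℕₚ.<⇒≤ (m<[1+m/n]*n (s ℕ.∸ B) K)) ⟩
        B ℕ.+ (K ℕ.+ P ℕ.* K)                ≡⟨ solve 3 (λ b k p → b :+ (k :+ p) := p :+ (b :+ k)) refl B K (P ℕ.* K) ⟩
        P ℕ.* K ℕ.+ (B ℕ.+ K)                ∎) ⟩
      M ℕ.* (P ℕ.* K ℕ.+ (B ℕ.+ K))        ≡⟨ ℕₚ.*-distribˡ-+ M (P ℕ.* K) (B ℕ.+ K) ⟩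
      M ℕ.* (P ℕ.* K) ℕ.+ M ℕ.* (B ℕ.+ K)  ≤⟨ ℕₚ.+-monoʳ-≤ (M ℕ.* (P ℕ.* K)) (ℕₚ.≤-trans MBK≤s (ℕₚ.≤-reflexive (sym (ℕₚ.*-identityˡ s)))) ⟩
      M ℕ.* (P ℕ.* K) ℕ.+ 1 ℕ.* s          ∎)
    s≲QK : s ≲[ 3 ] Q ℕ.* K
    s≲QK = approx (begin
      M ℕ.* s                              ≡⟨ ℕₚ.+-comm s (m ℕ.* s) ⟩
      m ℕ.* s ℕ.+ s                        ≤⟨ ℕₚ.+-monoˡ-≤ s (ℕₚ.≤-trans rest≥ (ℕₚ.+-monoˡ-≤ (B ℕ.* M ℕ.+ suc s)
                                                (subst (λ q → rest ℕ.≤ suc q ℕ.* D) (sym sucQ) (ℕₚ.<⇒≤ (m<[1+m/n]*n rest D))))) ⟩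
      suc (suc Q) ℕ.* D ℕ.+ (B ℕ.* M ℕ.+ suc s) ℕ.+ s
        ≡⟨ solve 5 (λ q k m b s → (con 2 :+ q) :* (k :* m) :+ (b :* m :+ (con 1 :+ s)) :+ s
                 := m :* (q :* k) :+ ((con 2 :* (k :* m) :+ (b :* m :+ con 1)) :+ con 2 :* s)) refl Q K M B s ⟩
      M ℕ.* (Q ℕ.* K) ℕ.+ (c₂ ℕ.+ 2 ℕ.* s) ≤⟨ ℕₚ.+-monoʳ-≤ (M ℕ.* (Q ℕ.* K)) (ℕₚ.+-monoˡ-≤ (2 ℕ.* s) c₂≤s) ⟩
      M ℕ.* (Q ℕ.* K) ℕ.+ 3 ℕ.* s          ∎)
    n≲s² : n ≲[ 1 ] s ℕ.* s
    n≲s² = approx (begin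
      M ℕ.* n                              ≤⟨ ℕₚ.*-monoʳ-≤ M (ℕₚ.<⇒≤ (isqrt-upper n)) ⟩
      M ℕ.* (suc s ℕ.* suc s)              ≡⟨ solve 2 (λ m s → m :* ((con 1 :+ s) :* (con 1 :+ s)) := m :* (s :* s) :+ m :* (con 1 :+ con 2 :* s)) refl M s ⟩
      M ℕ.* (s ℕ.* s) ℕ.+ M ℕ.* (1 ℕ.+ 2 ℕ.* s) ≤⟨ ℕₚ.+-monoʳ-≤ (M ℕ.* (s ℕ.* s)) (begin
        M ℕ.* (1 ℕ.+ 2 ℕ.* s)                ≤⟨ ℕₚ.*-monoʳ-≤ M (ℕₚ.+-monoˡ-≤ (2 ℕ.* s) 1≤s) ⟩
        M ℕ.* (3 ℕ.* s)                      ≡⟨ solve 2 (λ m s → m :* (con 3 :* s) := con 3 :* m :* s) refl M s ⟩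
        3 ℕ.* M ℕ.* s                        ≤⟨ ℕₚ.*-monoˡ-≤ s 3M≤s ⟩
        s ℕ.* s                              ≤⟨ isqrt-lower n ⟩
        n                                    ≡⟨ ℕₚ.*-identityˡ n ⟨
        1 ℕ.* n                              ∎) ⟩
      M ℕ.* (s ℕ.* s) ℕ.+ 1 ℕ.* n          ∎)
    K²≲I : K ℕ.* K ≲[ 1 ] I
    K²≲I = approx (subst₂ ℕ._≤_ (ℕₚ.*-comm (K ℕ.* K) M) (cong₂ ℕ._+_ (ℕₚ.*-comm I M) (sym (ℕₚ.*-identityˡ (K ℕ.* K)))) area)
    1≤M : 1 ℕ.≤ M
    1≤M = s≤s z≤n
    chain : n ℕ.* (K ℕ.* K) ≲[ 6 ] P ℕ.* K ℕ.* (Q ℕ.* K) ℕ.* I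
    chain = ≲-trans 1≤M (≲-trans {b = 3} (ℕₚ.≤-trans (s≤s (s≤s (s≤s z≤n))) 6≤M) (≲-trans {b = 1} 1≤M
      (≲-*ʳ (K ℕ.* K) n≲s²)
      (≲-*ʳ (K ℕ.* K) (≲-*ʳ s s≲PK)))
      (≲-*ʳ (K ℕ.* K) (≲-*ˡ (P ℕ.* K) s≲QK)))
      (≲-*ˡ (P ℕ.* K ℕ.* (Q ℕ.* K)) K²≲I)
    conclude : M ℕ.* n ℕ.≤ M ℕ.* N ℕ.+ 6 ℕ.* n
    conclude = ℕₚ.*-cancelʳ-≤ _ _ (K ℕ.* K) (begin
      M ℕ.* n ℕ.* (K ℕ.* K)                ≡⟨ ℕₚ.*-assoc M n (K ℕ.* K) ⟩
      M ℕ.* (n ℕ.* (K ℕ.* K))              ≤⟨ bound chain ⟩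
      M ℕ.* (P ℕ.* K ℕ.* (Q ℕ.* K) ℕ.* I) ℕ.+ 6 ℕ.* (n ℕ.* (K ℕ.* K))
        ≡⟨ solve 6 (λ m p k q i n → m :* (p :* k :* (q :* k) :* i) :+ con 6 :* (n :* (k :* k)) := (m :* (i :* (p :* q)) :+ con 6 :* n) :* (k :* k)) refl M P K Q I n ⟩
      (M ℕ.* (I ℕ.* (P ℕ.* Q)) ℕ.+ 6 ℕ.* n) ℕ.* (K ℕ.* K)
        ≤⟨ ℕₚ.*-monoˡ-≤ (K ℕ.* K) (ℕₚ.+-monoˡ-≤ (6 ℕ.* n) (ℕₚ.*-monoʳ-≤ M count′)) ⟩
      (M ℕ.* N ℕ.+ 6 ℕ.* n) ℕ.* (K ℕ.* K)  ∎)

module _ (k m O A C₁ C₂ : ℕ) where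
  private
    K = suc k
    M = suc m
    open Approximation M

  outer-threshold : ℕ
  outer-threshold = M ℕ.* K ℕ.+ (M ℕ.+ (A ℕ.+ 4))

  -- X counts the cells in grid squares and Y the exceptional ones. Since c M ≤ 2 s, the two ends of
  -- the rows cost 4 C₁ n/M in all. The rows from U on satisfy (L - U) M ≤ 5 s and cost 5 C₂ n/M:
  -- the 4 in A + 4 contributes 4 s, and the rounding terms, bounded through the threshold, one more
  -- s.
  size-asymptotically-≤ : 6 ℕ.≤ M → O ℕ.* M ℕ.≤ K ℕ.* K ℕ.* M ℕ.+ K ℕ.* K →
    ∀ n N L R → outer-threshold ℕ.≤ isqrt n →
    L ℕ.* M ℕ.≤ (A ℕ.+ 4) ℕ.* suc (isqrt n) → L ℕ.≤ C₁ ℕ.* isqrt n → R ℕ.≤ C₂ ℕ.* isqrt n →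
    (∀ P c U .{{_ : ℕ.NonZero P}} → isqrt n ℕ.< P ℕ.* K → isqrt n ℕ.< c ℕ.* M → U ℕ.* M ℕ.≤ A ℕ.* isqrt n →
      N ℕ.≤ O ℕ.* (P ℕ.* P) ℕ.+ (L ℕ.* c ℕ.+ (L ℕ.* c ℕ.+ (L ℕ.∸ U) ℕ.* R))) →
    M ℕ.* N ℕ.≤ M ℕ.* n ℕ.+ (6 ℕ.+ (4 ℕ.* C₁ ℕ.+ 5 ℕ.* C₂)) ℕ.* n
  size-asymptotically-≤ 6≤M area n N L R large LM≤ L≤ R≤ count = conclude
    where
    open ℕₚ.≤-Reasoning
    s = isqrt n
    d = 4 ℕ.* C₁ ℕ.+ 5 ℕ.* C₂
    MK≤s : M ℕ.* K ℕ.≤ s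
    MK≤s = ℕₚ.≤-trans (ℕₚ.m≤m+n _ (M ℕ.+ (A ℕ.+ 4))) large
    MA≤s : M ℕ.+ (A ℕ.+ 4) ℕ.≤ s
    MA≤s = ℕₚ.≤-trans (ℕₚ.m≤n+m _ (M ℕ.* K)) large
    M≤s : M ℕ.≤ s
    M≤s = ℕₚ.≤-trans (ℕₚ.m≤m+n M (A ℕ.+ 4)) MA≤s
    P c U X Y : ℕ
    P = suc (s ℕ./ K)
    c = suc (s ℕ./ M)
    U = (A ℕ.* s) ℕ./ M
    X = O ℕ.* (P ℕ.* P)
    Y = L ℕ.* c ℕ.+ (L ℕ.* c ℕ.+ (L ℕ.∸ U) ℕ.* R)
    N≤X+Y : N ℕ.≤ X ℕ.+ Y
    N≤X+Y = count P c U (m<[1+m/n]*n s K) (m<[1+m/n]*n s M) (m/n*n≤m (A ℕ.* s) M)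
    cM≤ : c ℕ.* M ℕ.≤ 2 ℕ.* s
    cM≤ = ℕₚ.≤-trans (ℕₚ.+-mono-≤ M≤s (m/n*n≤m s M)) (ℕₚ.≤-reflexive (solve 1 (λ s → s :+ s := con 2 :* s) refl s))
    low≤ : (L ℕ.∸ U) ℕ.* M ℕ.≤ 5 ℕ.* s
    low≤ = ℕₚ.≤-trans (ℕₚ.≤-reflexive (ℕₚ.*-distribʳ-∸ M L U)) (ℕₚ.m≤n+o⇒m∸n≤o (L ℕ.* M) (U ℕ.* M) (begin
      L ℕ.* M                                ≤⟨ LM≤ ⟩
      (A ℕ.+ 4) ℕ.* suc s                    ≡⟨ solve 2 (λ a s → (a :+ con 4) :* (con 1 :+ s) := a :* s :+ ((a :+ con 4) :+ con 4 :* s)) refl A s ⟩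
      A ℕ.* s ℕ.+ (A ℕ.+ 4 ℕ.+ 4 ℕ.* s)      ≤⟨ ℕₚ.+-monoˡ-≤ (A ℕ.+ 4 ℕ.+ 4 ℕ.* s) (ℕₚ.<⇒≤ (m<[1+m/n]*n (A ℕ.* s) M)) ⟩
      M ℕ.+ U ℕ.* M ℕ.+ (A ℕ.+ 4 ℕ.+ 4 ℕ.* s) ≡⟨ solve 4 (λ m u a s → m :+ u :+ (a :+ con 4 :* s) := u :+ ((m :+ a) :+ con 4 :* s)) refl M (U ℕ.* M) (A ℕ.+ 4) s ⟩
      U ℕ.* M ℕ.+ (M ℕ.+ (A ℕ.+ 4) ℕ.+ 4 ℕ.* s) ≤⟨ ℕₚ.+-monoʳ-≤ (U ℕ.* M) (ℕₚ.+-monoˡ-≤ (4 ℕ.* s) MA≤s) ⟩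
      U ℕ.* M ℕ.+ 5 ℕ.* s                    ∎))
    MY≤ : M ℕ.* Y ℕ.≤ d ℕ.* n
    MY≤ = begin
      M ℕ.* Y ≡⟨ solve 5 (λ m l c v r → m :* (l :* c :+ (l :* c :+ v :* r)) := con 2 :* (l :* (c :* m)) :+ v :* m :* r) refl M L c (L ℕ.∸ U) R ⟩
      2 ℕ.* (L ℕ.* (c ℕ.* M)) ℕ.+ (L ℕ.∸ U) ℕ.* M ℕ.* R
        ≤⟨ ℕₚ.+-mono-≤ (ℕₚ.*-monoʳ-≤ 2 (ℕₚ.*-mono-≤ L≤ cM≤)) (ℕₚ.*-mono-≤ low≤ R≤) ⟩
      2 ℕ.* (C₁ ℕ.* s ℕ.* (2 ℕ.* s)) ℕ.+ 5 ℕ.* s ℕ.* (C₂ ℕ.* s)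
        ≡⟨ solve 3 (λ a b s → con 2 :* (a :* s :* (con 2 :* s)) :+ con 5 :* s :* (b :* s) := (con 4 :* a :+ con 5 :* b) :* (s :* s)) refl C₁ C₂ s ⟩
      d ℕ.* (s ℕ.* s) ≤⟨ ℕₚ.*-monoʳ-≤ d (isqrt-lower n) ⟩
      d ℕ.* n ∎
    1≤M : 1 ℕ.≤ M
    1≤M = s≤s z≤n
    PK≲s : P ℕ.* K ≲[ 1 ] s
    PK≲s = ≲-from-excess (begin
      M ℕ.* (K ℕ.+ (s ℕ./ K) ℕ.* K)   ≤⟨ ℕₚ.*-monoʳ-≤ M (ℕₚ.+-monoʳ-≤ K (m/n*n≤m s K)) ⟩
      M ℕ.* (K ℕ.+ s)                 ≡⟨ solve 3 (λ m k s → m :* (k :+ s) := m :* s :+ m :* k) refl M K s ⟩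
      M ℕ.* s ℕ.+ M ℕ.* K             ≤⟨ ℕₚ.+-monoʳ-≤ (M ℕ.* s) (ℕₚ.≤-trans MK≤s (ℕₚ.≤-reflexive (sym (ℕₚ.*-identityˡ s)))) ⟩
      M ℕ.* s ℕ.+ 1 ℕ.* s             ∎)
    O≲K² : O ≲[ 1 ] K ℕ.* K
    O≲K² = ≲-from-excess (subst₂ ℕ._≤_ (ℕₚ.*-comm O M) (cong₂ ℕ._+_ (ℕₚ.*-comm (K ℕ.* K) M) (sym (ℕₚ.*-identityˡ (K ℕ.* K)))) area)
    chain : O ℕ.* (P ℕ.* K ℕ.* (P ℕ.* K)) ≲[ 3 ] K ℕ.* K ℕ.* (s ℕ.* s)
    chain = ≲-trans {b = 1} 1≤M (≲-trans {b = 1} 1≤M (≲-*ʳ (P ℕ.* K ℕ.* (P ℕ.* K)) O≲K²)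
      (≲-*ˡ (K ℕ.* K) (≲-*ʳ (P ℕ.* K) PK≲s)))
      (≲-*ˡ (K ℕ.* K) (≲-*ˡ s PK≲s))
    MX≤ : M ℕ.* X ℕ.≤ M ℕ.* n ℕ.+ 3 ℕ.* X
    MX≤ = ℕₚ.*-cancelʳ-≤ _ _ (K ℕ.* K) (begin
      M ℕ.* (O ℕ.* (P ℕ.* P)) ℕ.* (K ℕ.* K) ≡⟨ solve 4 (λ m o p k → m :* (o :* (p :* p)) :* (k :* k) := m :* (o :* (p :* k :* (p :* k)))) refl M O P K ⟩
      M ℕ.* (O ℕ.* (P ℕ.* K ℕ.* (P ℕ.* K))) ≤⟨ bound chain ⟩
      M ℕ.* (K ℕ.* K ℕ.* (s ℕ.* s)) ℕ.+ 3 ℕ.* (O ℕ.* (P ℕ.* K ℕ.* (P ℕ.* K))) ≤⟨ ℕₚ.+-monoˡ-≤ _ (ℕₚ.*-monoʳ-≤ M (ℕₚ.*-monoʳ-≤ (K ℕ.* K) (isqrt-lower n))) ⟩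
      M ℕ.* (K ℕ.* K ℕ.* n) ℕ.+ 3 ℕ.* (O ℕ.* (P ℕ.* K ℕ.* (P ℕ.* K)))
        ≡⟨ solve 5 (λ m o p k n → m :* (k :* k :* n) :+ con 3 :* (o :* (p :* k :* (p :* k))) := (m :* n :+ con 3 :* (o :* (p :* p))) :* (k :* k)) refl M O P K n ⟩
      (M ℕ.* n ℕ.+ 3 ℕ.* X) ℕ.* (K ℕ.* K) ∎)
    -- `MX≤` has an error relative to X itself. Since 6 ≤ M, that error is at most half of M X,
    -- which gives this crude bound, and substituting it back makes the error relative to n.
    X≤2n : X ℕ.≤ 2 ℕ.* n
    X≤2n = ℕₚ.*-cancelˡ-≤ M (ℕₚ.+-cancelʳ-≤ (M ℕ.* X) _ _ (begin
      M ℕ.* X ℕ.+ M ℕ.* X                     ≤⟨ ℕₚ.+-mono-≤ MX≤ MX≤ ⟩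
      M ℕ.* n ℕ.+ 3 ℕ.* X ℕ.+ (M ℕ.* n ℕ.+ 3 ℕ.* X) ≡⟨ solve 3 (λ m n x → m :* n :+ con 3 :* x :+ (m :* n :+ con 3 :* x) := m :* (con 2 :* n) :+ con 6 :* x) refl M n X ⟩
      M ℕ.* (2 ℕ.* n) ℕ.+ 6 ℕ.* X             ≤⟨ ℕₚ.+-monoʳ-≤ (M ℕ.* (2 ℕ.* n)) (ℕₚ.*-monoˡ-≤ X 6≤M) ⟩
      M ℕ.* (2 ℕ.* n) ℕ.+ M ℕ.* X             ∎))
    conclude : M ℕ.* N ℕ.≤ M ℕ.* n ℕ.+ (6 ℕ.+ d) ℕ.* n
    conclude = begin
      M ℕ.* N                          ≤⟨ ℕₚ.*-monoʳ-≤ M N≤X+Y ⟩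
      M ℕ.* (X ℕ.+ Y)                  ≡⟨ ℕₚ.*-distribˡ-+ M X Y ⟩
      M ℕ.* X ℕ.+ M ℕ.* Y              ≤⟨ ℕₚ.+-mono-≤ (ℕₚ.≤-trans MX≤ (ℕₚ.+-monoʳ-≤ (M ℕ.* n) (ℕₚ.*-monoʳ-≤ 3 X≤2n))) MY≤ ⟩
      M ℕ.* n ℕ.+ 3 ℕ.* (2 ℕ.* n) ℕ.+ d ℕ.* n ≡⟨ solve 3 (λ m n d → m :+ con 3 :* (con 2 :* n) :+ d :* n := m :+ (con 6 :+ d) :* n) refl (M ℕ.* n) n d ⟩
      M ℕ.* n ℕ.+ (6 ℕ.+ d) ℕ.* n      ∎

-- Powers of the number of tableaux against powers of n

^-distribʳ-* : ∀ k m n → (m ℕ.* n) ℕ.^ k ≡ m ℕ.^ k ℕ.* n ℕ.^ k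
^-distribʳ-* zero    m n = refl
^-distribʳ-* (suc k) m n = trans (cong (m ℕ.* n ℕ.*_) (^-distribʳ-* k m n))
  (solve 4 (λ m n a b → m :* n :* (a :* b) := m :* a :* (n :* b)) refl m n (m ℕ.^ k) (n ℕ.^ k))

^-double : ∀ m k → m ℕ.^ (2 ℕ.* k) ≡ (m ℕ.* m) ℕ.^ k
^-double m k = trans (sym (ℕₚ.^-*-assoc m 2 k)) (cong (λ t → (m ℕ.* t) ℕ.^ k) (ℕₚ.*-identityʳ m))

-- An even exponent lets L enter only through L² ≤ C′ n, where C′ = C² + 1. Of the two additional
-- factors n^n on the right, one pays for the excess of N E over n E and the other for the constant,
-- since C′^(E + 1) ≤ n.
e-power-≤ : ∀ E C n N L x .{{_ : ℕ.NonZero n}} → L ℕ.≤ C ℕ.* isqrt n → N ℕ.* E ℕ.≤ n ℕ.* E ℕ.+ n →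
  suc (C ℕ.* C) ℕ.^ (E ℕ.+ 1) ℕ.≤ n → x ℕ.≤ L ℕ.^ N → x ℕ.^ (2 ℕ.* E) ℕ.≤ n ℕ.^ (n ℕ.* (E ℕ.+ 2))
e-power-≤ E C n N L x L≤ NE≤ large x≤ = begin
  x ℕ.^ (2 ℕ.* E)                       ≤⟨ ℕₚ.^-monoˡ-≤ (2 ℕ.* E) x≤ ⟩
  (L ℕ.^ N) ℕ.^ (2 ℕ.* E)               ≡⟨ trans (ℕₚ.^-*-assoc L N (2 ℕ.* E)) (cong (L ℕ.^_) (solve 2 (λ n e → n :* (con 2 :* e) := con 2 :* (n :* e)) refl N E)) ⟩
  L ℕ.^ (2 ℕ.* (N ℕ.* E))               ≡⟨ ^-double L (N ℕ.* E) ⟩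
  (L ℕ.* L) ℕ.^ (N ℕ.* E)               ≤⟨ ℕₚ.^-monoˡ-≤ (N ℕ.* E) L²≤ ⟩
  (C′ ℕ.* n) ℕ.^ (N ℕ.* E)              ≤⟨ ℕₚ.^-monoʳ-≤ (C′ ℕ.* n) {{ℕₚ.m*n≢0 C′ n}} (ℕₚ.≤-trans NE≤ (ℕₚ.≤-reflexive (solve 2 (λ n e → n :* e :+ n := (e :+ con 1) :* n) refl n E))) ⟩
  (C′ ℕ.* n) ℕ.^ ((E ℕ.+ 1) ℕ.* n)      ≡⟨ ^-distribʳ-* ((E ℕ.+ 1) ℕ.* n) C′ n ⟩
  C′ ℕ.^ ((E ℕ.+ 1) ℕ.* n) ℕ.* n ℕ.^ ((E ℕ.+ 1) ℕ.* n) ≡⟨ cong (ℕ._* n ℕ.^ ((E ℕ.+ 1) ℕ.* n)) (ℕₚ.^-*-assoc C′ (E ℕ.+ 1) n) ⟨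
  (C′ ℕ.^ (E ℕ.+ 1)) ℕ.^ n ℕ.* n ℕ.^ ((E ℕ.+ 1) ℕ.* n) ≤⟨ ℕₚ.*-monoˡ-≤ (n ℕ.^ ((E ℕ.+ 1) ℕ.* n)) (ℕₚ.^-monoˡ-≤ n large) ⟩
  n ℕ.^ n ℕ.* n ℕ.^ ((E ℕ.+ 1) ℕ.* n)   ≡⟨ ℕₚ.^-distribˡ-+-* n n ((E ℕ.+ 1) ℕ.* n) ⟨
  n ℕ.^ (n ℕ.+ (E ℕ.+ 1) ℕ.* n)         ≡⟨ cong (n ℕ.^_) (solve 2 (λ n e → n :+ (e :+ con 1) :* n := n :* (e :+ con 2)) refl n E) ⟩
  n ℕ.^ (n ℕ.* (E ℕ.+ 2))               ∎
  where
  open ℕₚ.≤-Reasoning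
  C′ = suc (C ℕ.* C)
  L²≤ : L ℕ.* L ℕ.≤ C′ ℕ.* n
  L²≤ = begin
    L ℕ.* L                            ≤⟨ ℕₚ.*-mono-≤ L≤ L≤ ⟩
    C ℕ.* isqrt n ℕ.* (C ℕ.* isqrt n)  ≡⟨ solve 2 (λ c s → c :* s :* (c :* s) := c :* c :* (s :* s)) refl C (isqrt n) ⟩
    C ℕ.* C ℕ.* (isqrt n ℕ.* isqrt n)  ≤⟨ ℕₚ.*-monoʳ-≤ (C ℕ.* C) (isqrt-lower n) ⟩
    C ℕ.* C ℕ.* n                      ≤⟨ ℕₚ.m≤n+m (C ℕ.* C ℕ.* n) n ⟩
    C′ ℕ.* n                           ∎

-- The choice t ≈ √n / T makes t log-comparable to √n while keeping the loss
-- t^(r t) in the exponent negligible.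
e-power-≥ : ∀ E C n N r x .{{_ : ℕ.NonZero n}} → let F = E ℕ.+ 3 ; T = suc (2 ℕ.* C ℕ.* F) in
  r ℕ.≤ C ℕ.* isqrt n → T ℕ.≤ isqrt n → n ℕ.* F ℕ.≤ N ℕ.* F ℕ.+ n → T ℕ.^ (2 ℕ.* (E ℕ.+ 1)) ℕ.≤ n →
  (∀ t → 1 ℕ.≤ t → t ℕ.^ N ℕ.≤ x ℕ.* t ℕ.^ (r ℕ.* t)) →
  -- The three units in F = E + 3 have one purpose each. Multiplying both sides by n^n pays for the
  -- powers of T. In `power`, the exponent 2 n F exceeds 2 G by 4 n, of which 2 n pays for N falling
  -- short of n and 2 n for the factor t^(r t).
  n ℕ.^ (n ℕ.* E) ℕ.≤ x ℕ.^ (2 ℕ.* (E ℕ.+ 3))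
e-power-≥ E C n N r x r≤ T≤s nF≤ large count = ℕₚ.*-cancelˡ-≤ (n ℕ.^ n) {{ℕₚ.m^n≢0 n n}} (begin
  n ℕ.^ n ℕ.* n ℕ.^ (n ℕ.* E)            ≡⟨ ℕₚ.^-distribˡ-+-* n n (n ℕ.* E) ⟨
  n ℕ.^ (n ℕ.+ n ℕ.* E)                  ≡⟨ cong (n ℕ.^_) (solve 2 (λ n e → n :+ n :* e := (e :+ con 1) :* n) refl n E) ⟩
  n ℕ.^ G                                ≤⟨ ℕₚ.^-monoˡ-≤ G n≤ ⟩
  ((t ℕ.* t) ℕ.* (T ℕ.* T)) ℕ.^ G        ≡⟨ ^-distribʳ-* G (t ℕ.* t) (T ℕ.* T) ⟩
  (t ℕ.* t) ℕ.^ G ℕ.* (T ℕ.* T) ℕ.^ G    ≡⟨ cong₂ ℕ._*_ (^-double t G) (ℕₚ.^-*-assoc (T ℕ.* T) (E ℕ.+ 1) n) ⟨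
  t ℕ.^ (2 ℕ.* G) ℕ.* ((T ℕ.* T) ℕ.^ (E ℕ.+ 1)) ℕ.^ n ≡⟨ cong (λ y → t ℕ.^ (2 ℕ.* G) ℕ.* y ℕ.^ n) (^-double T (E ℕ.+ 1)) ⟨
  t ℕ.^ (2 ℕ.* G) ℕ.* (T ℕ.^ (2 ℕ.* (E ℕ.+ 1))) ℕ.^ n ≤⟨ ℕₚ.*-mono-≤ power (ℕₚ.^-monoˡ-≤ n large) ⟩
  x ℕ.^ (2 ℕ.* F) ℕ.* n ℕ.^ n            ≡⟨ ℕₚ.*-comm (x ℕ.^ (2 ℕ.* F)) (n ℕ.^ n) ⟩
  n ℕ.^ n ℕ.* x ℕ.^ (2 ℕ.* F)            ∎)
  where
  open ℕₚ.≤-Reasoning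
  s = isqrt n
  F = E ℕ.+ 3
  T = suc (2 ℕ.* C ℕ.* F)
  t = suc (s ℕ./ T)
  G = (E ℕ.+ 1) ℕ.* n
  n≤ : n ℕ.≤ (t ℕ.* t) ℕ.* (T ℕ.* T)
  n≤ = begin
    n                          ≤⟨ ℕₚ.<⇒≤ (isqrt-upper n) ⟩
    suc s ℕ.* suc s            ≤⟨ ℕₚ.*-mono-≤ (m<[1+m/n]*n s T) (m<[1+m/n]*n s T) ⟩
    t ℕ.* T ℕ.* (t ℕ.* T)      ≡⟨ solve 2 (λ a b → a :* b :* (a :* b) := a :* a :* (b :* b)) refl t T ⟩
    (t ℕ.* t) ℕ.* (T ℕ.* T)    ∎
  rtF≤n : r ℕ.* t ℕ.* F ℕ.≤ n
  -- From r ≤ C s and t T ≤ 2 s follows r t T F ≤ 2 C F s², and T exceeds 2 C F.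
  rtF≤n = ℕₚ.*-cancelˡ-≤ T (begin
    T ℕ.* (r ℕ.* t ℕ.* F)      ≡⟨ solve 4 (λ T r t F → T :* (r :* t :* F) := r :* (t :* T) :* F) refl T r t F ⟩
    r ℕ.* (t ℕ.* T) ℕ.* F      ≤⟨ ℕₚ.*-monoˡ-≤ F (ℕₚ.*-mono-≤ r≤ (ℕₚ.+-mono-≤ T≤s (m/n*n≤m s T))) ⟩
    C ℕ.* s ℕ.* (s ℕ.+ s) ℕ.* F ≡⟨ solve 3 (λ c s f → c :* s :* (s :+ s) :* f := con 2 :* c :* f :* (s :* s)) refl C s F ⟩
    2 ℕ.* C ℕ.* F ℕ.* (s ℕ.* s) ≤⟨ ℕₚ.*-mono-≤ (ℕₚ.n≤1+n (2 ℕ.* C ℕ.* F)) (isqrt-lower n) ⟩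
    T ℕ.* n                    ∎)
  power : t ℕ.^ (2 ℕ.* G) ℕ.≤ x ℕ.^ (2 ℕ.* F)
  power = ℕₚ.*-cancelʳ-≤ _ _ (t ℕ.^ (4 ℕ.* n)) {{ℕₚ.m^n≢0 t (4 ℕ.* n)}} (begin
    t ℕ.^ (2 ℕ.* G) ℕ.* t ℕ.^ (4 ℕ.* n)  ≡⟨ ℕₚ.^-distribˡ-+-* t (2 ℕ.* G) (4 ℕ.* n) ⟨
    t ℕ.^ (2 ℕ.* G ℕ.+ 4 ℕ.* n)          ≡⟨ cong (t ℕ.^_) (solve 2 (λ e n → con 2 :* ((e :+ con 1) :* n) :+ con 4 :* n := con 2 :* (n :* (e :+ con 3))) refl E n) ⟩
    t ℕ.^ (2 ℕ.* (n ℕ.* F))              ≤⟨ ℕₚ.^-monoʳ-≤ t (ℕₚ.*-monoʳ-≤ 2 nF≤) ⟩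
    t ℕ.^ (2 ℕ.* (N ℕ.* F ℕ.+ n))        ≡⟨ cong (t ℕ.^_) (solve 3 (λ n f m → con 2 :* (n :* f :+ m) := n :* (con 2 :* f) :+ con 2 :* m) refl N F n) ⟩
    t ℕ.^ (N ℕ.* (2 ℕ.* F) ℕ.+ 2 ℕ.* n)  ≡⟨ ℕₚ.^-distribˡ-+-* t (N ℕ.* (2 ℕ.* F)) (2 ℕ.* n) ⟩
    t ℕ.^ (N ℕ.* (2 ℕ.* F)) ℕ.* t ℕ.^ (2 ℕ.* n) ≡⟨ cong (ℕ._* t ℕ.^ (2 ℕ.* n)) (ℕₚ.^-*-assoc t N (2 ℕ.* F)) ⟨
    (t ℕ.^ N) ℕ.^ (2 ℕ.* F) ℕ.* t ℕ.^ (2 ℕ.* n) ≤⟨ ℕₚ.*-monoˡ-≤ (t ℕ.^ (2 ℕ.* n)) (ℕₚ.^-monoˡ-≤ (2 ℕ.* F) (count t (s≤s z≤n))) ⟩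
    (x ℕ.* t ℕ.^ (r ℕ.* t)) ℕ.^ (2 ℕ.* F) ℕ.* t ℕ.^ (2 ℕ.* n) ≡⟨ cong (ℕ._* t ℕ.^ (2 ℕ.* n)) (trans (^-distribʳ-* (2 ℕ.* F) x (t ℕ.^ (r ℕ.* t)))
        (cong (x ℕ.^ (2 ℕ.* F) ℕ.*_) (trans (ℕₚ.^-*-assoc t (r ℕ.* t) (2 ℕ.* F)) (cong (t ℕ.^_) (solve 2 (λ y f → y :* (con 2 :* f) := con 2 :* (y :* f)) refl (r ℕ.* t) F))))) ⟩
    x ℕ.^ (2 ℕ.* F) ℕ.* t ℕ.^ (2 ℕ.* (r ℕ.* t ℕ.* F)) ℕ.* t ℕ.^ (2 ℕ.* n) ≤⟨ ℕₚ.*-monoˡ-≤ (t ℕ.^ (2 ℕ.* n)) (ℕₚ.*-monoʳ-≤ (x ℕ.^ (2 ℕ.* F)) (ℕₚ.^-monoʳ-≤ t (ℕₚ.*-monoʳ-≤ 2 rtF≤n))) ⟩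
    x ℕ.^ (2 ℕ.* F) ℕ.* t ℕ.^ (2 ℕ.* n) ℕ.* t ℕ.^ (2 ℕ.* n) ≡⟨ ℕₚ.*-assoc (x ℕ.^ (2 ℕ.* F)) _ _ ⟩
    x ℕ.^ (2 ℕ.* F) ℕ.* (t ℕ.^ (2 ℕ.* n) ℕ.* t ℕ.^ (2 ℕ.* n)) ≡⟨ cong (x ℕ.^ (2 ℕ.* F) ℕ.*_) (trans (sym (ℕₚ.^-distribˡ-+-* t (2 ℕ.* n) (2 ℕ.* n)))
        (cong (t ℕ.^_) (solve 1 (λ n → con 2 :* n :+ con 2 :* n := con 4 :* n) refl n))) ⟩
    x ℕ.^ (2 ℕ.* F) ℕ.* t ℕ.^ (4 ℕ.* n)  ∎)

-- The number of cells is asymptotic to n, and the conclusion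

module _ (k m : ℕ) where
  private
    K = suc k
    -- `suc κ` is K², so `frac i κ` is the area of i grid squares.
    κ = k ℕ.+ k ℕ.* suc k
    D = m ℕ.+ κ ℕ.* suc m
    1/m : frac 1 m ≡ frac (suc κ) D
    1/m = frac-cong 1 m (suc κ) D (ℕₚ.*-identityˡ (suc D))

  inner-area : ∀ i → 1ℝ ≤ gridArea k i + fromℚ (frac 1 m) → K ℕ.* K ℕ.* suc m ℕ.≤ i ℕ.* suc m ℕ.+ K ℕ.* K
  inner-area i h = subst₂ ℕ._≤_ (ℕₚ.*-identityˡ (suc D)) (ℕₚ.*-identityʳ (i ℕ.* suc m ℕ.+ suc κ))
    (frac-cancel-≤ 1 0 (i ℕ.* suc m ℕ.+ suc κ) D (subst (1ℚ ℚ.≤_)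
      (trans (cong₂ ℚ._+_ (refine i κ m) 1/m) (frac-+ (i ℕ.* suc m) (suc κ) D))
      (fromℚ-cancel {1ℚ} {frac i κ ℚ.+ frac 1 m} h)))

  outer-area : ∀ o → gridArea k o ≤ 1ℝ + fromℚ (frac 1 m) → o ℕ.* suc m ℕ.≤ K ℕ.* K ℕ.* suc m ℕ.+ K ℕ.* K
  outer-area o h = ℕₚ.*-cancelʳ-≤ _ _ (suc D)
    (frac-cancel-≤ (o ℕ.* suc m) D (suc D ℕ.+ suc κ) D (subst₂ ℚ._≤_ (refine o κ m)
      (trans (cong₂ ℚ._+_ (frac-cong 1 0 (suc D) D (trans (ℕₚ.*-identityˡ (suc D)) (sym (ℕₚ.*-identityʳ (suc D))))) 1/m) (frac-+ (suc D) (suc κ) D))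
      (fromℚ-cancel {frac o κ} {1ℚ ℚ.+ frac 1 m} h)))

bounded : ∀ (J : List (ℕ × ℕ)) → ∃[ B ] (∀ {i j} → (i , j) ∈ J → i ℕ.≤ B × j ℕ.≤ B)
bounded []            = 0 , λ ()
bounded ((x , y) ∷ J) = let (B , h) = bounded J in (x ℕ.+ y) ℕ.+ B , λ
  { (here refl) → ℕₚ.≤-trans (ℕₚ.m≤m+n x y) (ℕₚ.m≤m+n (x ℕ.+ y) B) , ℕₚ.≤-trans (ℕₚ.m≤n+m y x) (ℕₚ.m≤m+n (x ℕ.+ y) B)
  ; (there c∈)  → ℕₚ.≤-trans (proj₁ (h c∈)) (ℕₚ.m≤n+m B (x ℕ.+ y)) , ℕₚ.≤-trans (proj₂ (h c∈)) (ℕₚ.m≤n+m B (x ℕ.+ y)) }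

from-positive : ∀ (Q : ℕ → Set) → Eventually (λ n → .{{_ : ℕ.NonZero n}} → Q n) → Eventually Q
from-positive Q (N , p) = N ℕ.⊔ 1 , λ n h →
  p n (ℕₚ.≤-trans (ℕₚ.m≤m⊔n N 1) h) {{ℕ.>-nonZero (ℕₚ.≤-trans (ℕₚ.m≤n⊔m N 1) h)}}

module _ {a b : ℝ} (0≤a : 0ℝ ≤ a) {ω π : ℝ → ℝ}
  (maps-ω : MapsTo (Icc 0ℝ a) (Icc 0ℝ b) ω) (maps-π : MapsTo (Icc 0ℝ a) (Icc 0ℝ b) π)
  (area : HasArea (RegionBetween a π ω) 1ℝ)
  (υ : ℕ → SkewShape) (stable-ω : HasStableShape (outer ∘ υ) a ω) (stable-π : HasStableShape (inner ∘ υ) a π) where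

  private
    N L R : ℕ → ℕ
    N n = size (υ n)
    L n = ℓ (outer (υ n))
    R n = row (outer (υ n)) 0

    A₀ = proj₁ (ℝ-bound a)
    B₀ = proj₁ (ℝ-bound b)
    C₁ C₂ : ℕ
    C₁ = (A₀ ℕ.+ 1) ℕ.* 2
    C₂ = (B₀ ℕ.+ 1) ℕ.* 2

    suc-absorbed : ∀ {x s} c → 1 ℕ.≤ s → x ℕ.≤ c ℕ.* suc s → x ℕ.≤ c ℕ.* 2 ℕ.* s
    suc-absorbed {x} {s} c 1≤s h = ℕₚ.≤-trans h (ℕₚ.≤-trans (ℕₚ.*-monoʳ-≤ c (ℕₚ.+-monoˡ-≤ s 1≤s))
      (ℕₚ.≤-reflexive (solve 2 (λ c s → c :* (s :+ s) := c :* con 2 :* s) refl c s)))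
      where open ℕSolver.+-*-Solver

    length-bound : Eventually λ n → L n ℕ.≤ C₁ ℕ.* isqrt n
    length-bound = Eventually-map {λ n → L n ℕ.* 1 ℕ.≤ (A₀ ℕ.+ 1) ℕ.* suc (isqrt n) × 1 ℕ.≤ isqrt n}
      (λ n (h , 1≤s) → suc-absorbed (A₀ ℕ.+ 1) 1≤s (subst (ℕ._≤ (A₀ ℕ.+ 1) ℕ.* suc (isqrt n)) (ℕₚ.*-identityʳ (L n)) h))
      (Eventually-× (from-positive (λ n → L n ℕ.* 1 ℕ.≤ (A₀ ℕ.+ 1) ℕ.* suc (isqrt n))
        (stable-ℓ {outer ∘ υ} {a} {ω} {A₀} {0} (proj₂ (ℝ-bound a)) stable-ω)) (isqrt-large 1))

    width-bound : Eventually λ n → R n ℕ.≤ C₂ ℕ.* isqrt n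
    width-bound = Eventually-map {λ n → R n ℕ.≤ (B₀ ℕ.+ 1) ℕ.* suc (isqrt n) × 1 ℕ.≤ isqrt n}
      (λ n (h , 1≤s) → suc-absorbed (B₀ ℕ.+ 1) 1≤s h)
      (Eventually-× (from-positive (λ n → R n ℕ.≤ (B₀ ℕ.+ 1) ℕ.* suc (isqrt n))
        (stable-row₀ {outer ∘ υ} {a} {ω} {b} {B₀} 0≤a maps-ω (proj₂ (ℝ-bound b)) stable-ω)) (isqrt-large 1))

  size-≥ : ∀ E → Eventually λ n → n ℕ.* E ℕ.≤ N n ℕ.* E ℕ.+ n
  size-≥ zero    = 0 , λ n _ → ℕₚ.≤-trans (ℕₚ.≤-reflexive (ℕₚ.*-zeroʳ n)) z≤n
  size-≥ (suc E) =
    -- `suc m` is 6 (E + 1), so the relative loss 6/M becomes 1/(E + 1).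
    let m = E ℕ.+ 5 ℕ.* suc E
        (k , squares) = area (frac 1 m) (frac-pos m)
        ((I , I-unique , I⊑R , I-area) , _) = squares k ℕₚ.≤-refl
        (J , I≡) = nonNeg-squares {a} {b} {ω} {π} maps-π k I I⊑R
        (B , J≤B) = bounded J
        count = inner-count {a} {ω} {π} υ stable-ω stable-π k m J
          (Uniqueₚ.map⁻ {f = emb} (subst Unique I≡ I-unique))
          (λ c∈ → All.lookup (subst (All (λ c → GridSquare k c ⊑ RegionBetween a π ω)) I≡ I⊑R) (∈-map⁺ emb c∈))
          B J≤B
        6≤M = ℕₚ.*-monoʳ-≤ 6 {1} {suc E} (s≤s z≤n)
        |J|-area = subst (λ i → suc k ℕ.* suc k ℕ.* suc m ℕ.≤ i ℕ.* suc m ℕ.+ suc k ℕ.* suc k)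
          (trans (cong length I≡) (length-map emb J)) (inner-area k m (length I) I-area)
    in Eventually-map {λ n → InnerCount k m J B n × inner-threshold k m (length J) B ℕ.≤ isqrt n}
      (λ n (c , large) → scale n (size-asymptotically-≥ k m (length J) B 6≤M |J|-area n (N n) large c))
      (Eventually-× (from-positive (InnerCount k m J B) count) (isqrt-large (inner-threshold k m (length J) B)))
    where
    InnerCount : ℕ → ℕ → List (ℕ × ℕ) → ℕ → ℕ → Set
    InnerCount k m J B n = ∀ P Q →
      B ℕ.+ P ℕ.* suc k ℕ.≤ isqrt n →
      B ℕ.* suc m ℕ.+ suc (isqrt n) ℕ.+ suc Q ℕ.* (suc k ℕ.* suc m) ℕ.≤ m ℕ.* isqrt n →
      length J ℕ.* (P ℕ.* Q) ℕ.≤ N n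
    scale : ∀ n → 6 ℕ.* suc E ℕ.* n ℕ.≤ 6 ℕ.* suc E ℕ.* N n ℕ.+ 6 ℕ.* n → n ℕ.* suc E ℕ.≤ N n ℕ.* suc E ℕ.+ n
    scale n h = ℕₚ.*-cancelˡ-≤ 6 (subst₂ ℕ._≤_
      (solve 2 (λ e n → con 6 :* e :* n := con 6 :* (n :* e)) refl (suc E) n)
      (solve 3 (λ e n m → con 6 :* e :* m :+ con 6 :* n := con 6 :* (m :* e :+ n)) refl (suc E) n (N n)) h)
      where open ℕSolver.+-*-Solver

  size-≤ : ∀ E → Eventually λ n → N n ℕ.* E ℕ.≤ n ℕ.* E ℕ.+ n
  size-≤ zero    = 0 , λ n _ → ℕₚ.≤-trans (ℕₚ.≤-reflexive (ℕₚ.*-zeroʳ (N n))) z≤n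
  size-≤ (suc E) =
    -- `suc m` is (6 + d) (E + 1), chosen to reduce the relative excess (6 + d)/M to 1/(E + 1).
    let m = E ℕ.+ (5 ℕ.+ d) ℕ.* suc E
        (k , squares) = area (frac 1 m) (frac-pos m)
        (_ , (O , covers , O-area)) = squares k ℕₚ.≤-refl
        (A , A≤a , a≤A+3) = nonNeg-approx a 0≤a m
        count = outer-count {a} {ω} {π} υ stable-ω stable-π k m O covers A A≤a
        6≤M = ℕₚ.≤-trans (ℕₚ.*-monoʳ-≤ 6 {1} {suc E} (s≤s z≤n)) (ℕₚ.*-monoˡ-≤ (suc E) (ℕₚ.m≤m+n 6 d))
        threshold = outer-threshold k m (length O) A C₁ C₂
    in Eventually-map {λ n → OuterCount k m O A n × (L n ℕ.* suc m ℕ.≤ (A ℕ.+ 3 ℕ.+ 1) ℕ.* suc (isqrt n) × (L n ℕ.≤ C₁ ℕ.* isqrt n × (R n ℕ.≤ C₂ ℕ.* isqrt n × threshold ℕ.≤ isqrt n)))}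
      (λ n (c , LM≤ , L≤ , R≤ , large) → scale n (size-asymptotically-≤ k m (length O) A C₁ C₂ 6≤M
        (outer-area k m (length O) O-area) n (N n) (L n) (R n) large
        (subst (λ t → L n ℕ.* suc m ℕ.≤ t ℕ.* suc (isqrt n)) (ℕₚ.+-assoc A 3 1) LM≤) L≤ R≤ (λ P c′ U → c P c′ U)))
      (Eventually-× (from-positive (OuterCount k m O A) count)
      (Eventually-× (from-positive (λ n → L n ℕ.* suc m ℕ.≤ (A ℕ.+ 3 ℕ.+ 1) ℕ.* suc (isqrt n)) (stable-ℓ {outer ∘ υ} {a} {ω} {A ℕ.+ 3} {m} a≤A+3 stable-ω))
      (Eventually-× length-bound (Eventually-× width-bound (isqrt-large threshold)))))
    where
    d = 4 ℕ.* C₁ ℕ.+ 5 ℕ.* C₂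
    OuterCount : ℕ → ℕ → List (ℤ × ℤ) → ℕ → ℕ → Set
    OuterCount k m O A n = ∀ P c U .{{_ : ℕ.NonZero P}} →
      isqrt n ℕ.< P ℕ.* suc k → isqrt n ℕ.< c ℕ.* suc m → U ℕ.* suc m ℕ.≤ A ℕ.* isqrt n →
      N n ℕ.≤ length O ℕ.* (P ℕ.* P) ℕ.+ (L n ℕ.* c ℕ.+ (L n ℕ.* c ℕ.+ (L n ℕ.∸ U) ℕ.* R n))
    scale : ∀ n → (6 ℕ.+ d) ℕ.* suc E ℕ.* N n ℕ.≤ (6 ℕ.+ d) ℕ.* suc E ℕ.* n ℕ.+ (6 ℕ.+ d) ℕ.* n → N n ℕ.* suc E ℕ.≤ n ℕ.* suc E ℕ.+ n
    scale n h = ℕₚ.*-cancelˡ-≤ (6 ℕ.+ d) (subst₂ ℕ._≤_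
      (solve 3 (λ c e n → c :* e :* n := c :* (n :* e)) refl (6 ℕ.+ d) (suc E) (N n))
      (solve 4 (λ c e n m → c :* e :* m :+ c :* n := c :* (m :* e :+ n)) refl (6 ℕ.+ d) (suc E) n n) h)
      where open ℕSolver.+-*-Solver

  e-powers : ∀ E → Eventually λ n → 1 ℕ.≤ e (υ n) ×
    n ℕ.^ (n ℕ.* E) ℕ.≤ e (υ n) ℕ.^ (2 ℕ.* (E ℕ.+ 3)) × e (υ n) ℕ.^ (2 ℕ.* E) ℕ.≤ n ℕ.^ (n ℕ.* (E ℕ.+ 2))
  e-powers E =
    let (M , p) = Eventually-× (Eventually-× (size-≥ F) (size-≤ E)) (Eventually-× (Eventually-× length-bound width-bound)
          (Eventually-× (isqrt-large T) (Eventually-× (Eventually-≥ (T ℕ.^ (2 ℕ.* (E ℕ.+ 1))))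
            (Eventually-× (Eventually-≥ (suc (C₁ ℕ.* C₁) ℕ.^ (E ℕ.+ 1))) (Eventually-≥ 1)))))
    in M , λ n h → let ((nF≤ , NE≤) , (L≤ , R≤) , T≤s , T^≤n , C^≤n , 1≤n) = p n h in
      e-positive (υ n) , lower n {{ℕ.>-nonZero 1≤n}} nF≤ L≤ R≤ T≤s T^≤n ,
      e-power-≤ E C₁ n (N n) (L n) (e (υ n)) {{ℕ.>-nonZero 1≤n}} L≤ NE≤ C^≤n (e-upper (υ n))
    where
    F = E ℕ.+ 3
    T = suc (2 ℕ.* (C₁ ℕ.+ C₂) ℕ.* F)
    lower : ∀ n .{{_ : ℕ.NonZero n}} → n ℕ.* F ℕ.≤ N n ℕ.* F ℕ.+ n → L n ℕ.≤ C₁ ℕ.* isqrt n → R n ℕ.≤ C₂ ℕ.* isqrt n →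
      T ℕ.≤ isqrt n → T ℕ.^ (2 ℕ.* (E ℕ.+ 1)) ℕ.≤ n → n ℕ.^ (n ℕ.* E) ℕ.≤ e (υ n) ℕ.^ (2 ℕ.* F)
    lower n nF≤ L≤ R≤ T≤s T^≤n = e-power-≥ E (C₁ ℕ.+ C₂) n (N n) (L n ℕ.+ R n) (e (υ n))
      (ℕₚ.≤-trans (ℕₚ.+-mono-≤ L≤ R≤) (ℕₚ.≤-reflexive (sym (ℕₚ.*-distribʳ-+ (isqrt n) C₁ C₂)))) T≤s nF≤ T^≤n (e-lower (υ n))
    e-positive : ∀ υ → 1 ℕ.≤ e υ
    -- The lower bound for t = 1 states that there is at least one tableau.
    e-positive υ = ℕₚ.≤-trans (ℕₚ.≤-reflexive (sym (ℕₚ.^-zeroˡ (size υ))))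
      (ℕₚ.≤-trans (e-lower υ 1 ℕₚ.≤-refl) (ℕₚ.≤-reflexive
        (trans (cong (e υ ℕ.*_) (ℕₚ.^-zeroˡ ((ℓ (outer υ) ℕ.+ row (outer υ) 0) ℕ.* 1))) (ℕₚ.*-identityʳ (e υ)))))

theorem6p1 : (a b : ℝ) → 0ℝ ≤ a →
    (ω π : ℝ → ℝ) →
    MapsTo (Icc 0ℝ a) (Icc 0ℝ b) ω →
    MapsTo (Icc 0ℝ a) (Icc 0ℝ b) π →
    ContinuousOn (Icc 0ℝ a) ω →
    ContinuousOn (Icc 0ℝ a) π →
    NonIncreasingOn (Icc 0ℝ a) ω →
    NonIncreasingOn (Icc 0ℝ a) π →
    (∀ x → Icc 0ℝ a x → π x ≤ ω x) →
    HasArea (RegionBetween a π ω) 1ℝ →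
    (υ : ℕ → SkewShape) →
    (∀ n → Connected (υ n)) →
    HasStableShape (outer ∘ υ) a ω →
    HasStableShape (inner ∘ υ) a π →
    (λ n → ln (e (υ n))) ∼ (λ n → fromℚ ½ * fromℕ n * ln n)
theorem6p1 a b 0≤a ω π maps-ω maps-π _ _ _ _ _ area υ _ stable-ω stable-π =
  log-asymptotics (λ n → e (υ n)) (e-powers {a} {b} 0≤a {ω} {π} maps-ω maps-π area υ stable-ω stable-π)
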